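{- Let $k\geq 2$ be an integer and let $\alpha\in[\frac{k-1}{k},1]$ be rational. Let $\ell$ be the smallest positive integer such that $\frac{\ell}{2k-1}$ and $\frac{\alpha\ell}{2k-1}$ are integers. There exist integers $s_0,q_0$ such that for every integer $s\geq s_0$ and every prime power $q\geq q_0$ there exists a bipartite graph $G$ with parts $M,N$, $|M|=q^{\alpha\ell}$, $|N|=q^{\ell}$, such that $G$ is $\Theta_{s,2k-1}$-free and \[e(G)\geq \frac12 |M|^{\frac{k}{2k-1}}|N|^{\frac{k}{2k-1}}.\]
   Context: The theta graph $\Theta_{s,k}$ is the graph consisting of $s$ paths of length $k$ with the same two endpoints that are otherwise pairwise vertex-disjoint. -}

module Defs where

open import Data.Nat using (ℕ; zero; suc; _+_; _*_; _∸_; _^_; _≤_; _<_)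
open import Data.Nat.Primality using (Prime)
open import Data.Fin using (Fin; toℕ)
open import Data.Bool using (Bool; true; false; if_then_else_; T)
open import Data.List using (List; map; allFin)
open import Data.Nat.ListAction using (sum)
open import Data.Sum using (_⊎_; inj₁; inj₂)
open import Data.Product using (Σ; ∃; ∃-syntax; _×_; _,_)
open import Data.Empty using (⊥)
open import Data.Integer using (ℤ; +_)
open import Data.Rational using (ℚ; _/_) renaming (_*_ to _*ℚ_)
open import Relation.Binary.PropositionalEquality using (_≡_)
open import Relation.Nullary using (¬_)
open import Function.Definitions using (Injective)

record Graph : Set₁ where
  field
    V   : Set
    Adj : V → V → Set

open Graph public

Contains : Graph → Graph → Set
Contains G H =
  Σ (V H → V G) λ f → Injective _≡_ _≡_ f ×
    (∀ u v → Adj H u v → Adj G (f u) (f v))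

FreeOf : Graph → Graph → Set
FreeOf H G = ¬ Contains G H

-- Theta graph Θ_{s,L}: two endpoints (left, right) joined by s internally
-- vertex-disjoint paths of length L; path i has inner vertices
-- inner i 0, ..., inner i (L-2), where inner i j is at distance j+1 from left.
data ThetaV (s L : ℕ) : Set where
  left right : ThetaV s L
  inner : Fin s → Fin (L ∸ 1) → ThetaV s L

ThetaAdj : (s L : ℕ) → ThetaV s L → ThetaV s L → Set
ThetaAdj s L left right = L ≡ 1
ThetaAdj s L right left = L ≡ 1
ThetaAdj s L left (inner i j) = toℕ j ≡ 0
ThetaAdj s L (inner i j) left = toℕ j ≡ 0
ThetaAdj s L (inner i j) right = suc (toℕ j) ≡ L ∸ 1
ThetaAdj s L right (inner i j) = suc (toℕ j) ≡ L ∸ 1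
ThetaAdj s L (inner i j) (inner i′ j′) =
  i ≡ i′ × (suc (toℕ j) ≡ toℕ j′ ⊎ suc (toℕ j′) ≡ toℕ j)
ThetaAdj s L left left = ⊥
ThetaAdj s L right right = ⊥

Theta : ℕ → ℕ → Graph
Theta s L = record { V = ThetaV s L ; Adj = ThetaAdj s L }

BipGraph : (m n : ℕ) → (Fin m → Fin n → Bool) → Graph
BipGraph m n E = record { V = Fin m ⊎ Fin n ; Adj = adj }
  where
  adj : Fin m ⊎ Fin n → Fin m ⊎ Fin n → Set
  adj (inj₁ a) (inj₂ b) = T (E a b)
  adj (inj₂ b) (inj₁ a) = T (E a b)
  adj (inj₁ _) (inj₁ _) = ⊥
  adj (inj₂ _) (inj₂ _) = ⊥

edges : (m n : ℕ) → (Fin m → Fin n → Bool) → ℕ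
edges m n E =
  sum (map (λ a → sum (map (λ b → if E a b then 1 else 0) (allFin n))) (allFin m))

IsPrimePower : ℕ → Set
IsPrimePower q = ∃[ p ] ∃[ e ] (Prime p × 1 ≤ e × q ≡ p ^ e)

DivInt : ℕ → ℚ → Set
DivInt d x = ∃[ z ] x ≡ (+ d / 1) *ℚ (z / 1)

GoodL : ℕ → ℚ → ℕ → Set
GoodL k α ℓ = 1 ≤ ℓ × DivInt (2 * k ∸ 1) (+ ℓ / 1) × DivInt (2 * k ∸ 1) (α *ℚ (+ ℓ / 1))

IsLeastL : ℕ → ℚ → ℕ → Set
IsLeastL k α ℓ = GoodL k α ℓ × (∀ ℓ′ → GoodL k α ℓ′ → ℓ ≤ ℓ′)

{-# OPTIONS --safe #-}
module Submission where

-- Let P be a prime with q ≤ P ≤ 16q (Chebyshev) and F = ℤ/P.  Join x = (ξ,p) ∈ [q]^(A+m) to y ∈ [q]^ℓ when p is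
-- the rounding to [q] of g(ξ,y), where g : F^(A+ℓ) → F^m is a polynomial map of bounded degree; this graph has
-- exactly q^(A+ℓ) edges.  Paths of length 2k−1 between u and v are zeros of boundedly many square polynomial systems,
-- one for each choice of rounding errors.
--
-- Such a system has boundedly many nonsingular zeros: lift N of them to power series with f_j = t^(r^j), so that
-- the polynomials of degree O(N) already realise all N·rⁿ coefficients modulo t^(rⁿ).
--
-- A singular zero carries a tangent vector.  Any set of unknowns of a path is at most as large as the set of
-- equations on the edges it meets (this is where α ≥ (k−1)/k enters), so for random g each further disjoint singular
-- path between u and v costs a factor O(1/P).  Hence for some g no u, v are joined by more than a + ℓ disjoint singular
-- paths of the same type, and a theta graph with many paths is impossible.

open import Defs
open import Algebra.Bundles using (CommutativeRing)
open import Algebra.Structures using (IsCommutativeRing)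
import Algebra.Solver.Ring.NaturalCoefficients.Default as RingSolve
open import Data.Bool using (Bool; true; false; if_then_else_; T; not)
import Data.Bool.Properties as Boolₚ
open import Data.Fin as Fin using (Fin; zero; suc; toℕ; fromℕ; fromℕ<; inject₁; inject≤; lower₁; punchOut; cast; combine; remQuot; splitAt; _↑ˡ_; _↑ʳ_; finToFun; funToFin)
open import Data.Fin.Properties as Finₚ using (any?; all?; _≟_)
open import Data.List using ([]; _∷_; tabulate)
import Data.List.Properties as Listₚ
open import Data.List.Relation.Unary.All using (_∷_)
open import Data.Nat as ℕ using (ℕ; zero; suc; _^_; _∸_; _≤_; _<_; z≤n; s≤s; ⌊_/2⌋; ⌈_/2⌉; NonZero)
open import Data.Nat.ListAction using (sum; product)
open import Data.Nat.Primality using (Prime; prime?; euclidsLemma; prime⇒nonZero; prime⇒nonTrivial; ¬prime[1])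
import Data.Nat.Properties as ℕₚ
open import Data.Nat.Solver using (module +-*-Solver)
open import Data.Product using (Σ; ∃; ∃-syntax; _×_; _,_; proj₁; proj₂)
open import Data.Sum using (_⊎_; inj₁; inj₂; [_,_]′)
import Data.Sum.Properties as Sumₚ
open import Function using (_∘_)
open import Function.Definitions using (Injective)
open import Level using (0ℓ)
open import Relation.Binary.PropositionalEquality hiding (J)
open import Relation.Nullary using (¬_; yes; no; ¬?; Dec; contradiction)
open import Relation.Nullary.Decidable using (decidable-stable; _×-dec_; _→-dec_; ⌊_⌋; toWitness)

-- Power series, polynomials and polynomial expressions over a finite field

-- The random algebraic method usually rests on a dichotomy from algebraic geometry: a variety of
-- bounded complexity has few points or about P of them. Here the dichotomy is between zeros with
-- injective and with non-injective derivative, and both sides are settled by injections between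
-- finite sets. The sizes are forced. With e₀ = (a+ℓ)/(2k-1) there are q^(k·e₀) edges, so A+ℓ = k·e₀
-- and m = (k-1)·e₀; a path has (k-1)(a+ℓ) unknown coordinates and (2k-1)·m equations, and these
-- numbers agree. Rarity of singular families is proved by encoding. Add to a bad g interpolants
-- with arbitrary values and arbitrary derivatives along the tangents at all edges of J paths. The
-- sum, the points and the tangents determine g and the interpolants, and one normalised tangent
-- coordinate per path is free to carry an element of F. The obstacle is an edge along which the
-- tangent does not move the argument of g: no derivative can be read there, so its parameters must
-- be stored in tangent coordinates known to vanish. There are q^(a+ℓ) pairs u, v, so J = a+ℓ+1
-- beats the union bound; with P ≤ 16q all other factors are bounded independently of q.

record FiniteField (P : ℕ) : Set where
  infixl 6 _+_
  infixl 7 _*_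
  infix  8 -_
  field
    _+_ _*_           : Fin P → Fin P → Fin P
    -_                : Fin P → Fin P
    0# 1#             : Fin P
    isCommutativeRing : IsCommutativeRing _≡_ _+_ _*_ -_ 0# 1#
    inv               : Fin P → Fin P
    inverseʳ          : ∀ {x} → x ≢ 0# → x * inv x ≡ 1#
    1≢0               : 1# ≢ 0#

  commutativeRing : CommutativeRing 0ℓ 0ℓ
  commutativeRing = record { isCommutativeRing = isCommutativeRing }

module PowerSeries {P : ℕ} (𝔽 : FiniteField P) where

  open FiniteField 𝔽 public
  open CommutativeRing commutativeRing public
    using ( +-assoc; +-comm; +-identityˡ; +-identityʳ; *-assoc; *-comm; *-identityˡ; *-identityʳ
          ; distribˡ; distribʳ; zeroˡ; zeroʳ; -‿inverseˡ; -‿inverseʳ; commutativeSemiring; ring)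
  open import Algebra.Properties.Ring ring public
    using (-‿distribˡ-*; -‿distribʳ-*; +-cancelˡ; +-cancelʳ)
  module FSolver = RingSolve commutativeSemiring

  F : Set
  F = Fin P

  Series : Set
  Series = ℕ → F

  infixl 6 _⊞_
  infixl 7 _⊛_

  ι : F → Series
  ι c zero    = c
  ι c (suc _) = 0#

  _⊞_ : Series → Series → Series
  (a ⊞ b) n = a n + b n

  -- The Cauchy product, by splitting off the constant term of the left factor: `a` is `a 0` plus t
  -- times `a ∘ suc`. Identities then go by induction on the index of the coefficient, with the
  -- series generalised.
  _⊛_ : Series → Series → Series
  (a ⊛ b) zero    = a 0 * b 0
  (a ⊛ b) (suc n) = a 0 * b (suc n) + ((a ∘ suc) ⊛ b) n

  ⊛-cong : ∀ {a a′ b b′} → a ≗ a′ → b ≗ b′ → a ⊛ b ≗ a′ ⊛ b′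
  ⊛-cong p r zero    = cong₂ _*_ (p 0) (r 0)
  ⊛-cong p r (suc n) = cong₂ _+_ (cong₂ _*_ (p 0) (r (suc n))) (⊛-cong (p ∘ suc) r n)

  ⊛-sucʳ : ∀ a b n → (a ⊛ b) (suc n) ≡ a (suc n) * b 0 + (a ⊛ (b ∘ suc)) n
  ⊛-sucʳ a b zero    = +-comm _ _
  ⊛-sucʳ a b (suc n) = begin
    a 0 * b (2 ℕ.+ n) + ((a ∘ suc) ⊛ b) (suc n)
      ≡⟨ cong (a 0 * b (2 ℕ.+ n) +_) (⊛-sucʳ (a ∘ suc) b n) ⟩
    a 0 * b (2 ℕ.+ n) + (a (2 ℕ.+ n) * b 0 + ((a ∘ suc) ⊛ (b ∘ suc)) n)
      ≡⟨ solve 3 (λ x y z → x :+ (y :+ z) := y :+ (x :+ z)) refl _ _ _ ⟩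
    a (2 ℕ.+ n) * b 0 + (a 0 * b (2 ℕ.+ n) + ((a ∘ suc) ⊛ (b ∘ suc)) n) ∎
    where open ≡-Reasoning
          open FSolver

  ⊛-comm : ∀ a b → a ⊛ b ≗ b ⊛ a
  ⊛-comm a b zero    = *-comm _ _
  ⊛-comm a b (suc n) = trans (cong₂ _+_ (*-comm _ _) (⊛-comm (a ∘ suc) b n)) (sym (⊛-sucʳ b a n))

  ⊛-distribʳ : ∀ c a b → (a ⊞ b) ⊛ c ≗ (a ⊛ c) ⊞ (b ⊛ c)
  ⊛-distribʳ c a b zero    = distribʳ _ _ _
  ⊛-distribʳ c a b (suc n) = trans (cong₂ _+_ (distribʳ _ _ _) (⊛-distribʳ c (a ∘ suc) (b ∘ suc) n))
    (solve 4 (λ x y z w → (x :+ y) :+ (z :+ w) := (x :+ z) :+ (y :+ w)) refl _ _ _ _)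
    where open FSolver

  ⊛-distribˡ : ∀ c a b → c ⊛ (a ⊞ b) ≗ (c ⊛ a) ⊞ (c ⊛ b)
  ⊛-distribˡ c a b n = trans (⊛-comm c (a ⊞ b) n)
    (trans (⊛-distribʳ c a b n) (cong₂ _+_ (⊛-comm a c n) (⊛-comm b c n)))

  ⊛-scaleˡ : ∀ x a b → (λ n → x * a n) ⊛ b ≗ λ n → x * (a ⊛ b) n
  ⊛-scaleˡ x a b zero    = *-assoc _ _ _
  ⊛-scaleˡ x a b (suc n) = trans (cong₂ _+_ (*-assoc _ _ _) (⊛-scaleˡ x (a ∘ suc) b n)) (sym (distribˡ _ _ _))

  ⊛-assoc : ∀ a b c → (a ⊛ b) ⊛ c ≗ a ⊛ (b ⊛ c)
  ⊛-assoc a b c zero    = *-assoc _ _ _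
  ⊛-assoc a b c (suc n) = begin
    a 0 * b 0 * c (suc n) + (((a ⊛ b) ∘ suc) ⊛ c) n
      ≡⟨ cong (a 0 * b 0 * c (suc n) +_) (trans (⊛-distribʳ c (λ k → a 0 * b (suc k)) ((a ∘ suc) ⊛ b) n)
           (cong₂ _+_ (⊛-scaleˡ (a 0) (b ∘ suc) c n) (⊛-assoc (a ∘ suc) b c n))) ⟩
    a 0 * b 0 * c (suc n) + (a 0 * ((b ∘ suc) ⊛ c) n + ((a ∘ suc) ⊛ (b ⊛ c)) n)
      ≡⟨ solve 5 (λ x y z u v → x :* y :* z :+ (x :* u :+ v) := x :* (y :* z :+ u) :+ v) refl _ _ _ _ _ ⟩
    a 0 * (b 0 * c (suc n) + ((b ∘ suc) ⊛ c) n) + ((a ∘ suc) ⊛ (b ⊛ c)) n ∎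
    where open ≡-Reasoning
          open FSolver

  ⊛-zeroˡ : ∀ a b → (∀ n → a n ≡ 0#) → ∀ n → (a ⊛ b) n ≡ 0#
  ⊛-zeroˡ a b a≡0 zero    = trans (cong (_* b 0) (a≡0 0)) (zeroˡ _)
  ⊛-zeroˡ a b a≡0 (suc n) = trans (cong₂ _+_ (trans (cong (_* b (suc n)) (a≡0 0)) (zeroˡ _))
    (⊛-zeroˡ (a ∘ suc) b (a≡0 ∘ suc) n)) (+-identityˡ _)

  ι-⊛ : ∀ c a n → (ι c ⊛ a) n ≡ c * a n
  ι-⊛ c a zero    = refl
  ι-⊛ c a (suc n) = trans (cong (c * a (suc n) +_) (⊛-zeroˡ (ι c ∘ suc) a (λ _ → refl) n)) (+-identityʳ _)

  -- p +x* p′ stands for p(x₁,…) + x₀ p′(x₀,x₁,…), so degree d is total degree.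
  data Poly : ℕ → ℕ → Set where
    con   : ∀ {d} → F → Poly 0 d
    base  : ∀ {n} → F → Poly (suc n) 0
    _+x*_ : ∀ {n d} → Poly n (suc d) → Poly (suc n) d → Poly (suc n) (suc d)

  -- The binomial coefficient n+d over n, which is the number of coefficients of a `Poly n d`.
  κ : ℕ → ℕ → ℕ
  κ zero    d       = 1
  κ (suc n) zero    = 1
  κ (suc n) (suc d) = κ n (suc d) ℕ.+ κ (suc n) d

  ⟦_⟧ : ∀ {n d} → Poly n d → (Fin n → Series) → Series
  ⟦ con c ⟧    Z = ι c
  ⟦ base c ⟧   Z = ι c
  ⟦ p +x* p′ ⟧ Z = ⟦ p ⟧ (Z ∘ suc) ⊞ (Z zero ⊛ ⟦ p′ ⟧ Z)

  constP : ∀ {n d} → F → Poly n d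
  constP {zero}          c = con c
  constP {suc n} {zero}  c = base c
  constP {suc n} {suc d} c = constP c +x* constP 0#

  weaken : ∀ {n d} → Poly n d → Poly n (suc d)
  weaken (con c)    = con c
  weaken (base c)   = constP c
  weaken (p +x* p′) = weaken p +x* weaken p′

  addP : ∀ {n d} → Poly n d → Poly n d → Poly n d
  addP (con a)    (con b)    = con (a + b)
  addP (base a)   (base b)   = base (a + b)
  addP (p +x* p′) (r +x* r′) = addP p r +x* addP p′ r′

  scaleP : ∀ {n d} → F → Poly n d → Poly n d
  scaleP x (con a)    = con (x * a)
  scaleP x (base a)   = base (x * a)
  scaleP x (p +x* p′) = scaleP x p +x* scaleP x p′

  mulVar : ∀ {n d} → Fin n → Poly n d → Poly n (suc d)
  mulVar zero    p          = constP 0# +x* p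
  mulVar (suc i) (base c)   = mulVar i (constP c) +x* base 0#
  mulVar (suc i) (p +x* p′) = mulVar i p +x* mulVar (suc i) p′

  ⟦⟧-cong : ∀ {n d} (p : Poly n d) {Z Z′} → (∀ i → Z i ≗ Z′ i) → ⟦ p ⟧ Z ≗ ⟦ p ⟧ Z′
  ⟦⟧-cong (con c)    eq k = refl
  ⟦⟧-cong (base c)   eq k = refl
  ⟦⟧-cong (p +x* p′) eq k = cong₂ _+_ (⟦⟧-cong p (eq ∘ suc) k) (⊛-cong (eq zero) (⟦⟧-cong p′ eq) k)

  private
    x0 : ∀ a {b} → (∀ n → b n ≡ 0#) → ∀ n → (a ⊛ b) n ≡ 0#
    x0 a b≡0 n = trans (⊛-comm a _ n) (⊛-zeroˡ _ a b≡0 n)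

    ι0 : ∀ n → ι 0# n ≡ 0#
    ι0 zero    = refl
    ι0 (suc n) = refl

  ⟦constP⟧ : ∀ {n d} c Z → ⟦ constP {n} {d} c ⟧ Z ≗ ι c
  ⟦constP⟧ {zero}          c Z k = refl
  ⟦constP⟧ {suc n} {zero}  c Z k = refl
  ⟦constP⟧ {suc n} {suc d} c Z k = trans
    (cong₂ _+_ (⟦constP⟧ {n} {suc d} c _ k) (x0 (Z zero) (λ j → trans (⟦constP⟧ {suc n} {d} 0# Z j) (ι0 j)) k))
    (+-identityʳ _)

  ⟦weaken⟧ : ∀ {n d} (p : Poly n d) Z → ⟦ weaken p ⟧ Z ≗ ⟦ p ⟧ Z
  ⟦weaken⟧ (con c)        Z k = refl
  ⟦weaken⟧ (base {n} c)   Z k = ⟦constP⟧ {suc n} {1} c Z k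
  ⟦weaken⟧ (p +x* p′)     Z k = cong₂ _+_ (⟦weaken⟧ p _ k) (⊛-cong (λ _ → refl) (⟦weaken⟧ p′ Z) k)

  ⟦addP⟧ : ∀ {n d} (p r : Poly n d) Z → ⟦ addP p r ⟧ Z ≗ ⟦ p ⟧ Z ⊞ ⟦ r ⟧ Z
  ⟦addP⟧ (con a) (con b) Z zero    = refl
  ⟦addP⟧ (con a) (con b) Z (suc k) = sym (+-identityˡ _)
  ⟦addP⟧ (base a) (base b) Z zero    = refl
  ⟦addP⟧ (base a) (base b) Z (suc k) = sym (+-identityˡ _)
  ⟦addP⟧ (p +x* p′) (r +x* r′) Z k = trans
    (cong₂ _+_ (⟦addP⟧ p r _ k) (trans (⊛-cong (λ _ → refl) (⟦addP⟧ p′ r′ Z) k) (⊛-distribˡ (Z zero) _ _ k)))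
    (solve 4 (λ x y z w → (x :+ y) :+ (z :+ w) := (x :+ z) :+ (y :+ w)) refl _ _ _ _)
    where open FSolver

  ⟦scaleP⟧ : ∀ {n d} x (p : Poly n d) Z k → ⟦ scaleP x p ⟧ Z k ≡ x * ⟦ p ⟧ Z k
  ⟦scaleP⟧ x (con a)  Z zero    = refl
  ⟦scaleP⟧ x (con a)  Z (suc k) = sym (zeroʳ _)
  ⟦scaleP⟧ x (base a) Z zero    = refl
  ⟦scaleP⟧ x (base a) Z (suc k) = sym (zeroʳ _)
  ⟦scaleP⟧ x (p +x* p′) Z k = trans (cong₂ _+_ (⟦scaleP⟧ x p _ k)
    (trans (⊛-cong (λ _ → refl) (⟦scaleP⟧ x p′ Z) k)
    (trans (⊛-comm (Z zero) _ k) (trans (⊛-scaleˡ x _ (Z zero) k) (cong (x *_) (⊛-comm _ (Z zero) k))))))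
    (sym (distribˡ _ _ _))

  ⟦mulVar⟧ : ∀ {n d} i (p : Poly n d) Z → ⟦ mulVar i p ⟧ Z ≗ Z i ⊛ ⟦ p ⟧ Z
  ⟦mulVar⟧ {suc n} {d} zero p Z k = trans
    (cong (_+ (Z zero ⊛ ⟦ p ⟧ Z) k) (trans (⟦constP⟧ {n} {suc d} 0# (Z ∘ suc) k) (ι0 k))) (+-identityˡ _)
  ⟦mulVar⟧ (suc i) (base c) Z k = trans
    (cong₂ _+_ (trans (⟦mulVar⟧ {d = 0} i (constP c) (Z ∘ suc) k) (⊛-cong (λ _ → refl) (⟦constP⟧ {d = 0} c (Z ∘ suc)) k))
               (x0 (Z zero) ι0 k)) (+-identityʳ _)
  ⟦mulVar⟧ (suc i) (p +x* p′) Z k = begin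
    ⟦ mulVar i p ⟧ (Z ∘ suc) k + (Z zero ⊛ ⟦ mulVar (suc i) p′ ⟧ Z) k
      ≡⟨ cong₂ _+_ (⟦mulVar⟧ i p (Z ∘ suc) k) (⊛-cong (λ _ → refl) (⟦mulVar⟧ (suc i) p′ Z) k) ⟩
    (Zᵢ ⊛ a) k + (Z zero ⊛ (Zᵢ ⊛ b)) k
      ≡⟨ cong ((Zᵢ ⊛ a) k +_) (trans (sym (⊛-assoc (Z zero) Zᵢ b k))
           (trans (⊛-cong (⊛-comm (Z zero) Zᵢ) (λ _ → refl) k) (⊛-assoc Zᵢ (Z zero) b k))) ⟩
    (Zᵢ ⊛ a) k + (Zᵢ ⊛ (Z zero ⊛ b)) k
      ≡⟨ sym (⊛-distribˡ Zᵢ a (Z zero ⊛ b) k) ⟩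
    (Zᵢ ⊛ (a ⊞ (Z zero ⊛ b))) k ∎
    where open ≡-Reasoning
          Zᵢ = Z (suc i)
          a  = ⟦ p ⟧ (Z ∘ suc)
          b  = ⟦ p′ ⟧ Z

  -- Cancellation holds for the coefficients themselves, not only for values; this lets a polynomial
  -- be recovered from its sum with a known perturbation.
  addP-cancelʳ : ∀ {n d} (p r s : Poly n d) → addP p s ≡ addP r s → p ≡ r
  addP-cancelʳ (con a) (con b) (con c) eq with con-inj eq
    where con-inj : ∀ {d} {x y : F} → con {d} x ≡ con y → x ≡ y
          con-inj refl = refl
  ... | e = cong con (+-cancelʳ c a b e)
  addP-cancelʳ (base a) (base b) (base c) eq with base-inj eq
    where base-inj : ∀ {n} {x y : F} → base {n} x ≡ base y → x ≡ y
          base-inj refl = refl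
  ... | e = cong base (+-cancelʳ c a b e)
  addP-cancelʳ (p +x* p′) (r +x* r′) (s +x* s′) eq =
    cong₂ _+x*_ (addP-cancelʳ p r s (hd eq)) (addP-cancelʳ p′ r′ s′ (tl eq))
    where hd : ∀ {n d} {x x′ : Poly n (suc d)} {y y′ : Poly (suc n) d} → x +x* y ≡ x′ +x* y′ → x ≡ x′
          hd refl = refl
          tl : ∀ {n d} {x x′ : Poly n (suc d)} {y y′ : Poly (suc n) d} → x +x* y ≡ x′ +x* y′ → y ≡ y′
          tl refl = refl

  infixl 6 _⊕_
  infixl 7 _⊗_

  -- Two representations coexist: `Tree` has products and serves to write interpolants, while `Poly`
  -- has a fixed number of coefficients and serves to count.
  data Tree (n : ℕ) : Set where
    con     : F → Tree n
    var     : Fin n → Tree n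
    _⊕_ _⊗_ : Tree n → Tree n → Tree n

  deg : ∀ {n} → Tree n → ℕ
  deg (con _) = 0
  deg (var _) = 1
  deg (f ⊕ g) = deg f ℕ.⊔ deg g
  deg (f ⊗ g) = deg f ℕ.+ deg g

  eval : ∀ {n} → Tree n → (Fin n → Series) → Series
  eval (con c) Z = ι c
  eval (var i) Z = Z i
  eval (f ⊕ g) Z = eval f Z ⊞ eval g Z
  eval (f ⊗ g) Z = eval f Z ⊛ eval g Z

  eval-cong : ∀ {n} (f : Tree n) {Z Z′} → (∀ i → Z i ≗ Z′ i) → eval f Z ≗ eval f Z′
  eval-cong (con c) eq k = refl
  eval-cong (var i) eq k = eq i k
  eval-cong (f ⊕ g) eq k = cong₂ _+_ (eval-cong f eq k) (eval-cong g eq k)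
  eval-cong (f ⊗ g) eq k = ⊛-cong (eval-cong f eq) (eval-cong g eq) k

  weakenTo : ∀ {n d e} → d ℕ.≤′ e → Poly n d → Poly n e
  weakenTo ℕ.≤′-refl       p = p
  weakenTo (ℕ.≤′-step d≤e) p = weaken (weakenTo d≤e p)

  ⟦weakenTo⟧ : ∀ {n d e} (d≤e : d ℕ.≤′ e) (p : Poly n d) Z → ⟦ weakenTo d≤e p ⟧ Z ≗ ⟦ p ⟧ Z
  ⟦weakenTo⟧ ℕ.≤′-refl       p Z k = refl
  ⟦weakenTo⟧ (ℕ.≤′-step d≤e) p Z k = trans (⟦weaken⟧ (weakenTo d≤e p) Z k) (⟦weakenTo⟧ d≤e p Z k)

  -- Multiplying an accumulator by an expression needs only sums, scalars and single variables, so a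
  -- product of two coefficient forms never has to be defined.
  mulTree : ∀ {n d} e (f : Tree n) → deg f ℕ.+ d ≤ e → Poly n d → Poly n e
  mulTree e (con c) d≤e p = weakenTo (ℕₚ.≤⇒≤′ d≤e) (scaleP c p)
  mulTree e (var i) d≤e p = weakenTo (ℕₚ.≤⇒≤′ d≤e) (mulVar i p)
  mulTree {d = d} e (f ⊕ g) d≤e p =
    addP (mulTree e f (ℕₚ.≤-trans (ℕₚ.+-monoˡ-≤ d (ℕₚ.m≤m⊔n (deg f) (deg g))) d≤e) p)
         (mulTree e g (ℕₚ.≤-trans (ℕₚ.+-monoˡ-≤ d (ℕₚ.m≤n⊔m (deg f) (deg g))) d≤e) p)
  mulTree {d = d} e (f ⊗ g) d≤e p =
    mulTree e f (subst (_≤ e) (ℕₚ.+-assoc (deg f) (deg g) d) d≤e) (mulTree (deg g ℕ.+ d) g ℕₚ.≤-refl p)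

  ⟦mulTree⟧ : ∀ {n d} e (f : Tree n) (d≤e : deg f ℕ.+ d ≤ e) (p : Poly n d) Z →
              ⟦ mulTree e f d≤e p ⟧ Z ≗ eval f Z ⊛ ⟦ p ⟧ Z
  ⟦mulTree⟧ e (con c) d≤e p Z k = trans (⟦weakenTo⟧ (ℕₚ.≤⇒≤′ d≤e) (scaleP c p) Z k)
    (trans (⟦scaleP⟧ c p Z k) (sym (ι-⊛ c (⟦ p ⟧ Z) k)))
  ⟦mulTree⟧ e (var i) d≤e p Z k = trans (⟦weakenTo⟧ (ℕₚ.≤⇒≤′ d≤e) (mulVar i p) Z k) (⟦mulVar⟧ i p Z k)
  ⟦mulTree⟧ e (f ⊕ g) d≤e p Z k = trans (⟦addP⟧ (mulTree e f _ p) (mulTree e g _ p) Z k)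
    (trans (cong₂ _+_ (⟦mulTree⟧ e f _ p Z k) (⟦mulTree⟧ e g _ p Z k)) (sym (⊛-distribʳ (⟦ p ⟧ Z) (eval f Z) (eval g Z) k)))
  ⟦mulTree⟧ {d = d} e (f ⊗ g) d≤e p Z k = trans
    (⟦mulTree⟧ e f (subst (_≤ e) (ℕₚ.+-assoc (deg f) (deg g) d) d≤e) (mulTree (deg g ℕ.+ d) g ℕₚ.≤-refl p) Z k)
    (trans (⊛-cong (λ _ → refl) (⟦mulTree⟧ (deg g ℕ.+ d) g ℕₚ.≤-refl p Z) k) (sym (⊛-assoc (eval f Z) (eval g Z) (⟦ p ⟧ Z) k)))

  toPoly : ∀ {n} d (f : Tree n) → deg f ≤ d → Poly n d
  toPoly d f f≤d = mulTree d f (subst (_≤ d) (sym (ℕₚ.+-identityʳ (deg f))) f≤d) (constP {d = 0} 1#)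

  ⟦toPoly⟧ : ∀ {n} d (f : Tree n) (f≤d : deg f ≤ d) Z → ⟦ toPoly d f f≤d ⟧ Z ≗ eval f Z
  ⟦toPoly⟧ {n} d f f≤d Z k = trans (⟦mulTree⟧ d f (subst (_≤ d) (sym (ℕₚ.+-identityʳ (deg f))) f≤d) (constP {n} {0} 1#) Z k)
    (trans (⊛-cong (λ _ → refl) (⟦constP⟧ {n} {0} 1# Z) k)
    (trans (⊛-comm (eval f Z) (ι 1#) k) (trans (ι-⊛ 1# (eval f Z) k) (*-identityˡ _))))

  substT : ∀ {n n′ d} → Poly n d → (Fin n → Tree n′) → Tree n′
  substT (con c)    σ = con c
  substT (base c)   σ = con c
  substT (p +x* p′) σ = substT p (σ ∘ suc) ⊕ σ zero ⊗ substT p′ σ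

  eval-substT : ∀ {n n′ d} (p : Poly n d) (σ : Fin n → Tree n′) Z →
                eval (substT p σ) Z ≗ ⟦ p ⟧ (λ i → eval (σ i) Z)
  eval-substT (con c)    σ Z k = refl
  eval-substT (base c)   σ Z k = refl
  eval-substT (p +x* p′) σ Z k = cong₂ _+_ (eval-substT p (σ ∘ suc) Z k)
    (⊛-cong (λ _ → refl) (eval-substT p′ σ Z) k)

  deg-substT : ∀ {n n′ d} (p : Poly n d) (σ : Fin n → Tree n′) → (∀ i → deg (σ i) ≤ 1) → deg (substT p σ) ≤ d
  deg-substT (con c)    σ σ≤1 = z≤n
  deg-substT (base c)   σ σ≤1 = z≤n
  deg-substT (p +x* p′) σ σ≤1 = ℕₚ.⊔-lub (deg-substT p (σ ∘ suc) (σ≤1 ∘ suc)) (ℕₚ.+-mono-≤ (σ≤1 zero) (deg-substT p′ σ σ≤1))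

-- Finite sets of functions and powers of natural numbers

injective⇒surjective : ∀ {n} (f : Fin n → Fin n) → Injective _≡_ _≡_ f → ∀ y → ∃ λ x → f x ≡ y
injective⇒surjective {suc n} f inj y with any? (λ x → f x ≟ y)
... | yes hit = hit
... | no miss = contradiction
  (λ {x} {x′} eq → inj (Finₚ.punchOut-injective (≢y x) (≢y x′) eq))
  (Finₚ.<⇒notInjective {f = λ x → punchOut {i = y} (≢y x)} (ℕₚ.n<1+n n))
  where ≢y : ∀ x → y ≢ f x
        ≢y x eq = miss (x , sym eq)

funToFin-cong : ∀ {m n} {f g : Fin m → Fin n} → f ≗ g → funToFin f ≡ funToFin g
funToFin-cong {zero}  f≗g = refl
funToFin-cong {suc m} f≗g = cong₂ combine (f≗g zero) (funToFin-cong (f≗g ∘ suc))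

funToFin-injective : ∀ {m n} {f g : Fin m → Fin n} → funToFin f ≡ funToFin g → f ≗ g
funToFin-injective {f = f} {g} eq i = trans (sym (Finₚ.finToFun-funToFin f i))
  (trans (cong (λ c → finToFun c i) eq) (Finₚ.finToFun-funToFin g i))

finToFun-injective : ∀ {m n} {a b : Fin (n ^ m)} → finToFun {n} {m} a ≗ finToFun b → a ≡ b
finToFun-injective {m} {n} {a} {b} eq = trans (sym (Finₚ.funToFin-finToFin {m} a))
  (trans (funToFin-cong eq) (Finₚ.funToFin-finToFin {m} b))

^-cancelˡ-≤ : ∀ b {x y} → 1 < b → b ^ x ≤ b ^ y → x ≤ y
^-cancelˡ-≤ b {x} {y} 1<b bˣ≤bʸ with x ℕ.≤? y
... | yes x≤y = x≤y
... | no  x≰y = contradiction (ℕₚ.^-monoʳ-< b 1<b (ℕₚ.≰⇒> x≰y)) (ℕₚ.≤⇒≯ bˣ≤bʸ)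

^-distribʳ-* : ∀ n a b → (a ℕ.* b) ^ n ≡ a ^ n ℕ.* b ^ n
^-distribʳ-* zero    a b = refl
^-distribʳ-* (suc n) a b = trans (cong (a ℕ.* b ℕ.*_) (^-distribʳ-* n a b))
  (solve 4 (λ a b x y → a :* b :* (x :* y) := a :* x :* (b :* y)) refl a b (a ^ n) (b ^ n))
  where open +-*-Solver

-- Bézout's bound for nonsingular zeros

module Bezout {P : ℕ} (𝔽 : FiniteField P) where

  open PowerSeries 𝔽 public
  open import Data.Nat.DivMod using (_%_; m≡m%n+[m/n]*n; m%n<n; m<n*o⇒m/o<n)

  1<P : 1 < P
  1<P = go 0# 1# 1≢0
    where
    go : ∀ {P} (x y : Fin P) → y ≢ x → 1 < P
    go {suc zero}    zero zero y≢x = contradiction refl y≢x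
    go {suc (suc P)} _ _ _ = s≤s (s≤s z≤n)

  x-x : ∀ {x y} → x ≡ y → x + - y ≡ 0#
  x-x {x} refl = -‿inverseʳ x

  x-y≡0⇒x≡y : ∀ {x y} → x + - y ≡ 0# → x ≡ y
  x-y≡0⇒x≡y {x} {y} eq = +-cancelʳ (- y) x y (trans eq (sym (-‿inverseʳ y)))

  coefs : ∀ {n d} → Poly n d → Fin (κ n d) → F
  coefs (con c)  _ = c
  coefs (base c) _ = c
  coefs {suc n} {suc d} (p +x* p′) i = [ coefs p , coefs p′ ]′ (splitAt (κ n (suc d)) i)

  fromCoefs : ∀ n d → (Fin (κ n d) → F) → Poly n d
  fromCoefs zero    d       c = con (c zero)
  fromCoefs (suc n) zero    c = base (c zero)
  fromCoefs (suc n) (suc d) c = fromCoefs n (suc d) (c ∘ (_↑ˡ κ (suc n) d)) +x* fromCoefs (suc n) d (c ∘ (κ n (suc d) ↑ʳ_))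

  fromCoefs-cong : ∀ n d {c c′ : Fin (κ n d) → F} → c ≗ c′ → fromCoefs n d c ≡ fromCoefs n d c′
  fromCoefs-cong zero    d       eq = cong con (eq zero)
  fromCoefs-cong (suc n) zero    eq = cong base (eq zero)
  fromCoefs-cong (suc n) (suc d) eq = cong₂ _+x*_ (fromCoefs-cong n (suc d) (eq ∘ _)) (fromCoefs-cong (suc n) d (eq ∘ _))

  fromCoefs-coefs : ∀ {n d} (p : Poly n d) → fromCoefs n d (coefs p) ≡ p
  fromCoefs-coefs (con c)  = refl
  fromCoefs-coefs (base c) = refl
  fromCoefs-coefs {suc n} {suc d} (p +x* p′) = cong₂ _+x*_
    (trans (fromCoefs-cong n (suc d) λ i → cong [ coefs p , coefs p′ ]′ (Finₚ.splitAt-↑ˡ (κ n (suc d)) i (κ (suc n) d))) (fromCoefs-coefs p))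
    (trans (fromCoefs-cong (suc n) d λ i → cong [ coefs p , coefs p′ ]′ (Finₚ.splitAt-↑ʳ (κ n (suc d)) (κ (suc n) d) i)) (fromCoefs-coefs p′))

  coefs-fromCoefs : ∀ n d (c : Fin (κ n d) → F) → coefs (fromCoefs n d c) ≗ c
  coefs-fromCoefs zero    d       c zero = refl
  coefs-fromCoefs (suc n) zero    c zero = refl
  coefs-fromCoefs (suc n) (suc d) c i with splitAt (κ n (suc d)) i in eq
  ... | inj₁ j = trans (coefs-fromCoefs n (suc d) _ j) (cong c (Finₚ.splitAt⁻¹-↑ˡ eq))
  ... | inj₂ j = trans (coefs-fromCoefs (suc n) d _ j) (cong c (Finₚ.splitAt⁻¹-↑ʳ eq))

  encode : ∀ {n d} → Poly n d → Fin (P ^ κ n d)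
  encode p = funToFin (coefs p)

  decode : ∀ n d → Fin (P ^ κ n d) → Poly n d
  decode n d c = fromCoefs n d (finToFun c)

  encode-injective : ∀ {n d} {p r : Poly n d} → encode p ≡ encode r → p ≡ r
  encode-injective {n} {d} {p} {r} eq = trans (sym (fromCoefs-coefs p))
    (trans (fromCoefs-cong n d (funToFin-injective eq)) (fromCoefs-coefs r))

  decode-injective : ∀ n d {a b} → decode n d a ≡ decode n d b → a ≡ b
  decode-injective n d {a} {b} eq = finToFun-injective λ i → trans (sym (coefs-fromCoefs n d _ i))
    (trans (cong (λ p → coefs p i) eq) (coefs-fromCoefs n d _ i))

  κ-bound : ∀ n d → κ n d ≤ suc d ^ n
  κ-bound zero    d       = s≤s z≤n
  κ-bound (suc n) zero    = subst (1 ≤_) (sym (ℕₚ.^-zeroˡ (suc n))) (s≤s z≤n)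
  κ-bound (suc n) (suc d) = ℕₚ.+-mono-≤ (κ-bound n (suc d))
    (ℕₚ.≤-trans (κ-bound (suc n) d) (ℕₚ.*-monoʳ-≤ (suc d) (ℕₚ.^-monoˡ-≤ n (ℕₚ.n≤1+n (suc d)))))

  ⊛-agree : ∀ n {a a′ b b′ : Series} → (∀ i → i ≤ n → a i ≡ a′ i) → (∀ i → i ≤ n → b i ≡ b′ i) →
            (a ⊛ b) n ≡ (a′ ⊛ b′) n
  ⊛-agree zero    p r = cong₂ _*_ (p 0 z≤n) (r 0 z≤n)
  ⊛-agree (suc n) p r = cong₂ _+_ (cong₂ _*_ (p 0 z≤n) (r (suc n) ℕₚ.≤-refl))
    (⊛-agree n (λ i i≤n → p (suc i) (s≤s i≤n)) (λ i i≤n → r i (ℕₚ.m≤n⇒m≤1+n i≤n)))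

  infix 4 _≈[_]_
  _≈[_]_ : Series → ℕ → Series → Set
  a ≈[ M ] b = ∀ i → i < M → a i ≡ b i

  ⊛-cong-mod : ∀ {M a a′ b b′} → a ≈[ M ] a′ → b ≈[ M ] b′ → a ⊛ b ≈[ M ] a′ ⊛ b′
  ⊛-cong-mod p r i i<M = ⊛-agree i (λ j j≤i → p j (ℕₚ.≤-<-trans j≤i i<M)) (λ j j≤i → r j (ℕₚ.≤-<-trans j≤i i<M))

  -- a′ = a + d·tᶜ modulo tᶜ⁺¹
  Near : ℕ → Series → Series → F → Set
  Near c a a′ d = (∀ i → i < c → a′ i ≡ a i) × a′ c ≡ a c + d

  ⊛-perturbˡ : ∀ n {a a′ b b′ d} → Near n a a′ d → (∀ i → i ≤ n → b′ i ≡ b i) →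
               (a′ ⊛ b′) n ≡ (a ⊛ b) n + d * b 0
  ⊛-perturbˡ zero    (_ , top) r = trans (cong₂ _*_ top (r 0 z≤n)) (distribʳ _ _ _)
  ⊛-perturbˡ (suc n) (low , top) r = trans (cong₂ _+_ (cong₂ _*_ (low 0 (s≤s z≤n)) (r (suc n) ℕₚ.≤-refl))
    (⊛-perturbˡ n ((λ i i<n → low (suc i) (s≤s i<n)) , top) (λ i i≤n → r i (ℕₚ.m≤n⇒m≤1+n i≤n)))) (sym (+-assoc _ _ _))

  -- The product rule. The order has to be at least 1: at order 0 the cross term `d * e` would
  -- survive.
  ⊛-near : ∀ c {a a′ b b′ d e} → Near (suc c) a a′ d → Near (suc c) b b′ e →
           Near (suc c) (a ⊛ b) (a′ ⊛ b′) (a 0 * e + d * b 0)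
  ⊛-near c {a} {a′} {b} {b′} {d} {e} (lowa , topa) (lowb , topb) =
      (λ i i<c → ⊛-agree i (λ j j≤i → lowa j (ℕₚ.≤-<-trans j≤i i<c)) (λ j j≤i → lowb j (ℕₚ.≤-<-trans j≤i i<c)))
    , trans (cong₂ _+_ (cong₂ _*_ (lowa 0 (s≤s z≤n)) topb)
        (⊛-perturbˡ c {a ∘ suc} ((λ i i<c → lowa (suc i) (s≤s i<c)) , topa) (λ i i≤c → lowb i (s≤s i≤c))))
      (solve 5 (λ x y e X D → x :* (y :+ e) :+ (X :+ D) := (x :* y :+ X) :+ (x :* e :+ D)) refl (a 0) (b (suc c)) e _ (d * b 0))
    where open FSolver

  dual : ∀ {n} → (Fin n → F) → (Fin n → F) → Fin n → Series
  dual p δ v zero          = p v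
  dual p δ v (suc zero)    = δ v
  dual p δ v (suc (suc _)) = 0#

  -- The directional derivative, read off as the coefficient of t in f(p + δt), so that expressions
  -- are never differentiated formally.
  D : ∀ {n} → Tree n → (Fin n → F) → (Fin n → F) → F
  D f p δ = eval f (dual p δ) 1

  eval-0 : ∀ {n} (f : Tree n) {Z Z′ : Fin n → Series} → (∀ v → Z v 0 ≡ Z′ v 0) → eval f Z 0 ≡ eval f Z′ 0
  eval-0 (con c) eq = refl
  eval-0 (var i) eq = eq i
  eval-0 (f ⊕ g) eq = cong₂ _+_ (eval-0 f eq) (eval-0 g eq)
  eval-0 (f ⊗ g) eq = cong₂ _*_ (eval-0 f eq) (eval-0 g eq)

  dual-cong : ∀ {n} {p p′ δ δ′ : Fin n → F} → p ≗ p′ → δ ≗ δ′ → ∀ v → dual p δ v ≗ dual p′ δ′ v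
  dual-cong pe δe v zero          = pe v
  dual-cong pe δe v (suc zero)    = δe v
  dual-cong pe δe v (suc (suc _)) = refl

  D-cong : ∀ {n} (f : Tree n) {p p′ δ δ′} → p ≗ p′ → δ ≗ δ′ → D f p δ ≡ D f p′ δ′
  D-cong f pe δe = eval-cong f (dual-cong pe δe) 1

  D-linear : ∀ {n} (f : Tree n) p x δ δ′ → D f p (λ v → x * δ v + δ′ v) ≡ x * D f p δ + D f p δ′
  D-linear (con c) p x δ δ′ = sym (trans (+-identityʳ _) (zeroʳ x))
  D-linear (var i) p x δ δ′ = refl
  D-linear (f ⊕ g) p x δ δ′ = trans (cong₂ _+_ (D-linear f p x δ δ′) (D-linear g p x δ δ′))
    (solve 5 (λ x a b c d → (x :* a :+ b) :+ (x :* c :+ d) := x :* (a :+ c) :+ (b :+ d)) refl x _ _ _ _)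
    where open FSolver
  D-linear (f ⊗ g) p x δ δ′
    rewrite D-linear f p x δ δ′ | D-linear g p x δ δ′
          | eval-0 f {dual p (λ v → x * δ v + δ′ v)} {dual p δ′} (λ _ → refl)
          | eval-0 g {dual p (λ v → x * δ v + δ′ v)} {dual p δ′} (λ _ → refl)
          | eval-0 f {dual p δ} {dual p δ′} (λ _ → refl)
          | eval-0 g {dual p δ} {dual p δ′} (λ _ → refl) =
    solve 7 (λ x f₀ g₀ a b c d → f₀ :* (x :* a :+ b) :+ (x :* c :+ d) :* g₀
                              := x :* (f₀ :* a :+ c :* g₀) :+ (f₀ :* b :+ d :* g₀)) refl x _ _ _ _ _ _
    where open FSolver

  D-zero : ∀ {n} (f : Tree n) p → D f p (λ _ → 0#) ≡ 0#
  D-zero f p = sym (+-cancelˡ (D f p (λ _ → 0#)) _ _ (trans (+-identityʳ _)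
    (trans (D-cong f (λ _ → refl) (λ _ → sym (trans (+-identityʳ _) (*-identityˡ _))))
    (trans (D-linear f p 1# (λ _ → 0#) (λ _ → 0#)) (cong (_+ D f p (λ _ → 0#)) (*-identityˡ _))))))

  D-scale : ∀ {n} (f : Tree n) p x δ → D f p (λ v → x * δ v) ≡ x * D f p δ
  D-scale f p x δ = trans (D-cong f (λ _ → refl) (λ _ → sym (+-identityʳ _)))
    (trans (D-linear f p x δ (λ _ → 0#)) (trans (cong (x * D f p δ +_) (D-zero f p)) (+-identityʳ _)))

  -- The derivative is taken at the constant terms of `Z`, whatever the order: every later
  -- correction of a lift is governed by the same linear map.
  taylor : ∀ {n} c (f : Tree n) {Z Z′ : Fin n → Series} {δ} → (∀ v → Near (suc c) (Z v) (Z′ v) (δ v)) →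
           Near (suc c) (eval f Z) (eval f Z′) (D f (λ v → Z v 0) δ)
  taylor c (con x) near = (λ _ _ → refl) , sym (+-identityʳ _)
  taylor c (var v) near = near v
  taylor c (f ⊕ g) near with taylor c f near | taylor c g near
  ... | lf , tf | lg , tg = (λ i i<c → cong₂ _+_ (lf i i<c) (lg i i<c)) ,
    trans (cong₂ _+_ tf tg) (solve 4 (λ x y z w → (x :+ y) :+ (z :+ w) := (x :+ z) :+ (y :+ w)) refl _ _ _ _)
    where open FSolver
  taylor c (f ⊗ g) {Z} {Z′} {δ} near with ⊛-near c (taylor c f near) (taylor c g near)
  ... | l , t = l , trans t (cong ((eval f Z ⊛ eval g Z) (suc c) +_)
    (cong₂ _+_ (cong (_* D g (λ v → Z v 0) δ) (eval-0 f (λ _ → refl))) (cong (D f (λ v → Z v 0) δ *_) (eval-0 g (λ _ → refl)))))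

  bump : ℕ → F → Series
  bump zero    x         = ι x
  bump (suc k) x zero    = 0#
  bump (suc k) x (suc i) = bump k x i

  bump-< : ∀ k x {i} → i < k → bump k x i ≡ 0#
  bump-< (suc k) x {zero}  _         = refl
  bump-< (suc k) x {suc i} (s≤s i<k) = bump-< k x i<k

  bump-top : ∀ k x → bump k x k ≡ x
  bump-top zero    x = refl
  bump-top (suc k) x = bump-top k x

  bump-⊛-< : ∀ k a {i} → i < k → (bump k 1# ⊛ a) i ≡ 0#
  bump-⊛-< (suc k) a {zero}  _         = zeroˡ _
  bump-⊛-< (suc k) a {suc i} (s≤s i<k) = trans (cong₂ _+_ (zeroˡ _) (bump-⊛-< k a i<k)) (+-identityˡ _)

  bump-⊛-≥ : ∀ k a j → (bump k 1# ⊛ a) (k ℕ.+ j) ≡ a j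
  bump-⊛-≥ zero    a j = trans (ι-⊛ 1# a j) (*-identityˡ _)
  bump-⊛-≥ (suc k) a j = trans (cong₂ _+_ (zeroˡ _) (bump-⊛-≥ k a j)) (+-identityˡ _)

  bump-+ : ∀ a b → bump a 1# ⊛ bump b 1# ≗ bump (a ℕ.+ b) 1#
  bump-+ zero    b i       = trans (ι-⊛ 1# (bump b 1#) i) (*-identityˡ _)
  bump-+ (suc a) b zero    = zeroˡ _
  bump-+ (suc a) b (suc i) = trans (cong₂ _+_ (zeroˡ _) (bump-+ a b i)) (+-identityˡ _)

  module _ {n : ℕ} (f : Fin n → Tree n) (p : Fin n → F) where

    Zero NonSingular : Set
    Zero        = ∀ j → eval (f j) (ι ∘ p) 0 ≡ 0#
    NonSingular = ∀ δ → (∀ j → D (f j) p δ ≡ 0#) → ∀ v → δ v ≡ 0#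

    -- A trivial kernel makes the linear map injective on a finite set of size `P ^ n`, hence
    -- surjective; no determinants are involved.
    D-surjective : NonSingular → (w : Fin n → F) → ∃ λ δ → ∀ j → D (f j) p δ ≡ w j
    D-surjective ns w with injective⇒surjective (λ x → funToFin (Dx x)) inj (funToFin w)
      where
      Dx : Fin (P ^ n) → Fin n → F
      Dx x j = D (f j) p (finToFun x)
      inj : Injective _≡_ _≡_ (λ x → funToFin (Dx x))
      inj {x} {y} eq = finToFun-injective λ v → sym (x-y≡0⇒x≡y (trans (+-comm _ _)
        (trans (cong (_+ finToFun y v) (trans (sym (*-identityˡ _)) (trans (sym (-‿distribʳ-* 1# _)) (-‿distribˡ-* 1# _))))
        (ns (λ v → - 1# * finToFun x v + finToFun y v) (λ j → trans (D-linear (f j) p (- 1#) (finToFun x) (finToFun y))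
          (trans (cong (- 1# * Dx x j +_) (sym (funToFin-injective eq j)))
          (trans (cong (_+ Dx x j) (trans (sym (-‿distribˡ-* 1# _)) (cong -_ (*-identityˡ _)))) (-‿inverseˡ _)))) v))))
    ... | x , eq = finToFun x , funToFin-injective eq

    -- Lifting one coefficient at a time: by `taylor` the next coefficient solves a linear system
    -- whose map is the derivative at `p`, and `D-surjective` solves it for any right-hand side.
    hensel : Zero → NonSingular → (target : Fin n → Series) → (∀ j → target j 0 ≡ 0#) → ∀ c →
             ∃ λ (Z : Fin n → Series) → (∀ v → Z v 0 ≡ p v) × (∀ j i → i ≤ c → eval (f j) Z i ≡ target j i)
    hensel zp ns target t0 zero = ι ∘ p , (λ _ → refl) , λ { j .0 z≤n → trans (zp j) (sym (t0 j)) }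
    hensel zp ns target t0 (suc c) with hensel zp ns target t0 c
    ... | Z , Z0 , ok with D-surjective ns (λ j → target j (suc c) + - eval (f j) Z (suc c))
    ... | δ , Dδ = Z′ , (λ v → trans (+-identityʳ _) (Z0 v)) , ok′
      where
      Z′ : Fin n → Series
      Z′ v = Z v ⊞ bump (suc c) (δ v)
      near : ∀ v → Near (suc c) (Z v) (Z′ v) (δ v)
      near v = (λ i i<c → trans (cong (Z v i +_) (bump-< (suc c) (δ v) i<c)) (+-identityʳ _)) ,
               cong (Z v (suc c) +_) (bump-top c (δ v))
      ok′ : ∀ j i → i ≤ suc c → eval (f j) Z′ i ≡ target j i
      ok′ j i i≤ with taylor c (f j) near | ℕₚ.m≤n⇒m<n∨m≡n i≤
      ... | low , _   | inj₁ (s≤s i≤c) = trans (low i (s≤s i≤c)) (ok j i i≤c)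
      ... | _   , top | inj₂ refl = trans top (trans
        (cong (eval (f j) Z (suc c) +_) (trans (D-cong (f j) Z0 (λ _ → refl)) (Dδ j)))
        (trans (+-comm _ _) (trans (+-assoc _ _ _) (trans (cong (target j (suc c) +_) (-‿inverseˡ _)) (+-identityʳ _)))))

  prodT sumT : ∀ {h n} → (Fin h → Tree n) → Tree n
  prodT {zero}  g = con 1#
  prodT {suc h} g = g zero ⊗ prodT (g ∘ suc)
  sumT {zero}  g = con 0#
  sumT {suc h} g = g zero ⊕ sumT (g ∘ suc)

  deg-prodT : ∀ {h n} (g : Fin h → Tree n) {d} → (∀ i → deg (g i) ≤ d) → deg (prodT g) ≤ h ℕ.* d
  deg-prodT {zero}  g g≤ = z≤n
  deg-prodT {suc h} g g≤ = ℕₚ.+-mono-≤ (g≤ zero) (deg-prodT (g ∘ suc) (g≤ ∘ suc))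

  deg-sumT : ∀ {h n} (g : Fin h → Tree n) {d} → (∀ i → deg (g i) ≤ d) → deg (sumT g) ≤ d
  deg-sumT {zero}  g g≤ = z≤n
  deg-sumT {suc h} g g≤ = ℕₚ.⊔-lub (g≤ zero) (deg-sumT (g ∘ suc) (g≤ ∘ suc))

  sumT-zero : ∀ {h n} (g : Fin h → Tree n) Z k → (∀ i → eval (g i) Z k ≡ 0#) → eval (sumT g) Z k ≡ 0#
  sumT-zero {zero}  g Z zero    g≡0 = refl
  sumT-zero {zero}  g Z (suc k) g≡0 = refl
  sumT-zero {suc h} g Z k       g≡0 = trans (cong₂ _+_ (g≡0 zero) (sumT-zero (g ∘ suc) Z k (g≡0 ∘ suc))) (+-identityˡ _)

  sumT-single : ∀ {h n} (g : Fin h → Tree n) Z k i → (∀ j → j ≢ i → eval (g j) Z k ≡ 0#) →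
                eval (sumT g) Z k ≡ eval (g i) Z k
  sumT-single g Z k zero g≡0 = trans
    (cong (eval (g zero) Z k +_) (sumT-zero (g ∘ suc) Z k (λ j → g≡0 (suc j) λ ()))) (+-identityʳ _)
  sumT-single g Z k (suc i) g≡0 = trans
    (cong₂ _+_ (g≡0 zero λ ()) (sumT-single (g ∘ suc) Z k i (λ j j≢i → g≡0 (suc j) (j≢i ∘ Finₚ.suc-injective)))) (+-identityˡ _)

  prodT-1 : ∀ {h n} (g : Fin h → Tree n) Z → (∀ i → eval (g i) Z 0 ≡ 1#) → eval (prodT g) Z 0 ≡ 1#
  prodT-1 {zero}  g Z g≡1 = refl
  prodT-1 {suc h} g Z g≡1 = trans (cong₂ _*_ (g≡1 zero) (prodT-1 (g ∘ suc) Z (g≡1 ∘ suc))) (*-identityˡ _)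

  prodT-0 : ∀ {h n} (g : Fin h → Tree n) Z i → eval (g i) Z 0 ≡ 0# → eval (prodT g) Z 0 ≡ 0#
  prodT-0 g Z zero    gi≡0 = trans (cong (_* eval (prodT (g ∘ suc)) Z 0) gi≡0) (zeroˡ _)
  prodT-0 g Z (suc i) gi≡0 = trans (cong (eval (g zero) Z 0 *_) (prodT-0 (g ∘ suc) Z i gi≡0)) (zeroʳ _)

  -- An affine form equal to 1 at p and to 0 at r (junk when p = r).
  sepT : ∀ {n} → (p r : Fin n → F) → Tree n
  sepT p r with any? (λ x → ¬? (p x ≟ r x))
  ... | yes (x , _) = (var x ⊕ con (- r x)) ⊗ con (inv (p x + - r x))
  ... | no _        = con 1#

  deg-sepT : ∀ {n} (p r : Fin n → F) → deg (sepT p r) ≤ 1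
  deg-sepT p r with any? (λ x → ¬? (p x ≟ r x))
  ... | yes _ = s≤s z≤n
  ... | no _  = z≤n

  sepT-1 : ∀ {n} (p r : Fin n → F) Z → ¬ p ≗ r → (∀ v → Z v 0 ≡ p v) → eval (sepT p r) Z 0 ≡ 1#
  sepT-1 p r Z p≢r Z0 with any? (λ x → ¬? (p x ≟ r x))
  ... | yes (x , px≢rx) = trans (cong (λ z → (z + - r x) * inv (p x + - r x)) (Z0 x)) (inverseʳ (px≢rx ∘ x-y≡0⇒x≡y))
  ... | no same = refl

  sepT-0 : ∀ {n} (p r : Fin n → F) Z → ¬ p ≗ r → (∀ v → Z v 0 ≡ r v) → eval (sepT p r) Z 0 ≡ 0#
  sepT-0 p r Z p≢r Z0 with any? (λ x → ¬? (p x ≟ r x))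
  ... | yes (x , _) = trans (cong (_* inv (p x + - r x)) (x-x (Z0 x))) (zeroˡ _)
  ... | no same = contradiction (λ x → decidable-stable (p x ≟ r x) (λ ne → same (x , ne))) p≢r

  Distinct : ∀ {h n} → (Fin h → Fin n → F) → Set
  Distinct pts = ∀ i j → i ≢ j → ¬ pts i ≗ pts j

  lagrangeFactor : ∀ {h n} → (Fin h → Fin n → F) → (i j : Fin h) → Tree n
  lagrangeFactor pts i j with j ≟ i
  ... | yes _ = con 1#
  ... | no _  = sepT (pts i) (pts j)

  -- On a series only the constant term of the value is prescribed. That is enough for `span`, which
  -- corrects one power of t at a time.
  lagrange : ∀ {h n} → (Fin h → Fin n → F) → Fin h → Tree n
  lagrange pts i = prodT (lagrangeFactor pts i)

  deg-lagrange : ∀ {h n} (pts : Fin h → Fin n → F) i → deg (lagrange pts i) ≤ h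
  deg-lagrange {h} pts i = subst (deg (lagrange pts i) ≤_) (ℕₚ.*-identityʳ h) (deg-prodT (lagrangeFactor pts i) factor≤1)
    where
    factor≤1 : ∀ j → deg (lagrangeFactor pts i j) ≤ 1
    factor≤1 j with j ≟ i
    ... | yes _ = z≤n
    ... | no _  = deg-sepT (pts i) (pts j)

  lagrange-1 : ∀ {h n} (pts : Fin h → Fin n → F) → Distinct pts → ∀ i Z → (∀ v → Z v 0 ≡ pts i v) →
               eval (lagrange pts i) Z 0 ≡ 1#
  lagrange-1 pts dist i Z Z0 = prodT-1 (lagrangeFactor pts i) Z factor
    where
    factor : ∀ j → eval (lagrangeFactor pts i j) Z 0 ≡ 1#
    factor j with j ≟ i
    ... | yes _   = refl
    ... | no j≢i = sepT-1 (pts i) (pts j) Z (dist i j (j≢i ∘ sym)) Z0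

  lagrange-0 : ∀ {h n} (pts : Fin h → Fin n → F) → Distinct pts → ∀ i j → i ≢ j → ∀ Z → (∀ v → Z v 0 ≡ pts j v) →
               eval (lagrange pts i) Z 0 ≡ 0#
  lagrange-0 pts dist i j i≢j Z Z0 = prodT-0 (lagrangeFactor pts i) Z j factor
    where
    factor : eval (lagrangeFactor pts i j) Z 0 ≡ 0#
    factor with j ≟ i
    ... | yes j≡i = contradiction (sym j≡i) i≢j
    ... | no j≢i  = sepT-0 (pts i) (pts j) Z (dist i j i≢j) Z0

  powT : ∀ {n} → Tree n → ℕ → Tree n
  powT f zero    = con 1#
  powT f (suc e) = f ⊗ powT f e

  deg-powT : ∀ {n} (f : Tree n) {d} → deg f ≤ d → ∀ e → deg (powT f e) ≤ e ℕ.* d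
  deg-powT f f≤d zero    = z≤n
  deg-powT f f≤d (suc e) = ℕₚ.+-mono-≤ f≤d (deg-powT f f≤d e)

  powT-bump : ∀ {n M} (f : Tree n) Z {w} → eval f Z ≈[ M ] bump w 1# → ∀ e → eval (powT f e) Z ≈[ M ] bump (e ℕ.* w) 1#
  powT-bump f Z eq zero    i i<M = refl
  powT-bump f Z {w} eq (suc e) i i<M = trans (⊛-cong-mod eq (powT-bump f Z eq e) i i<M) (bump-+ w (e ℕ.* w) i)

  -- Write `c` in base `r` and multiply the powers of the f_j with the digits as exponents. Digits
  -- are below `r`, so the degree is linear in `r` although `c` ranges up to `r ^ k`. Dropping the
  -- lowest digit replaces `w` by `w * r`.
  digits : ∀ {N n d M} k (f : Fin k → Tree n) (Z : Fin N → Fin n → Series) r .{{_ : ℕ.NonZero r}} w →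
           (∀ j → deg (f j) ≤ d) →
           (∀ i j → eval (f j) (Z i) ≈[ M ] bump (w ℕ.* r ^ toℕ j) 1#) →
           ∀ c → c < r ^ k → ∃ λ T → deg T ≤ k ℕ.* (r ℕ.* d) × (∀ i → eval T (Z i) ≈[ M ] bump (w ℕ.* c) 1#)
  digits zero f Z r w f≤d fZ zero _ = con 1# , z≤n , λ i j j<M → cong (λ e → bump e 1# j) (sym (ℕₚ.*-zeroʳ w))
  digits zero f Z r w f≤d fZ (suc c) (s≤s ())
  digits {d = d} (suc k) f Z r w f≤d fZ c c<
    with digits k (f ∘ suc) Z r (w ℕ.* r) (f≤d ∘ suc)
           (λ i j l l<M → trans (fZ i (suc j) l l<M) (cong (λ e → bump e 1# l) (sym (ℕₚ.*-assoc w r (r ^ toℕ j)))))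
           (c ℕ./ r) (m<n*o⇒m/o<n {n = r ^ k} (subst (c <_) (ℕₚ.*-comm r (r ^ k)) c<))
  ... | T , T≤ , TZ = powT (f zero) (c % r) ⊗ T ,
    ℕₚ.+-mono-≤ (ℕₚ.≤-trans (deg-powT (f zero) (f≤d zero) (c % r)) (ℕₚ.*-monoˡ-≤ d (ℕₚ.<⇒≤ (m%n<n c r)))) T≤ ,
    λ i l l<M → trans (⊛-cong-mod (powT-bump (f zero) (Z i) {w} (λ l l<M → trans (fZ i zero l l<M) (cong (λ e → bump e 1# l) (ℕₚ.*-identityʳ w))) (c % r)) (TZ i) l l<M)
      (trans (bump-+ (c % r ℕ.* w) (w ℕ.* r ℕ.* (c ℕ./ r)) l) (cong (λ e → bump e 1# l)
        (trans (solve 4 (λ a w r b → a :* w :+ w :* r :* b := w :* (a :+ b :* r)) refl (c % r) w r (c ℕ./ r))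
               (cong (w ℕ.*_) (sym (m≡m%n+[m/n]*n c r))))))
    where open +-*-Solver

  -- At order `c` the sum of the ρᵢ(c)·tᶜ·Lᵢ, with Lᵢ the Lagrange polynomials, matches that
  -- coefficient on every series. What it spoils at higher orders is moved into `ρ′`. The
  -- corrections are added, not multiplied, so one degree bound serves for all orders.
  span : ∀ {N n M d} (pts : Fin N → Fin n → F) → Distinct pts → (Z : Fin N → Fin n → Series) →
         (∀ i v → Z i v 0 ≡ pts i v) →
         (∀ c → c < M → ∃ λ (T : Tree n) → deg T ≤ d × (∀ i → eval T (Z i) ≈[ M ] bump c 1#)) →
         ∀ k c → c ℕ.+ k ≡ M → (ρ : Fin N → Series) → (∀ i j → j < c → ρ i j ≡ 0#) →
         ∃ λ (p : Poly n (d ℕ.+ N)) → ∀ i → ⟦ p ⟧ (Z i) ≈[ M ] ρ i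
  span {n = n} {d = d} pts dist Z Z0 mono zero c refl ρ ρ≡0 = constP 0# ,
    λ i j j<M → trans (⟦constP⟧ {n} 0# (Z i) j) (trans (ι0 j) (sym (ρ≡0 i j (subst (j <_) (ℕₚ.+-identityʳ c) j<M))))
    where ι0 : ∀ j → ι 0# j ≡ 0#
          ι0 zero    = refl
          ι0 (suc j) = refl
  span {N} {n} {M} {d} pts dist Z Z0 mono (suc k) c c+k≡M ρ ρ≡0
    with mono c (subst (c <_) c+k≡M (ℕₚ.m<m+n c (s≤s z≤n)))
  ... | T , T≤d , TZ with span pts dist Z Z0 mono k (suc c) (trans (sym (ℕₚ.+-suc c k)) c+k≡M) ρ′ ρ′≡0
    where
    g : Fin N → Tree n
    g i = con (ρ i c) ⊗ (T ⊗ lagrange pts i)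
    c<M : c < M
    c<M = subst (c <_) c+k≡M (ℕₚ.m<m+n c (s≤s z≤n))
    ρ′ : Fin N → Series
    ρ′ i j = ρ i j + - eval (sumT g) (Z i) j
    g-coef : ∀ i i′ j → j < M → eval (g i′) (Z i) j ≡ ρ i′ c * (bump c 1# ⊛ eval (lagrange pts i′) (Z i)) j
    g-coef i i′ j j<M = trans (ι-⊛ (ρ i′ c) _ j) (cong (ρ i′ c *_) (⊛-cong-mod (TZ i) (λ _ _ → refl) j j<M))
    g-top : ∀ i i′ → eval (g i′) (Z i) c ≡ ρ i′ c * eval (lagrange pts i′) (Z i) 0
    g-top i i′ = trans (g-coef i i′ c c<M) (cong (ρ i′ c *_) (trans (cong (bump c 1# ⊛ eval (lagrange pts i′) (Z i)) (sym (ℕₚ.+-identityʳ c)))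
      (bump-⊛-≥ c (eval (lagrange pts i′) (Z i)) 0)))
    ρ′≡0 : ∀ i j → j < suc c → ρ′ i j ≡ 0#
    ρ′≡0 i j (s≤s j≤c) with ℕₚ.m≤n⇒m<n∨m≡n j≤c
    ... | inj₁ j<c = trans (cong₂ (λ x y → x + - y) (ρ≡0 i j j<c) (sumT-zero g (Z i) j (λ i′ →
            trans (g-coef i i′ j (ℕₚ.<-trans j<c c<M)) (trans (cong (ρ i′ c *_) (bump-⊛-< c _ j<c)) (zeroʳ _))))) (x-x refl)
    ... | inj₂ refl = x-x (sym (trans (sumT-single g (Z i) c i (λ i′ i′≢i → trans (g-top i i′)
            (trans (cong (ρ i′ c *_) (lagrange-0 pts dist i′ i i′≢i (Z i) (Z0 i))) (zeroʳ _))))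
          (trans (g-top i i) (trans (cong (ρ i c *_) (lagrange-1 pts dist i (Z i) (Z0 i))) (*-identityʳ _)))))
  ... | p , pZ = addP (toPoly (d ℕ.+ N) s s≤) p , λ i j j<M →
    trans (⟦addP⟧ (toPoly (d ℕ.+ N) s s≤) p (Z i) j) (trans (cong₂ _+_ (⟦toPoly⟧ (d ℕ.+ N) s s≤ (Z i) j) (pZ i j j<M))
      (trans (+-comm _ _) (trans (+-assoc _ _ _) (trans (cong (ρ i j +_) (-‿inverseˡ _)) (+-identityʳ _)))))
    where
    s : Tree n
    s = sumT (λ i → con (ρ i c) ⊗ (T ⊗ lagrange pts i))
    s≤ : deg s ≤ d ℕ.+ N
    s≤ = deg-sumT _ (λ i → ℕₚ.+-mono-≤ T≤d (deg-lagrange pts i))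

  -- Choosing an interpolant for each of the `P ^ (N * M)` prescriptions is an injection into the
  -- `P ^ κ n E` polynomials; compare exponents.
  interpolation-count : ∀ {N n M E} (Z : Fin N → Fin n → Series) →
    ((ρ : Fin N → Series) → ∃ λ (p : Poly n E) → ∀ i → ⟦ p ⟧ (Z i) ≈[ M ] ρ i) → N ℕ.* M ≤ κ n E
  interpolation-count {N} {n} {M} {E} Z onto = ^-cancelˡ-≤ P 1<P (Finₚ.injective⇒≤ {f = λ h → encode (poly h)} inj)
    where
    ρ : Fin (P ^ (N ℕ.* M)) → Fin N → Series
    ρ h i j with j ℕ.<? M
    ... | yes j<M = finToFun h (combine i (fromℕ< j<M))
    ... | no _    = 0#
    poly : Fin (P ^ (N ℕ.* M)) → Poly n E
    poly h = proj₁ (onto (ρ h))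
    ρ-at : ∀ h i (j : Fin M) → ρ h i (toℕ j) ≡ finToFun h (combine i j)
    ρ-at h i j with toℕ j ℕ.<? M
    ... | yes j<M = cong (λ j → finToFun h (combine i j)) (Finₚ.fromℕ<-toℕ j j<M)
    ... | no j≮M = contradiction (Finₚ.toℕ<n j) j≮M
    inj : Injective _≡_ _≡_ (λ h → encode (poly h))
    inj {h} {h′} eq = finToFun-injective {N ℕ.* M} λ x → subst (λ x → finToFun h x ≡ finToFun h′ x) (Finₚ.combine-remQuot {N} M x)
      (let i , j = remQuot {N} M x in
       trans (sym (ρ-at h i j)) (trans (sym (proj₂ (onto (ρ h)) i (toℕ j) (Finₚ.toℕ<n j)))
       (trans (cong (λ p → ⟦ p ⟧ (Z i) (toℕ j)) (encode-injective {p = poly h} {poly h′} eq))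
       (trans (proj₂ (onto (ρ h′)) i (toℕ j) (Finₚ.toℕ<n j)) (ρ-at h′ i j)))))

  -- The base r of the lift is taken to be `N` itself. Then monomials and Lagrange polynomials both
  -- have degree linear in `N`, so the number of coefficients is at most `N ^ n` times a constant,
  -- while `N * N ^ n` of them are needed; `N ^ n` cancels.
  bezout : ∀ {N n d} (f : Fin n → Tree n) → (∀ j → deg (f j) ≤ d) → (pts : Fin N → Fin n → F) → Distinct pts →
           (∀ i → Zero f (pts i)) → (∀ i → NonSingular f (pts i)) → N ≤ (n ℕ.* d ℕ.+ 2) ^ n
  bezout {zero} f f≤d pts dist zs ns = z≤n
  bezout {N@(suc N-1)} {n} {d} f f≤d pts dist zs ns = ℕₚ.*-cancelˡ-≤ (N ^ n) {{ℕₚ.m^n≢0 N n}} (begin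
    N ^ n ℕ.* N                             ≡⟨ ℕₚ.*-comm (N ^ n) N ⟩
    N ℕ.* M                                 ≤⟨ interpolation-count {M = M} {E} Z
                                                 (λ ρ → span pts dist Z Z0 mono M 0 refl ρ (λ _ _ ())) ⟩
    κ n E                                   ≤⟨ κ-bound n E ⟩
    suc E ^ n                               ≤⟨ ℕₚ.^-monoˡ-≤ n E< ⟩
    (N ℕ.* (n ℕ.* d ℕ.+ 2)) ^ n             ≡⟨ ^-distribʳ-* n N (n ℕ.* d ℕ.+ 2) ⟩
    N ^ n ℕ.* (n ℕ.* d ℕ.+ 2) ^ n           ∎)
    where
    open ℕₚ.≤-Reasoning
    M E : ℕ
    M = N ^ n
    -- The first summand is the degree coming from `digits` with r = N, the second the degree of a
    -- Lagrange polynomial on `N` points.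
    E = n ℕ.* (N ℕ.* d) ℕ.+ N
    E< : suc E ≤ N ℕ.* (n ℕ.* d ℕ.+ 2)
    E< = begin
      suc (n ℕ.* (N ℕ.* d) ℕ.+ N)           ≤⟨ ℕₚ.+-monoˡ-≤ (n ℕ.* (N ℕ.* d) ℕ.+ N) (s≤s (z≤n {N-1})) ⟩
      N ℕ.+ (n ℕ.* (N ℕ.* d) ℕ.+ N)         ≡⟨ solve 3 (λ n N d → N :+ (n :* (N :* d) :+ N) := N :* (n :* d :+ con 2)) refl n N d ⟩
      N ℕ.* (n ℕ.* d ℕ.+ 2)                 ∎
      where open +-*-Solver
    lift = λ i → hensel f (pts i) (zs i) (ns i) (λ j → bump (N ^ toℕ j) 1#)
                   (λ j → bump-< (N ^ toℕ j) 1# (ℕₚ.m^n>0 N (toℕ j))) M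
    Z : Fin N → Fin n → Series
    Z i = proj₁ (lift i)
    Z0 : ∀ i v → Z i v 0 ≡ pts i v
    Z0 i = proj₁ (proj₂ (lift i))
    mono : ∀ c → c < M → ∃ λ (T : Tree n) → deg T ≤ n ℕ.* (N ℕ.* d) × (∀ i → eval T (Z i) ≈[ M ] bump c 1#)
    mono c c<M with digits n f Z N 1 f≤d
      (λ i j l l<M → trans (proj₂ (proj₂ (lift i)) j l (ℕₚ.<⇒≤ l<M)) (cong (λ e → bump e 1# l) (sym (ℕₚ.*-identityˡ (N ^ toℕ j))))) c c<M
    ... | T , T≤ , TZ = T , T≤ , λ i l l<M → trans (TZ i l l<M) (cong (λ e → bump e 1# l) (ℕₚ.*-identityˡ c))

uncurried-≤ : ∀ {a b c d e} (Φ : Fin a → Fin b → Fin c → Fin d → Fin e) →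
  (∀ {w w′ x x′ y y′ z z′} → Φ w x y z ≡ Φ w′ x′ y′ z′ → w ≡ w′ × x ≡ x′ × y ≡ y′ × z ≡ z′) →
  a ℕ.* (b ℕ.* (c ℕ.* d)) ≤ e
uncurried-≤ {a} {b} {c} {d} Φ inj = Finₚ.injective⇒≤ {f = Ψ} Ψ-inj
  where
  Ψ : Fin (a ℕ.* (b ℕ.* (c ℕ.* d))) → _
  Ψ i = let w , i′ = remQuot {a} _ i ; x , i″ = remQuot {b} _ i′ ; y , z = remQuot {c} _ i″ in Φ w x y z
  remQuot-≡ : ∀ {m} k {i j : Fin (m ℕ.* k)} → proj₁ (remQuot {m} k i) ≡ proj₁ (remQuot {m} k j) →
              proj₂ (remQuot {m} k i) ≡ proj₂ (remQuot {m} k j) → i ≡ j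
  remQuot-≡ {m} k {i} {j} p r = trans (sym (Finₚ.combine-remQuot {m} k i))
    (trans (cong₂ combine p r) (Finₚ.combine-remQuot {m} k j))
  Ψ-inj : Injective _≡_ _≡_ Ψ
  Ψ-inj eq with inj eq
  ... | w≡ , x≡ , y≡ , z≡ = remQuot-≡ {a} _ w≡ (remQuot-≡ {b} _ x≡ (remQuot-≡ {c} _ y≡ z≡))

-- Counting polynomial maps with disjoint singular zeros

module Singular {P : ℕ} (𝔽 : FiniteField P) (D₀ m L J : ℕ) where

  open Bezout 𝔽 public

  -- `n` counts both the equations and the unknowns of a path, `h` the edges of `J` paths. A Hermite
  -- interpolant at `h` points is an affine factor times the square of a Lagrange polynomial, whence
  -- Δ = 2h+1.
  n h Δ : ℕ
  n = L ℕ.* m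
  h = J ℕ.* L
  Δ = suc (h ℕ.+ h)

  Term : Set
  Term = Fin n ⊎ F

  value tangent : Term → (Fin n → F) → F
  value (inj₁ v) z = z v
  value (inj₂ c) z = c
  tangent (inj₁ v) δ = δ v
  tangent (inj₂ c) δ = 0#

  -- The equations g(σ e) = ρ e + off e, one for each edge e; the variable in position e·m + x occurs on the edge e.
  record System : Set where
    field
      σ       : Fin L → Fin D₀ → Term
      ρ       : Fin L → Fin m → Term
      off     : Fin L → Fin m → F
      covered : ∀ e x → (∃ λ y → σ e y ≡ inj₁ (combine e x)) ⊎ (∃ λ y → ρ e y ≡ inj₁ (combine e x))

    point : (Fin n → F) → Fin L → Fin D₀ → F
    point z e y = value (σ e y) z

    direction : (Fin n → F) → Fin L → Fin D₀ → F
    direction δ e y = tangent (σ e y) δ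

  open System

  row : Fin (P ^ (J ℕ.* n)) → Fin J → Fin n → F
  row c j v = finToFun c (combine j v)

  row-injective : ∀ {a b} → (∀ j v → row a j v ≡ row b j v) → a ≡ b
  row-injective {a} {b} eq = finToFun-injective {J ℕ.* n} λ x →
    subst (λ x → finToFun a x ≡ finToFun b x) (Finₚ.combine-remQuot {J} n x) (eq _ _)

  points : System → Fin (P ^ (J ℕ.* n)) → Fin h → Fin D₀ → F
  points s zc i = let j , e = remQuot {J} L i in point s (row zc j) e

  directions : System → Fin (P ^ (J ℕ.* n)) → Fin h → Fin D₀ → F
  directions s dc i = let j , e = remQuot {J} L i in direction s (row dc j) e

  arc : System → (z δ : Fin n → F) → Fin L → Fin D₀ → Series
  arc s z δ e = dual (point s z e) (direction s δ e)

  -- All `J` tangents share the support `S` and the normalised coordinate `τ`, which are part of the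
  -- colour. A decoder thus knows in advance which coordinates hold tangent data and which are
  -- spare.
  record SingularFamily (s : System) (S : Fin n → Bool) (τ : Fin n) (g : Fin m → Poly D₀ Δ)
                        (zc dc : Fin (P ^ (J ℕ.* n))) : Set where
    field
      distinct : Distinct (points s zc)
      on-zero  : ∀ j e x → ⟦ g x ⟧ (arc s (row zc j) (row dc j) e) 0 ≡ value (ρ s e x) (row zc j) + off s e x
      kernel   : ∀ j e x → ⟦ g x ⟧ (arc s (row zc j) (row dc j) e) 1 ≡ tangent (ρ s e x) (row dc j)
      outside  : ∀ j v → S v ≡ false → row dc j v ≡ 0#
      inside   : ∀ j v → S v ≡ true → row dc j v ≢ 0#
      unit     : ∀ j → row dc j τ ≡ 1#

  open SingularFamily

  singularFamily? : ∀ s S τ g zc dc → Dec (SingularFamily s S τ g zc dc)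
  singularFamily? s S τ g zc dc with
    (all? λ i → all? λ j → ¬? (i ≟ j) →-dec ¬? (all? λ y → points s zc i y ≟ points s zc j y))
    ×-dec (all? λ j → all? λ e → all? λ x → ⟦ g x ⟧ (arc s (row zc j) (row dc j) e) 0 ≟ (value (ρ s e x) (row zc j) + off s e x))
    ×-dec (all? λ j → all? λ e → all? λ x → ⟦ g x ⟧ (arc s (row zc j) (row dc j) e) 1 ≟ tangent (ρ s e x) (row dc j))
    ×-dec (all? λ j → all? λ v → (S v Boolₚ.≟ false) →-dec (row dc j v ≟ 0#))
    ×-dec (all? λ j → all? λ v → (S v Boolₚ.≟ true) →-dec ¬? (row dc j v ≟ 0#))
    ×-dec (all? λ j → row dc j τ ≟ 1#)
  ... | yes (a , b , c , d , e , f) = yes record { distinct = a ; on-zero = b ; kernel = c ; outside = d ; inside = e ; unit = f }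
  ... | no ¬p = no λ b → ¬p (distinct b , on-zero b , kernel b , outside b , inside b , unit b)

  -- An affine form vanishing at p with slope 1 in the direction η (junk when η = 0).
  tangentT : (p η : Fin D₀ → F) → Tree D₀
  tangentT p η with any? (λ x → ¬? (η x ≟ 0#))
  ... | yes (x , _) = (var x ⊕ con (- p x)) ⊗ con (inv (η x))
  ... | no _        = con 0#

  deg-tangentT : ∀ p η → deg (tangentT p η) ≤ 1
  deg-tangentT p η with any? (λ x → ¬? (η x ≟ 0#))
  ... | yes _ = s≤s z≤n
  ... | no _  = z≤n

  tangentT-0 : ∀ p η → eval (tangentT p η) (dual p η) 0 ≡ 0#
  tangentT-0 p η with any? (λ x → ¬? (η x ≟ 0#))
  ... | yes (x , _) = trans (cong (_* inv (η x)) (x-x refl)) (zeroˡ _)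
  ... | no _        = refl

  tangentT-1 : ∀ p η → ¬ (∀ x → η x ≡ 0#) → eval (tangentT p η) (dual p η) 1 ≡ 1#
  tangentT-1 p η η≢0 with any? (λ x → ¬? (η x ≟ 0#))
  ... | yes (x , ηx≢0) = trans (cong₂ _+_ (zeroʳ _) (trans (cong (_* inv (η x)) (+-identityʳ (η x))) (inverseʳ ηx≢0))) (+-identityˡ _)
  ... | no all0 = contradiction (λ x → decidable-stable (η x ≟ 0#) (λ ne → all0 (x , ne))) η≢0

  module Hermite (pts dirs : Fin h → Fin D₀ → F) where

    -- The square kills the derivative at the other points, and the tangent factor kills the value
    -- at the own point while giving slope 1 there.
    hermite : Fin h → Tree D₀
    hermite i = tangentT (pts i) (dirs i) ⊗ (lagrange pts i ⊗ lagrange pts i)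

    valT derT : (Fin h → F) → Tree D₀
    valT c = sumT (λ i → con (c i) ⊗ lagrange pts i)
    derT c = sumT (λ i → con (c i) ⊗ hermite i)

    pertT : (c c′ : Fin h → F) → Tree D₀
    pertT c c′ = valT c ⊕ derT c′

    deg-pertT : ∀ c c′ → deg (pertT c c′) ≤ Δ
    deg-pertT c c′ = ℕₚ.⊔-lub
      (ℕₚ.≤-trans (deg-sumT (λ i → con (c i) ⊗ lagrange pts i) (deg-lagrange pts)) (ℕₚ.m≤n⇒m≤1+n (ℕₚ.m≤m+n h h)))
      (deg-sumT (λ i → con (c′ i) ⊗ hermite i) (λ i → ℕₚ.+-mono-≤ (deg-tangentT (pts i) (dirs i))
        (ℕₚ.+-mono-≤ (deg-lagrange pts i) (deg-lagrange pts i))))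

    module _ (dist : Distinct pts) where

      Z : Fin h → Fin D₀ → Series
      Z i = dual (pts i) (dirs i)

      lagrange-≢ : ∀ i j → j ≢ i → eval (lagrange pts j) (Z i) 0 ≡ 0#
      lagrange-≢ i j j≢i = lagrange-0 pts dist j i j≢i (Z i) (λ _ → refl)

      hermite-0 : ∀ i j → eval (hermite j) (Z i) 0 ≡ 0#
      hermite-0 i j with j ≟ i
      ... | yes refl = trans (cong (_* (eval (lagrange pts i) (Z i) 0 * eval (lagrange pts i) (Z i) 0))
              (tangentT-0 (pts i) (dirs i))) (zeroˡ _)
      ... | no j≢i rewrite lagrange-≢ i j j≢i = trans (cong (eval (tangentT (pts j) (dirs j)) (Z i) 0 *_) (zeroˡ _)) (zeroʳ _)

      hermite-1-≢ : ∀ i j → j ≢ i → eval (hermite j) (Z i) 1 ≡ 0#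
      hermite-1-≢ i j j≢i rewrite lagrange-≢ i j j≢i =
        solve 3 (λ a b c → a :* (con 0 :* b :+ b :* con 0) :+ c :* (con 0 :* con 0) := con 0) refl
          (eval (tangentT (pts j) (dirs j)) (Z i) 0) (eval (lagrange pts j) (Z i) 1) (eval (tangentT (pts j) (dirs j)) (Z i) 1)
        where open FSolver

      hermite-1 : ∀ i → ¬ (∀ x → dirs i x ≡ 0#) → eval (hermite i) (Z i) 1 ≡ 1#
      hermite-1 i ne rewrite tangentT-0 (pts i) (dirs i) | tangentT-1 (pts i) (dirs i) ne
                           | lagrange-1 pts dist i (Z i) (λ _ → refl) =
        solve 1 (λ b → con 0 :* b :+ con 1 :* (con 1 :* con 1) := con 1) refl _
        where open FSolver

      pertT-0 : ∀ c c′ i → eval (pertT c c′) (Z i) 0 ≡ c i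
      pertT-0 c c′ i = trans (cong₂ _+_
        (trans (sumT-single (λ i → con (c i) ⊗ lagrange pts i) (Z i) 0 i
                 (λ j j≢i → trans (cong (c j *_) (lagrange-≢ i j j≢i)) (zeroʳ _)))
               (trans (cong (c i *_) (lagrange-1 pts dist i (Z i) (λ _ → refl))) (*-identityʳ _)))
        (sumT-zero (λ i → con (c′ i) ⊗ hermite i) (Z i) 0 (λ j → trans (cong (c′ j *_) (hermite-0 i j)) (zeroʳ _))))
        (+-identityʳ _)

      -- The value part contributes a derivative of its own, but one that depends on `c` alone; once
      -- `c` is known, `c′` can be read.
      pertT-1 : ∀ c c′ i → ¬ (∀ x → dirs i x ≡ 0#) → eval (pertT c c′) (Z i) 1 ≡ eval (valT c) (Z i) 1 + c′ i
      pertT-1 c c′ i ne = cong (eval (valT c) (Z i) 1 +_)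
        (trans (sumT-single (λ i → con (c′ i) ⊗ hermite i) (Z i) 1 i
                 (λ j j≢i → trans (ι-⊛ (c′ j) (eval (hermite j) (Z i)) 1) (trans (cong (c′ j *_) (hermite-1-≢ i j j≢i)) (zeroʳ _))))
               (trans (ι-⊛ (c′ i) (eval (hermite i) (Z i)) 1) (trans (cong (c′ i *_) (hermite-1 i ne)) (*-identityʳ _))))

  open Hermite using (pertT; deg-pertT; valT; pertT-0; pertT-1)

  -- Perturbation parameters are indexed by path, edge and component of g, tangent coordinates by
  -- path and unknown. Since n = L·m these are the same index set, and `combine e x` identifies
  -- equation x of edge e with the unknown it is paired with.
  slot : Fin (P ^ (J ℕ.* n)) → Fin m → Fin h → F
  slot c x i = let j , e = remQuot {J} L i in row c j (combine e x)

  slot-combine : ∀ c x j e → slot c x (combine j e) ≡ row c j (combine e x)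
  slot-combine c x j e = cong (λ (j , e) → row c j (combine e x)) (Finₚ.remQuot-combine {J} j e)

  slots-injective : ∀ {a b} → (∀ x i → slot a x i ≡ slot b x i) → a ≡ b
  slots-injective {a} {b} eq = row-injective λ j v → subst (λ v → row a j v ≡ row b j v) (Finₚ.combine-remQuot {L} m v)
    (let e , x = remQuot {L} m v in trans (sym (slot-combine a x j e)) (trans (eq x (combine j e)) (slot-combine b x j e)))

  perturb : System → (zc dc c c′ : Fin (P ^ (J ℕ.* n))) → Fin m → Poly D₀ Δ
  perturb s zc dc c c′ x = toPoly Δ (pertT (points s zc) (directions s dc) (slot c x) (slot c′ x))
    (deg-pertT (points s zc) (directions s dc) (slot c x) (slot c′ x))

  -- Coordinates outside the support S vanish, which leaves room for the perturbations c′ of the derivatives that cannot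
  -- be read off the perturbed polynomials; the coordinate τ is known to be 1 and stores a free element x of F, which is
  -- where each singular zero gains a factor P.
  tangentCode : (S : Fin n → Bool) (τ : Fin n) → F → (δ c′ : Fin n → F) → Fin n → F
  tangentCode S τ x δ c′ v with v ≟ τ | S v
  ... | yes _ | _     = x
  ... | no _  | true  = δ v
  ... | no _  | false = c′ v

  tangentCode-τ : ∀ S τ x δ c′ → tangentCode S τ x δ c′ τ ≡ x
  tangentCode-τ S τ x δ c′ with τ ≟ τ
  ... | yes _  = refl
  ... | no τ≢τ = contradiction refl τ≢τ

  tangentCode-inside : ∀ S τ x δ c′ {v} → v ≢ τ → S v ≡ true → tangentCode S τ x δ c′ v ≡ δ v
  tangentCode-inside S τ x δ c′ {v} v≢τ Sv with v ≟ τ | S v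
  ... | yes v≡τ | _    = contradiction v≡τ v≢τ
  ... | no _    | true = refl

  tangentCode-outside : ∀ S τ x δ c′ {v} → v ≢ τ → S v ≡ false → tangentCode S τ x δ c′ v ≡ c′ v
  tangentCode-outside S τ x δ c′ {v} v≢τ Sv with v ≟ τ | S v
  ... | yes v≡τ | _     = contradiction v≡τ v≢τ
  ... | no _    | false = refl

  ⟦perturbed⟧ : ∀ (g : Poly D₀ Δ) s zc dc c c′ x Z k →
    ⟦ addP g (perturb s zc dc c c′ x) ⟧ Z k ≡ ⟦ g ⟧ Z k + eval (pertT (points s zc) (directions s dc) (slot c x) (slot c′ x)) Z k
  ⟦perturbed⟧ g s zc dc c c′ x Z k = trans (⟦addP⟧ g (perturb s zc dc c c′ x) Z k)
    (cong (⟦ g ⟧ Z k +_) (⟦toPoly⟧ Δ (pertT (points s zc) (directions s dc) (slot c x) (slot c′ x)) (deg-pertT (points s zc) (directions s dc) (slot c x) (slot c′ x)) Z k))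

  tangents-≡ : ∀ {s S τ g₁ g₂ zc₁ zc₂ dc₁ dc₂} → SingularFamily s S τ g₁ zc₁ dc₁ → SingularFamily s S τ g₂ zc₂ dc₂ →
    ∀ {x₁ x₂ : Fin J → F} {c₁ c₂} →
    (∀ j v → tangentCode S τ (x₁ j) (row dc₁ j) (row c₁ j) v ≡ tangentCode S τ (x₂ j) (row dc₂ j) (row c₂ j) v) → dc₁ ≡ dc₂
  tangents-≡ {S = S} {τ} B₁ B₂ code≡ = row-injective go
    where
    go : ∀ j v → _
    go j v with v ≟ τ
    ... | yes refl = trans (unit B₁ j) (sym (unit B₂ j))
    ... | no v≢τ with S v in Sv
    ...   | true  = trans (sym (tangentCode-inside S τ _ _ _ v≢τ Sv)) (trans (code≡ j v) (tangentCode-inside S τ _ _ _ v≢τ Sv))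
    ...   | false = trans (outside B₁ j v Sv) (sym (outside B₂ j v Sv))

  ⟦⟧-1-constant : ∀ {n d} (p : Poly n d) {Z : Fin n → Series} → (∀ y → Z y 1 ≡ 0#) → ⟦ p ⟧ Z 1 ≡ 0#
  ⟦⟧-1-constant (con c)  Z1 = refl
  ⟦⟧-1-constant (base c) Z1 = refl
  ⟦⟧-1-constant (p +x* p′) {Z} Z1 = trans (cong₂ _+_ (⟦⟧-1-constant p (Z1 ∘ suc))
    (trans (cong₂ _+_ (trans (cong (Z zero 0 *_) (⟦⟧-1-constant p′ Z1)) (zeroʳ _))
                      (trans (cong (_* ⟦ p′ ⟧ Z 0) (Z1 zero)) (zeroˡ _))) (+-identityˡ _))) (+-identityˡ _)

  -- If the argument of g does not move along edge e, the kernel equations keep the right-hand sides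
  -- still as well. By `covered` the whole block of unknowns paired with e lies among these terms.
  direction-0⇒tangent-0 : ∀ {s S τ g zc dc} → SingularFamily s S τ g zc dc → ∀ j e →
    (∀ y → direction s (row dc j) e y ≡ 0#) → ∀ x → row dc j (combine e x) ≡ 0#
  direction-0⇒tangent-0 {s} {g = g} {zc} {dc} B j e dir≡0 x with covered s e x
  ... | inj₁ (y , σ≡) = trans (cong (λ t → tangent t (row dc j)) (sym σ≡)) (dir≡0 y)
  ... | inj₂ (y , ρ≡) = trans (cong (λ t → tangent t (row dc j)) (sym ρ≡))
                          (trans (sym (kernel B j e y)) (⟦⟧-1-constant (g y) dir≡0))

  module _ {s : System} {S τ zc dc} {g₁ g₂ : Fin m → Poly D₀ Δ}
           (B₁ : SingularFamily s S τ g₁ zc dc) (B₂ : SingularFamily s S τ g₂ zc dc)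
           {c₁ c₂ c₁′ c₂′ : Fin (P ^ (J ℕ.* n))} {x₁ x₂ : Fin J → F}
           (g≡ : ∀ x → addP (g₁ x) (perturb s zc dc c₁ c₁′ x) ≡ addP (g₂ x) (perturb s zc dc c₂ c₂′ x))
           (code≡ : ∀ j v → tangentCode S τ (x₁ j) (row dc j) (row c₁′ j) v ≡ tangentCode S τ (x₂ j) (row dc j) (row c₂′ j) v)
           where

    private
      pts dirs : Fin h → Fin D₀ → F
      pts  = points s zc
      dirs = directions s dc
      Z : Fin h → Fin D₀ → Series
      Z i = dual (pts i) (dirs i)
      pert : (c c′ : Fin (P ^ (J ℕ.* n))) → Fin m → Tree D₀
      pert c c′ x = pertT pts dirs (slot c x) (slot c′ x)

    ⟦g⟧≡ : ∀ x i k → ⟦ g₁ x ⟧ (Z i) k + eval (pert c₁ c₁′ x) (Z i) k ≡ ⟦ g₂ x ⟧ (Z i) k + eval (pert c₂ c₂′ x) (Z i) k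
    ⟦g⟧≡ x i k = trans (sym (⟦perturbed⟧ (g₁ x) s zc dc c₁ c₁′ x (Z i) k))
      (trans (cong (λ p → ⟦ p ⟧ (Z i) k) (g≡ x)) (⟦perturbed⟧ (g₂ x) s zc dc c₂ c₂′ x (Z i) k))

    -- At a zero the value of g equals the right-hand side of its equation, which depends on the
    -- colour and the points but not on g. The value of the perturbed polynomial therefore reveals
    -- `c`.
    perturb₀-≡ : ∀ x i → slot c₁ x i ≡ slot c₂ x i
    perturb₀-≡ x i = trans (sym (pertT-0 pts dirs (distinct B₁) (slot c₁ x) (slot c₁′ x) i))
      (trans (+-cancelˡ (⟦ g₁ x ⟧ (Z i) 0) _ _ (trans (⟦g⟧≡ x i 0)
               (cong (_+ eval (pert c₂ c₂′ x) (Z i) 0) (trans (on-zero B₂ _ _ x) (sym (on-zero B₁ _ _ x))))))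
             (pertT-0 pts dirs (distinct B₁) (slot c₂ x) (slot c₂′ x) i))

    c≡ : c₁ ≡ c₂
    c≡ = slots-injective perturb₀-≡

    -- The paired tangent coordinate vanishes here, so it is outside the support by `inside` and
    -- differs from `τ` by `unit`. That is where the tangent code stores `c′`.
    untouched-≡ : ∀ x i → (∀ y → dirs i y ≡ 0#) → slot c₁′ x i ≡ slot c₂′ x i
    untouched-≡ x i dir≡0 = trans (sym (tangentCode-outside S τ _ _ _ v≢τ Sv)) (trans (code≡ j v) (tangentCode-outside S τ _ _ _ v≢τ Sv))
      where
      j = proj₁ (remQuot {J} L i)
      v = combine (proj₂ (remQuot {J} L i)) x
      δv≡0 : row dc j v ≡ 0#
      δv≡0 = direction-0⇒tangent-0 B₁ j _ dir≡0 x
      v≢τ : v ≢ τ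
      v≢τ v≡τ = 1≢0 (trans (sym (unit B₁ j)) (trans (cong (row dc j) (sym v≡τ)) δv≡0))
      Sv : S v ≡ false
      Sv with S v in eq
      ... | false = refl
      ... | true  = contradiction δv≡0 (inside B₁ j v eq)

    -- Where the direction is nonzero, `kernel` prescribes the derivative of g independently of g,
    -- and the derivative of the perturbed polynomial reveals `c′`.
    perturb₁-≡ : ∀ x i → slot c₁′ x i ≡ slot c₂′ x i
    perturb₁-≡ x i with all? (λ y → dirs i y ≟ 0#)
    ... | yes dir≡0 = untouched-≡ x i dir≡0
    ... | no ne = +-cancelˡ (eval (valT pts dirs (slot c₁ x)) (Z i) 1) _ _
      (trans (sym (pertT-1 pts dirs (distinct B₁) (slot c₁ x) (slot c₁′ x) i ne))
      (trans (+-cancelˡ (⟦ g₁ x ⟧ (Z i) 1) _ _ (trans (⟦g⟧≡ x i 1)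
               (cong (_+ eval (pert c₂ c₂′ x) (Z i) 1) (trans (kernel B₂ _ _ x) (sym (kernel B₁ _ _ x))))))
      (trans (pertT-1 pts dirs (distinct B₁) (slot c₂ x) (slot c₂′ x) i ne)
             (cong (λ c → eval (valT pts dirs (slot c x)) (Z i) 1 + slot c₂′ x i) (sym c≡)))))

    c′≡ : c₁′ ≡ c₂′
    c′≡ = slots-injective perturb₁-≡

    g₁≗g₂ : ∀ x → g₁ x ≡ g₂ x
    g₁≗g₂ x = addP-cancelʳ _ _ _ (trans (g≡ x)
      (cong₂ (λ c c′ → addP (g₂ x) (perturb s zc dc c c′ x)) (sym c≡) (sym c′≡)))

    x≗ : ∀ j → x₁ j ≡ x₂ j
    x≗ j = trans (sym (tangentCode-τ S τ _ _ _)) (trans (code≡ j τ) (tangentCode-τ S τ _ _ _))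

  tangentCodes : (S : Fin n → Bool) (τ : Fin n) → Fin (P ^ J) → (dc c′ : Fin (P ^ (J ℕ.* n))) → Fin (P ^ (J ℕ.* n))
  tangentCodes S τ x dc c′ = funToFin λ i → let j , v = remQuot {J} n i in
    tangentCode S τ (finToFun x j) (row dc j) (row c′ j) v

  tangentCodes-≡ : ∀ {S τ x₁ x₂ dc₁ dc₂ c₁ c₂} → tangentCodes S τ x₁ dc₁ c₁ ≡ tangentCodes S τ x₂ dc₂ c₂ →
    ∀ j v → tangentCode S τ (finToFun x₁ j) (row dc₁ j) (row c₁ j) v ≡ tangentCode S τ (finToFun x₂ j) (row dc₂ j) (row c₂ j) v
  tangentCodes-≡ {S} {τ} {x₁} {x₂} {dc₁} {dc₂} {c₁} {c₂} eq j v = subst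
    (λ (j , v) → tangentCode S τ (finToFun x₁ j) (row dc₁ j) (row c₁ j) v ≡ tangentCode S τ (finToFun x₂ j) (row dc₂ j) (row c₂ j) v)
    (Finₚ.remQuot-combine {J} j v) (funToFin-injective eq (combine j v))

  polys : Fin ((P ^ κ D₀ Δ) ^ m) → Fin m → Poly D₀ Δ
  polys g x = decode D₀ Δ (finToFun g x)

  module _ {K : ℕ} (sys : Fin K → System) (S : Fin K → Fin n → Bool) (τ : Fin K → Fin n) where

    Bad : (Fin m → Poly D₀ Δ) → Set
    Bad g = ∃ λ χ → ∃ λ zc → ∃ λ dc → SingularFamily (sys χ) (S χ) (τ χ) g zc dc

    bad? : ∀ g → Dec (Bad g)
    bad? g = any? λ χ → any? λ zc → any? λ dc → singularFamily? (sys χ) (S χ) (τ χ) g zc dc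

    private
      C G : ℕ
      C = P ^ (J ℕ.* n)
      G = (P ^ κ D₀ Δ) ^ m

    polyCode : Fin G → Fin K → (zc dc c c′ : Fin C) → Fin G
    polyCode g χ zc dc c c′ = funToFin λ y → encode (addP (polys g y) (perturb (sys χ) zc dc c c′ y))

    -- The codes of the points and of the tangents take up exactly the room of the two parameter
    -- vectors `c` and `c′`. Injectivity thus compares `G * (P ^ J * (C * C))` inputs with
    -- `K * (G * (C * C))` outputs, a gain of `P ^ J` over the loss `K`.
    fingerprint : (g : Fin G) → Bad (polys g) → Fin (P ^ J) → (c c′ : Fin C) → Fin (K ℕ.* (G ℕ.* (C ℕ.* C)))
    fingerprint g (χ , zc , dc , _) x c c′ =
      combine χ (combine (polyCode g χ zc dc c c′) (combine zc (tangentCodes (S χ) (τ χ) x dc c′)))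

    private
      same-tangents : ∀ {g₁ g₂ χ zc dc₁ dc₂} →
        SingularFamily (sys χ) (S χ) (τ χ) (polys g₁) zc dc₁ → SingularFamily (sys χ) (S χ) (τ χ) (polys g₂) zc dc₂ →
        ∀ {x₁ x₂ c₁ c₂ c₁′ c₂′} → dc₁ ≡ dc₂ → polyCode g₁ χ zc dc₁ c₁ c₁′ ≡ polyCode g₂ χ zc dc₂ c₂ c₂′ →
        tangentCodes (S χ) (τ χ) x₁ dc₁ c₁′ ≡ tangentCodes (S χ) (τ χ) x₂ dc₂ c₂′ →
        g₁ ≡ g₂ × x₁ ≡ x₂ × c₁ ≡ c₂ × c₁′ ≡ c₂′
      same-tangents {dc₁ = dc} B₁ B₂ {x₁} {x₂} {c₁} {c₂} {c₁′} {c₂′} refl polyCode≡ code≡ =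
          finToFun-injective (λ y → decode-injective D₀ Δ (g₁≗g₂ B₁ B₂ {c₁} {c₂} {c₁′} {c₂′} {finToFun x₁} {finToFun x₂} polys≡ codes≡ y))
        , finToFun-injective (x≗ B₁ B₂ {c₁} {c₂} {c₁′} {c₂′} polys≡ codes≡)
        , c≡ B₁ B₂ {c₁} {c₂} {c₁′} {c₂′} {finToFun x₁} {finToFun x₂} polys≡ codes≡
        , c′≡ B₁ B₂ {c₁} {c₂} {c₁′} {c₂′} {finToFun x₁} {finToFun x₂} polys≡ codes≡
        where
        polys≡ = λ y → encode-injective (funToFin-injective polyCode≡ y)
        codes≡ = tangentCodes-≡ {x₁ = x₁} {x₂} {dc} {dc} {c₁′} {c₂′} code≡

      -- The order of decoding matters: the colour and the points are read directly, then the
      -- tangents from their code; only then do the two perturbations interpolate at the same data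
      -- and become comparable.
      same-colour : ∀ {g₁ g₂ χ₁ χ₂ zc₁ zc₂ dc₁ dc₂} →
        SingularFamily (sys χ₁) (S χ₁) (τ χ₁) (polys g₁) zc₁ dc₁ → SingularFamily (sys χ₂) (S χ₂) (τ χ₂) (polys g₂) zc₂ dc₂ →
        ∀ {x₁ x₂ c₁ c₂ c₁′ c₂′} → χ₁ ≡ χ₂ → zc₁ ≡ zc₂ → polyCode g₁ χ₁ zc₁ dc₁ c₁ c₁′ ≡ polyCode g₂ χ₂ zc₂ dc₂ c₂ c₂′ →
        tangentCodes (S χ₁) (τ χ₁) x₁ dc₁ c₁′ ≡ tangentCodes (S χ₂) (τ χ₂) x₂ dc₂ c₂′ →
        g₁ ≡ g₂ × x₁ ≡ x₂ × c₁ ≡ c₂ × c₁′ ≡ c₂′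
      same-colour {dc₁ = dc₁} {dc₂} B₁ B₂ {x₁} {x₂} {c₁′ = c₁′} {c₂′} refl refl polyCode≡ code≡ = same-tangents B₁ B₂
        (tangents-≡ B₁ B₂ {finToFun x₁} {finToFun x₂} {c₁′} {c₂′} (tangentCodes-≡ {x₁ = x₁} {x₂} {dc₁} {dc₂} {c₁′} {c₂′} code≡))
        polyCode≡ code≡

    fingerprint-injective : ∀ {g₁ g₂} (b₁ : Bad (polys g₁)) (b₂ : Bad (polys g₂)) {x₁ x₂ c₁ c₂ c₁′ c₂′} →
      fingerprint g₁ b₁ x₁ c₁ c₁′ ≡ fingerprint g₂ b₂ x₂ c₂ c₂′ → g₁ ≡ g₂ × x₁ ≡ x₂ × c₁ ≡ c₂ × c₁′ ≡ c₂′
    fingerprint-injective (χ₁ , zc₁ , dc₁ , B₁) (χ₂ , zc₂ , dc₂ , B₂) eq =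
      let χ≡ , eq₁ = Finₚ.combine-injective χ₁ _ χ₂ _ eq
          polyCode≡ , eq₂ = Finₚ.combine-injective _ _ _ _ eq₁
          zc≡ , code≡ = Finₚ.combine-injective zc₁ _ zc₂ _ eq₂
      in same-colour B₁ B₂ χ≡ zc≡ polyCode≡ code≡

    all-bad⇒≤ : (∀ g → Bad (polys g)) → P ^ J ≤ K
    all-bad⇒≤ bad = ℕₚ.*-cancelʳ-≤ (P ^ J) K (G ℕ.* (C ℕ.* C)) {{nonZero}}
      (subst (_≤ K ℕ.* (G ℕ.* (C ℕ.* C)))
        (solve 3 (λ t j c → t :* (j :* c) := j :* (t :* c)) refl G (P ^ J) (C ℕ.* C))
        (uncurried-≤ (λ g → fingerprint g (bad g)) (λ {g₁} {g₂} → fingerprint-injective (bad g₁) (bad g₂))))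
      where
      open +-*-Solver
      instance
        P≢0 : ℕ.NonZero P
        P≢0 = ℕ.>-nonZero (ℕₚ.<-trans (s≤s z≤n) 1<P)
      nonZero : ℕ.NonZero (G ℕ.* (C ℕ.* C))
      nonZero = ℕₚ.m*n≢0 G (C ℕ.* C) {{ℕₚ.m^n≢0 (P ^ κ D₀ Δ) m {{ℕₚ.m^n≢0 P (κ D₀ Δ)}}}}
                  {{ℕₚ.m*n≢0 C C {{ℕₚ.m^n≢0 P (J ℕ.* n)}} {{ℕₚ.m^n≢0 P (J ℕ.* n)}}}}

    exists-good : K < P ^ J → ∃ λ g → ¬ Bad (polys g)
    exists-good K< = Finₚ.¬∀⟶∃¬ _ (Bad ∘ polys) (bad? ∘ polys) (λ bad → ℕₚ.<⇒≱ K< (all-bad⇒≤ bad))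

-- The pigeonhole principle

split-by : ∀ {s} (p : Fin s → Bool) → ∃ λ a → ∃ λ b → a ℕ.+ b ≡ s ×
  (Σ (Fin a → Fin s) λ ω → Injective _≡_ _≡_ ω × (∀ i → p (ω i) ≡ true)) ×
  (Σ (Fin b → Fin s) λ ω → Injective _≡_ _≡_ ω × (∀ i → p (ω i) ≡ false))
split-by {zero} p = 0 , 0 , refl , ((λ ()) , (λ {}) , λ ()) , ((λ ()) , (λ {}) , λ ())
split-by {suc s} p with split-by (p ∘ suc) | p zero in p0
... | a , b , refl , (ω , ω-inj , ωt) , (ω′ , ω′-inj , ωf) | true =
  suc a , b , refl , (Fin.lift 1 ω , Finₚ.lift-injective ω ω-inj 1 , λ { zero → p0 ; (suc i) → ωt i })
                   , (suc ∘ ω′ , ω′-inj ∘ Finₚ.suc-injective , ωf)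
... | a , b , refl , (ω , ω-inj , ωt) , (ω′ , ω′-inj , ωf) | false =
  a , suc b , ℕₚ.+-suc a b , (suc ∘ ω , ω-inj ∘ Finₚ.suc-injective , ωt)
                           , (Fin.lift 1 ω′ , Finₚ.lift-injective ω′ ω′-inj 1 , λ { zero → p0 ; (suc i) → ωf i })

monochromatic : ∀ c {s} N (col : Fin s → Fin c) → c ℕ.* N < s →
  ∃ λ χ → Σ (Fin N → Fin s) λ ω → Injective _≡_ _≡_ ω × (∀ i → col (ω i) ≡ χ)
monochromatic zero {suc s} N col _ with () ← col zero
monochromatic (suc c) {s} N col cN<s with split-by (λ i → ⌊ col i ≟ zero ⌋)
... | a , b , refl , (ω , ω-inj , ωt) , (ω′ , ω′-inj , ωf) with N ℕ.≤? a
...   | yes N≤a = zero , ω ∘ (λ i → inject≤ i N≤a) , Finₚ.inject≤-injective N≤a N≤a _ _ ∘ ω-inj ,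
        λ i → is-zero (inject≤ i N≤a) (ωt (inject≤ i N≤a))
  where
  is-zero : ∀ i → ⌊ col (ω i) ≟ zero ⌋ ≡ true → col (ω i) ≡ zero
  is-zero i eq with yes p ← col (ω i) ≟ zero = p
...   | no N≰a = let χ , ω″ , ω″-inj , mono = monochromatic c N (proj₁ ∘ below) cN<b in
        suc χ , ω′ ∘ ω″ , ω″-inj ∘ ω′-inj , λ i → trans (proj₂ (below (ω″ i))) (cong suc (mono i))
  where
  below : ∀ i → ∃ λ χ → col (ω′ i) ≡ suc χ
  below i with col (ω′ i) | ωf i
  ... | suc χ | _ = χ , refl
  cN<b : c ℕ.* N < b
  cN<b = ℕₚ.+-cancelˡ-< N _ _ (ℕₚ.<-≤-trans cN<s (ℕₚ.+-monoˡ-≤ b (ℕₚ.<⇒≤ (ℕₚ.≰⇒> N≰a))))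

-- Pairing the unknowns of a path with its equations

⌈n/2⌉-cases : ∀ n → ⌈ n /2⌉ ≡ ⌊ n /2⌋ ⊎ ⌈ n /2⌉ ≡ suc ⌊ n /2⌋
⌈n/2⌉-cases zero          = inj₁ refl
⌈n/2⌉-cases (suc zero)    = inj₂ refl
⌈n/2⌉-cases (suc (suc n)) with ⌈n/2⌉-cases n
... | inj₁ eq = inj₁ (cong suc eq)
... | inj₂ eq = inj₂ (cong suc eq)

-- The unknowns of a path are laid out as y₁,x₁,y₂,x₂,…, so that position W·i + j belongs to y if j < ℓ and to x
-- otherwise; the block of positions m·e,…,m·e+m−1 then meets only the two ends of the edge number e.
record Layout : Set where
  field
    k′ A m ℓ L : ℕ

  a : ℕ
  a = A ℕ.+ m

  W : ℕ
  W = ℓ ℕ.+ a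

  field
    L≡      : L ≡ suc (k′ ℕ.+ k′)
    Lm≡k′W  : L ℕ.* m ≡ k′ ℕ.* W
    y-block : ∀ {e x i j} → e < L → x < m → j < W → m ℕ.* e ℕ.+ x ≡ W ℕ.* i ℕ.+ j → j < ℓ → ⌊ e /2⌋ ≡ i
    x-block : ∀ {e x i j} → e < L → x < m → j < W → m ℕ.* e ℕ.+ x ≡ W ℕ.* i ℕ.+ j → ℓ ≤ j → ⌈ e /2⌉ ≡ suc i

-- A period of W = 2m + e₀ positions holds one y and the following x, so blocks of length m fall
-- behind by e₀ in each period. Odd blocks stay inside one period, even blocks inside the x-part of
-- one period and the y-part of the next. The latter needs m ≤ ℓ and also ℓ ≤ k·e₀, which holds
-- because A is a natural number.
module BlockLayout (k′ e₀ A ℓ : ℕ) (m≤ℓ : k′ ℕ.* e₀ ≤ ℓ) (A+ℓ≡ : A ℕ.+ ℓ ≡ suc k′ ℕ.* e₀) where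

  m W L : ℕ
  m = k′ ℕ.* e₀
  W = ℓ ℕ.+ (A ℕ.+ m)
  L = suc (k′ ℕ.+ k′)

  W≡ : W ≡ L ℕ.* e₀
  W≡ = trans (solve 3 (λ l a m → l :+ (a :+ m) := (a :+ l) :+ m) refl ℓ A m)
    (trans (cong (ℕ._+ m) A+ℓ≡) (solve 2 (λ k e → (con 1 :+ k) :* e :+ k :* e := (con 1 :+ (k :+ k)) :* e) refl k′ e₀))
    where open +-*-Solver

  Lm≡k′W : L ℕ.* m ≡ k′ ℕ.* W
  Lm≡k′W = trans (solve 2 (λ k e → (con 1 :+ (k :+ k)) :* (k :* e) := k :* ((con 1 :+ (k :+ k)) :* e)) refl k′ e₀)
    (cong (k′ ℕ.*_) (sym W≡))
    where open +-*-Solver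

  ℓ≤ : ℓ ≤ suc k′ ℕ.* e₀
  ℓ≤ = subst (ℓ ≤_) A+ℓ≡ (ℕₚ.m≤n+m ℓ A)

  ℓ≤W : ℓ ≤ W
  ℓ≤W = ℕₚ.m≤m+n ℓ _

  open ℕₚ.≤-Reasoning

  -- The block of edge 2b+2 starts no earlier than the x-part of period b; the slack after bounding
  -- `ℓ` is `o * e₀`, where `o` counts the periods still to come.
  even-lower : ∀ b → suc b ≤ k′ → b ℕ.* W ℕ.+ ℓ ≤ (suc b ℕ.+ suc b) ℕ.* m
  even-lower b b<k′ with ℕₚ.m≤n⇒∃[o]m+o≡n b<k′
  ... | o , refl = begin
    b ℕ.* W ℕ.+ ℓ                                     ≤⟨ ℕₚ.+-mono-≤ (ℕₚ.≤-reflexive (cong (b ℕ.*_) W≡)) ℓ≤ ⟩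
    b ℕ.* (L ℕ.* e₀) ℕ.+ suc k′ ℕ.* e₀                ≤⟨ ℕₚ.m≤m+n _ (o ℕ.* e₀) ⟩
    b ℕ.* (L ℕ.* e₀) ℕ.+ suc k′ ℕ.* e₀ ℕ.+ o ℕ.* e₀   ≡⟨ solve 3 (λ b o e → let k = con 1 :+ b :+ o in
          b :* ((con 1 :+ (k :+ k)) :* e) :+ (con 1 :+ k) :* e :+ o :* e := ((con 1 :+ b) :+ (con 1 :+ b)) :* (k :* e)) refl b o e₀ ⟩
    (suc b ℕ.+ suc b) ℕ.* m                           ∎
    where open +-*-Solver

  even-upper : ∀ b → suc (b ℕ.+ b) ℕ.* m ≤ b ℕ.* W ℕ.+ ℓ
  even-upper b = begin
    suc (b ℕ.+ b) ℕ.* m                   ≤⟨ ℕₚ.m≤m+n _ (b ℕ.* e₀) ⟩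
    suc (b ℕ.+ b) ℕ.* m ℕ.+ b ℕ.* e₀      ≡⟨ solve 3 (λ b k e → (con 1 :+ (b :+ b)) :* (k :* e) :+ b :* e
                                               := b :* ((con 1 :+ (k :+ k)) :* e) :+ k :* e) refl b k′ e₀ ⟩
    b ℕ.* (L ℕ.* e₀) ℕ.+ m                ≤⟨ ℕₚ.+-mono-≤ (ℕₚ.≤-reflexive (cong (b ℕ.*_) (sym W≡))) m≤ℓ ⟩
    b ℕ.* W ℕ.+ ℓ                         ∎
    where open +-*-Solver

  -- The accumulated drift b·e₀ is at most one block, since m = k′·e₀.
  odd-lower : ∀ b → b ≤ k′ → b ℕ.* W ≤ suc (b ℕ.+ b) ℕ.* m
  odd-lower b b≤k′ with ℕₚ.m≤n⇒∃[o]m+o≡n b≤k′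
  ... | o , refl = begin
    b ℕ.* W                               ≡⟨ cong (b ℕ.*_) W≡ ⟩
    b ℕ.* (L ℕ.* e₀)                      ≤⟨ ℕₚ.m≤m+n _ (o ℕ.* e₀) ⟩
    b ℕ.* (L ℕ.* e₀) ℕ.+ o ℕ.* e₀         ≡⟨ solve 3 (λ b o e → let k = b :+ o in
          b :* ((con 1 :+ (k :+ k)) :* e) :+ o :* e := (con 1 :+ (b :+ b)) :* (k :* e)) refl b o e₀ ⟩
    suc (b ℕ.+ b) ℕ.* m                   ∎
    where open +-*-Solver

  odd-upper : ∀ b → (suc b ℕ.+ suc b) ℕ.* m ≤ suc b ℕ.* W
  odd-upper b = begin
    (suc b ℕ.+ suc b) ℕ.* m               ≤⟨ ℕₚ.m≤m+n _ (suc b ℕ.* e₀) ⟩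
    (suc b ℕ.+ suc b) ℕ.* m ℕ.+ suc b ℕ.* e₀ ≡⟨ solve 3 (λ b k e → (con 1 :+ b :+ (con 1 :+ b)) :* (k :* e) :+ (con 1 :+ b) :* e
                                               := (con 1 :+ b) :* ((con 1 :+ (k :+ k)) :* e)) refl b k′ e₀ ⟩
    suc b ℕ.* (L ℕ.* e₀)                  ≡⟨ cong (suc b ℕ.*_) (sym W≡) ⟩
    suc b ℕ.* W                           ∎
    where open +-*-Solver

  module _ {e x i j : ℕ} (e<L : e < L) (x<m : x < m) (j<W : j < W) (s≡ : m ℕ.* e ℕ.+ x ≡ W ℕ.* i ℕ.+ j) where

    private
      s : ℕ
      s = W ℕ.* i ℕ.+ j
      em≤s : e ℕ.* m ≤ s
      em≤s = subst₂ _≤_ (ℕₚ.*-comm m e) s≡ (ℕₚ.m≤m+n _ x)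
      s<em+m : s < suc e ℕ.* m
      s<em+m = subst₂ _<_ s≡ (trans (cong (ℕ._+ m) (ℕₚ.*-comm m e)) (ℕₚ.+-comm _ m)) (ℕₚ.+-monoʳ-< (m ℕ.* e) x<m)
      iW≤s : i ℕ.* W ≤ s
      iW≤s = subst (_≤ s) (ℕₚ.*-comm W i) (ℕₚ.m≤m+n _ j)
      s<iW+W : s < suc i ℕ.* W
      s<iW+W = subst (s <_) (trans (cong (ℕ._+ W) (ℕₚ.*-comm W i)) (ℕₚ.+-comm _ W)) (ℕₚ.+-monoʳ-< (W ℕ.* i) j<W)
      cancelW : ∀ {b c} → b ℕ.* W < suc c ℕ.* W → b ≤ c
      cancelW {b} {c} lt = ℕₚ.≤-pred (ℕₚ.*-cancelʳ-< W b (suc c) lt)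
      e≤2k′ : e ≤ k′ ℕ.+ k′
      e≤2k′ = ℕₚ.≤-pred e<L
      b = ⌊ e /2⌋
      ⌊e/2⌋≤k′ : b ≤ k′
      ⌊e/2⌋≤k′ = subst (b ≤_) (sym (ℕₚ.n≡⌊n+n/2⌋ k′)) (ℕₚ.⌊n/2⌋-mono e≤2k′)
      odd≡ : ⌈ e /2⌉ ≡ suc b → e ≡ suc (b ℕ.+ b)
      odd≡ eq = trans (sym (ℕₚ.⌊n/2⌋+⌈n/2⌉≡n e)) (trans (cong (b ℕ.+_) eq) (ℕₚ.+-suc b b))
      even≡ : ⌈ e /2⌉ ≡ b → e ≡ b ℕ.+ b
      even≡ eq = trans (sym (ℕₚ.⌊n/2⌋+⌈n/2⌉≡n e)) (cong (b ℕ.+_) eq)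
      odd-i : ⌈ e /2⌉ ≡ suc b → b ≡ i
      odd-i eq = ℕₚ.≤-antisym
        (cancelW (ℕₚ.≤-<-trans (ℕₚ.≤-trans (odd-lower b ⌊e/2⌋≤k′) (subst (λ e → e ℕ.* m ≤ s) (odd≡ eq) em≤s)) s<iW+W))
        (cancelW (ℕₚ.≤-<-trans iW≤s (ℕₚ.<-≤-trans s<em+m
          (subst (λ e → suc e ℕ.* m ≤ suc b ℕ.* W) (sym (odd≡ eq))
            (subst (λ t → suc t ℕ.* m ≤ suc b ℕ.* W) (ℕₚ.+-suc b b) (odd-upper b))))))
      even-s< : ⌈ e /2⌉ ≡ b → s < b ℕ.* W ℕ.+ ℓ
      even-s< eq = ℕₚ.<-≤-trans s<em+m (subst (λ e → suc e ℕ.* m ≤ b ℕ.* W ℕ.+ ℓ) (sym (even≡ eq)) (even-upper b))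
      even-s≥ : ∀ b′ → b ≡ suc b′ → ⌈ e /2⌉ ≡ b → b′ ℕ.* W ℕ.+ ℓ ≤ s
      even-s≥ b′ b≡ eq = ℕₚ.≤-trans (even-lower b′ (subst (_≤ k′) b≡ ⌊e/2⌋≤k′))
        (subst (λ t → (t ℕ.+ t) ℕ.* m ≤ s) b≡ (subst (λ e → e ℕ.* m ≤ s) (even≡ eq) em≤s))

    y-block : j < ℓ → ⌊ e /2⌋ ≡ i
    y-block j<ℓ with ⌈n/2⌉-cases e
    ... | inj₂ odd  = odd-i odd
    ... | inj₁ even = ℕₚ.≤-antisym (b≤i b refl)
      (cancelW (ℕₚ.≤-<-trans iW≤s (ℕₚ.<-≤-trans (even-s< even)
        (subst (_≤ suc b ℕ.* W) (ℕₚ.+-comm ℓ (b ℕ.* W)) (ℕₚ.+-monoˡ-≤ (b ℕ.* W) ℓ≤W)))))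
      where
      b≤i : ∀ c → b ≡ c → c ≤ i
      b≤i zero    _  = z≤n
      b≤i (suc b′) eq = ℕₚ.*-cancelʳ-< W b′ i (ℕₚ.+-cancelʳ-< ℓ _ _ (ℕₚ.≤-<-trans (even-s≥ b′ eq even)
        (subst (λ t → s < t ℕ.+ ℓ) (ℕₚ.*-comm W i) (ℕₚ.+-monoʳ-< (W ℕ.* i) j<ℓ))))

    x-block : ℓ ≤ j → ⌈ e /2⌉ ≡ suc i
    x-block ℓ≤j with ⌈n/2⌉-cases e
    ... | inj₂ odd  = trans odd (cong suc (odd-i odd))
    ... | inj₁ even = trans even (ℕₚ.≤-antisym (b≤ b refl)
      (ℕₚ.*-cancelʳ-< W i b (ℕₚ.+-cancelʳ-< ℓ _ _ (ℕₚ.≤-<-trans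
        (subst (λ t → t ℕ.+ ℓ ≤ s) (ℕₚ.*-comm W i) (ℕₚ.+-monoʳ-≤ (W ℕ.* i) ℓ≤j)) (even-s< even)))))
      where
      b≤ : ∀ c → b ≡ c → c ≤ suc i
      b≤ zero     _  = z≤n
      b≤ (suc b′) eq = s≤s (cancelW (ℕₚ.≤-<-trans (ℕₚ.≤-trans (ℕₚ.m≤m+n _ ℓ) (even-s≥ b′ eq even)) s<iW+W))

  layout : Layout
  layout = record { k′ = k′ ; A = A ; m = m ; ℓ = ℓ ; L = L ; L≡ = refl ; Lm≡k′W = Lm≡k′W
                  ; y-block = y-block ; x-block = x-block }

-- The system of equations of a path

-- F = ⋃_c (emb [q] + offset c), and π rounds an element of F to [q].
record Rounding {P : ℕ} (𝔽 : FiniteField P) (q C : ℕ) : Set where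
  open FiniteField 𝔽
  field
    emb           : Fin q → Fin P
    emb-injective : Injective _≡_ _≡_ emb
    π             : Fin P → Fin q
    offset        : Fin C → Fin P
    split         : ∀ w → ∃ λ c → w ≡ emb (π w) + offset c

module Paths {P : ℕ} {𝔽 : FiniteField P} {q C : ℕ} (R : Rounding 𝔽 q C) (Λ : Layout) (J : ℕ) where

  open Rounding R public
  open Layout Λ public
  open Singular 𝔽 (A ℕ.+ ℓ) m L J public
  open System

  x̂ : Fin (q ^ a) → Fin a → F
  x̂ X j = emb (finToFun X j)

  ŷ : Fin (q ^ ℓ) → Fin ℓ → F
  ŷ Y j = emb (finToFun Y j)

  Q : Fin (q ^ a) → Fin (q ^ ℓ) → Fin (A ℕ.+ ℓ) → F
  Q X Y i = [ (λ j → x̂ X (j ↑ˡ m)) , ŷ Y ]′ (splitAt A i)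

  gval : (Fin m → Poly (A ℕ.+ ℓ) Δ) → Fin m → Fin (q ^ a) → Fin (q ^ ℓ) → F
  gval g x X Y = ⟦ g x ⟧ (ι ∘ Q X Y) 0

  Edge : (Fin m → Poly (A ℕ.+ ℓ) Δ) → Fin (q ^ a) → Fin (q ^ ℓ) → Set
  Edge g X Y = ∀ x → π (gval g x X Y) ≡ finToFun X (A ↑ʳ x)

  edge? : ∀ g X Y → Dec (Edge g X Y)
  edge? g X Y = all? λ x → π (gval g x X Y) ≟ finToFun X (A ↑ʳ x)

  edge≤ : ∀ (e : Fin L) → toℕ e ≤ k′ ℕ.+ k′
  edge≤ e = ℕₚ.≤-pred (subst (toℕ e <_) L≡ (Finₚ.toℕ<n e))

  -- The edge e of the path x₀ y₁ x₁ y₂ … joins the x-vertex number ⌈e/2⌉ to the y-vertex number ⌊e/2⌋ (counted from 0).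
  xi yi : Fin L → Fin (suc k′)
  xi e = fromℕ< {⌈ toℕ e /2⌉} (s≤s (subst (⌈ toℕ e /2⌉ ≤_) (sym (ℕₚ.n≡⌈n+n/2⌉ k′)) (ℕₚ.⌈n/2⌉-mono (edge≤ e))))
  yi e = fromℕ< {⌊ toℕ e /2⌋} (s≤s (subst (⌊ toℕ e /2⌋ ≤_) (sym (ℕₚ.n≡⌊n+n/2⌋ k′)) (ℕₚ.⌊n/2⌋-mono (edge≤ e))))

  posX : Fin k′ → Fin a → Fin n
  posX i j = cast (sym Lm≡k′W) (combine i (ℓ ↑ʳ j))

  posY : Fin k′ → Fin ℓ → Fin n
  posY i j = cast (sym Lm≡k′W) (combine i (j ↑ˡ a))

  xterm : Fin (q ^ a) → Fin (suc k′) → Fin a → Term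
  xterm u zero    j = inj₂ (x̂ u j)
  xterm u (suc i) j = inj₁ (posX i j)

  yterm : Fin (q ^ ℓ) → Fin (suc k′) → Fin ℓ → Term
  yterm v i j with k′ ℕ.≟ toℕ i
  ... | yes _  = inj₂ (ŷ v j)
  ... | no k≢i = inj₁ (posY (lower₁ i k≢i) j)

  pathPoint : (Fin (suc k′) → Fin (q ^ a)) → (Fin (suc k′) → Fin (q ^ ℓ)) → Fin n → F
  pathPoint X Y s = let i , j = remQuot {k′} W (cast Lm≡k′W s) in [ ŷ (Y (inject₁ i)) , x̂ (X (suc i)) ]′ (splitAt ℓ j)

  private
    pathPoint-pos : ∀ X Y i j → pathPoint X Y (cast (sym Lm≡k′W) (combine i j)) ≡
                    [ ŷ (Y (inject₁ i)) , x̂ (X (suc i)) ]′ (splitAt ℓ j)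
    pathPoint-pos X Y i j = trans
      (cong (λ t → let i , j = remQuot {k′} W t in [ ŷ (Y (inject₁ i)) , x̂ (X (suc i)) ]′ (splitAt ℓ j))
        (Finₚ.cast-involutive Lm≡k′W (sym Lm≡k′W) (combine i j)))
      (cong (λ (i , j) → [ ŷ (Y (inject₁ i)) , x̂ (X (suc i)) ]′ (splitAt ℓ j)) (Finₚ.remQuot-combine {k′} i j))

  value-xterm : ∀ {u} X Y → X zero ≡ u → ∀ i j → value (xterm u i j) (pathPoint X Y) ≡ x̂ (X i) j
  value-xterm X Y refl zero    j = refl
  value-xterm X Y X0   (suc i) j = trans (pathPoint-pos X Y i (ℓ ↑ʳ j)) (cong [ _ , _ ]′ (Finₚ.splitAt-↑ʳ ℓ a j))

  value-yterm : ∀ {v} X Y → Y (fromℕ k′) ≡ v → ∀ i j → value (yterm v i j) (pathPoint X Y) ≡ ŷ (Y i) j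
  value-yterm X Y refl i j with k′ ℕ.≟ toℕ i
  ... | yes k≡i = cong (λ i → ŷ (Y i) j) (Finₚ.toℕ-injective (trans (Finₚ.toℕ-fromℕ k′) k≡i))
  ... | no k≢i  = trans (pathPoint-pos X Y (lower₁ i k≢i) (j ↑ˡ a)) (trans (cong [ _ , _ ]′ (Finₚ.splitAt-↑ˡ ℓ j a))
                    (cong (λ i → ŷ (Y i) j) (Finₚ.inject₁-lower₁ i k≢i)))

  yterm-inject₁ : ∀ v i j → yterm v (inject₁ i) j ≡ inj₁ (posY i j)
  yterm-inject₁ v i j with k′ ℕ.≟ toℕ (inject₁ i)
  ... | yes k≡i = contradiction (trans k≡i (Finₚ.toℕ-inject₁ i)) (ℕₚ.>⇒≢ (Finₚ.toℕ<n i))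
  ... | no k≢i  = cong (λ i → inj₁ (posY i j)) (Finₚ.lower₁-inject₁′ i k≢i)

  σₚ : Fin (q ^ a) → Fin (q ^ ℓ) → Fin L → Fin (A ℕ.+ ℓ) → Term
  σₚ u v e i = [ (λ j → xterm u (xi e) (j ↑ˡ m)) , yterm v (yi e) ]′ (splitAt A i)

  ρₚ : Fin (q ^ a) → Fin L → Fin m → Term
  ρₚ u e x = xterm u (xi e) (A ↑ʳ x)

  private
    -- The layout puts the position at one of the two ends of the edge. A coordinate of y or one of
    -- the first `A` coordinates of x is an argument of g; one of the last `m` coordinates of x is a
    -- right-hand side.
    coveredₚ : ∀ u v e x → (∃ λ y → σₚ u v e y ≡ inj₁ (combine e x)) ⊎ (∃ λ y → ρₚ u e y ≡ inj₁ (combine e x))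
    coveredₚ u v e x with remQuot {k′} W (cast Lm≡k′W (combine e x)) in eq
    ... | i , jj = go (splitAt ℓ jj) refl
      where
      jj-pos : cast (sym Lm≡k′W) (combine i jj) ≡ combine e x
      jj-pos = trans (cong (λ (i , j) → cast (sym Lm≡k′W) (combine {k′} {W} i j)) (sym eq))
        (trans (cong (cast (sym Lm≡k′W)) (Finₚ.combine-remQuot {k′} W (cast Lm≡k′W (combine e x))))
               (Finₚ.cast-involutive (sym Lm≡k′W) Lm≡k′W (combine e x)))
      s≡ : m ℕ.* toℕ e ℕ.+ toℕ x ≡ W ℕ.* toℕ i ℕ.+ toℕ jj
      s≡ = trans (sym (Finₚ.toℕ-combine e x)) (trans (cong toℕ (sym jj-pos))
        (trans (Finₚ.toℕ-cast (sym Lm≡k′W) (combine i jj)) (Finₚ.toℕ-combine i jj)))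
      go : ∀ t → splitAt ℓ jj ≡ t → (∃ λ y → σₚ u v e y ≡ inj₁ (combine e x)) ⊎ (∃ λ y → ρₚ u e y ≡ inj₁ (combine e x))
      go (inj₁ j) sp = inj₁ (A ↑ʳ j , trans (cong [ _ , _ ]′ (Finₚ.splitAt-↑ʳ A ℓ j))
        (trans (cong (λ i → yterm v i j) yi≡) (trans (yterm-inject₁ v i j)
          (cong inj₁ (trans (cong (λ j → cast (sym Lm≡k′W) (combine i j)) (Finₚ.splitAt⁻¹-↑ˡ sp)) jj-pos)))))
        where
        j<ℓ : toℕ jj < ℓ
        j<ℓ = subst (_< ℓ) (trans (sym (Finₚ.toℕ-↑ˡ j a)) (cong toℕ (Finₚ.splitAt⁻¹-↑ˡ sp))) (Finₚ.toℕ<n j)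
        yi≡ : yi e ≡ inject₁ i
        yi≡ = Finₚ.toℕ-injective (trans (Finₚ.toℕ-fromℕ< _)
          (trans (y-block (Finₚ.toℕ<n e) (Finₚ.toℕ<n x) (Finₚ.toℕ<n jj) s≡ j<ℓ) (sym (Finₚ.toℕ-inject₁ i))))
      go (inj₂ j) sp = x-part (splitAt A j) refl
        where
        ℓ≤j : ℓ ≤ toℕ jj
        ℓ≤j = subst (ℓ ≤_) (trans (sym (Finₚ.toℕ-↑ʳ ℓ j)) (cong toℕ (Finₚ.splitAt⁻¹-↑ʳ sp))) (ℕₚ.m≤m+n ℓ (toℕ j))
        xi≡ : xi e ≡ suc i
        xi≡ = Finₚ.toℕ-injective (trans (Finₚ.toℕ-fromℕ< _)
          (x-block (Finₚ.toℕ<n e) (Finₚ.toℕ<n x) (Finₚ.toℕ<n jj) s≡ ℓ≤j))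
        xterm≡ : xterm u (xi e) j ≡ inj₁ (combine e x)
        xterm≡ = trans (cong (λ i → xterm u i j) xi≡)
          (cong inj₁ (trans (cong (λ j → cast (sym Lm≡k′W) (combine i j)) (Finₚ.splitAt⁻¹-↑ʳ sp)) jj-pos))
        x-part : ∀ t → splitAt A j ≡ t → (∃ λ y → σₚ u v e y ≡ inj₁ (combine e x)) ⊎ (∃ λ y → ρₚ u e y ≡ inj₁ (combine e x))
        x-part (inj₁ y) sp′ = inj₁ (y ↑ˡ ℓ , trans (cong [ _ , _ ]′ (Finₚ.splitAt-↑ˡ A y ℓ))
          (trans (cong (xterm u (xi e)) (Finₚ.splitAt⁻¹-↑ˡ sp′)) xterm≡))
        x-part (inj₂ y) sp′ = inj₂ (y , trans (cong (xterm u (xi e)) (Finₚ.splitAt⁻¹-↑ʳ sp′)) xterm≡)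

  pathSystem : Fin (q ^ a) → Fin (q ^ ℓ) → Fin (C ^ n) → System
  pathSystem u v o = record
    { σ = σₚ u v ; ρ = ρₚ u ; off = λ e x → offset (finToFun o (combine e x)) ; covered = coveredₚ u v }

  ⟦⟧-0 : ∀ {n d} (p : Poly n d) {Z Z′ : Fin n → Series} → (∀ y → Z y 0 ≡ Z′ y 0) → ⟦ p ⟧ Z 0 ≡ ⟦ p ⟧ Z′ 0
  ⟦⟧-0 (con c)    eq = refl
  ⟦⟧-0 (base c)   eq = refl
  ⟦⟧-0 (p +x* p′) eq = cong₂ _+_ (⟦⟧-0 p (eq ∘ suc)) (cong₂ _*_ (eq zero) (⟦⟧-0 p′ eq))

  -1*x : ∀ x → - 1# * x ≡ - x
  -1*x x = trans (sym (-‿distribˡ-* 1# x)) (cong -_ (*-identityˡ x))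

  module Equations (g : Fin m → Poly (A ℕ.+ ℓ) Δ) (s : System) where

    termT : Term → Tree n
    termT (inj₁ v) = var v
    termT (inj₂ c) = con c

    deg-termT : ∀ t → deg (termT t) ≤ 1
    deg-termT (inj₁ v) = s≤s z≤n
    deg-termT (inj₂ c) = z≤n

    equation : Fin L → Fin m → Tree n
    equation e x = substT (g x) (termT ∘ σ s e) ⊕ (con (- 1#) ⊗ termT (ρ s e x) ⊕ con (- off s e x))

    equations : Fin n → Tree n
    equations i = let e , x = remQuot {L} m i in equation e x

    deg-equations : ∀ i → deg (equations i) ≤ Δ
    deg-equations i = let e , x = remQuot {L} m i in
      ℕₚ.⊔-lub (deg-substT (g x) (termT ∘ σ s e) (deg-termT ∘ σ s e))
               (ℕₚ.⊔-lub (ℕₚ.≤-trans (deg-termT (ρ s e x)) (s≤s z≤n)) z≤n)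

    equation-0 : ∀ z e x → ⟦ g x ⟧ (ι ∘ point s z e) 0 ≡ value (ρ s e x) z + off s e x → eval (equation e x) (ι ∘ z) 0 ≡ 0#
    equation-0 z e x eq = trans (cong₂ _+_
      (trans (eval-substT (g x) (termT ∘ σ s e) (ι ∘ z) 0) (trans (⟦⟧-0 (g x) (λ y → term-0 (σ s e y))) eq))
      (cong (_+ - off s e x) (trans (cong (- 1# *_) (term-0 (ρ s e x))) (-1*x _))))
      (trans (trans (+-assoc _ _ _) (cong (value (ρ s e x) z +_) (trans (sym (+-assoc _ _ _))
        (trans (cong (_+ - off s e x) (+-comm _ _)) (trans (+-assoc _ _ _) (trans (cong (- value (ρ s e x) z +_) (-‿inverseʳ _)) (+-identityʳ _)))))))
        (-‿inverseʳ _))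
      where
      term-0 : ∀ t → eval (termT t) (ι ∘ z) 0 ≡ value t z
      term-0 (inj₁ v) = refl
      term-0 (inj₂ c) = refl

    equation-1 : ∀ z δ e x → D (equation e x) z δ ≡ 0# → ⟦ g x ⟧ (arc s z δ e) 1 ≡ tangent (ρ s e x) δ
    equation-1 z δ e x eq = x-y≡0⇒x≡y (trans (sym (cong₂ _+_
      (trans (eval-substT (g x) (termT ∘ σ s e) (dual z δ) 1) (⟦⟧-cong (g x) term-arc 1))
      (trans (+-identityʳ _) (trans (ι-⊛ (- 1#) (eval (termT (ρ s e x)) (dual z δ)) 1)
        (trans (-1*x _) (cong -_ (term-1 (ρ s e x)))))))) eq)
      where
      term-1 : ∀ t → eval (termT t) (dual z δ) 1 ≡ tangent t δ
      term-1 (inj₁ v) = refl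
      term-1 (inj₂ c) = refl
      term-arc : ∀ y k → eval (termT (σ s e y)) (dual z δ) k ≡ arc s z δ e y k
      term-arc y zero with σ s e y
      ... | inj₁ v = refl
      ... | inj₂ c = refl
      term-arc y (suc zero)    = term-1 (σ s e y)
      term-arc y (suc (suc k)) with σ s e y
      ... | inj₁ v = refl
      ... | inj₂ c = refl

-- Families of edge-disjoint paths with common ends

threshold : ℕ → ℕ → ℕ → ℕ
threshold n d J = suc ((n ℕ.* d ℕ.+ 2) ^ n) ℕ.+ J

-- Paths are coloured by their rounding errors (`C ^ n` choices) and by being nonsingular or having
-- a given tangent support and normalised coordinate (`suc (2 ^ n * n)` choices). A class of
-- `threshold` paths exceeds the Bézout bound and has at least `J` members. Nothing depends on q.
familyBound : ℕ → ℕ → ℕ → ℕ → ℕ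
familyBound C n d J = suc (C ^ n ℕ.* suc (2 ^ n ℕ.* n) ℕ.* threshold n d J)

module PathFamilies {P : ℕ} {𝔽 : FiniteField P} {q C : ℕ} (R : Rounding 𝔽 q C) (Λ : Layout) (J : ℕ) where

  open Paths R Λ J public
  open System

  -- Disjointness is stated for edges: g is evaluated at edges, and it is their arguments that must
  -- be distinct for interpolation.
  record PathFamily (g : Fin m → Poly (A ℕ.+ ℓ) Δ) (s : ℕ) : Set where
    field
      u        : Fin (q ^ a)
      v        : Fin (q ^ ℓ)
      X        : Fin s → Fin (suc k′) → Fin (q ^ a)
      Y        : Fin s → Fin (suc k′) → Fin (q ^ ℓ)
      starts   : ∀ p → X p zero ≡ u
      ends     : ∀ p → Y p (fromℕ k′) ≡ v
      edge     : ∀ p e → Edge g (X p (xi e)) (Y p (yi e))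
      disjoint : ∀ {p p′ e e′} → X p (xi e) ≡ X p′ (xi e′) → Y p (yi e) ≡ Y p′ (yi e′) → p ≡ p′ × e ≡ e′

  -- The number of events in the union bound: the two ends, the rounding errors, the support and the
  -- normalised coordinate. Only the ends contribute factors that grow with q.
  K : ℕ
  K = q ^ a ℕ.* (q ^ ℓ ℕ.* (C ^ n ℕ.* (2 ^ n ℕ.* n)))

  isOne : Fin 2 → Bool
  isOne zero    = false
  isOne (suc _) = true

  sysK : Fin K → System
  sysK χ = let u , χ₁ = remQuot {q ^ a} _ χ ; v , χ₂ = remQuot {q ^ ℓ} _ χ₁ ; o , _ = remQuot {C ^ n} (2 ^ n ℕ.* n) χ₂ in
    pathSystem u v o

  supportK : Fin K → Fin n → Bool
  supportK χ i = let _ , χ₁ = remQuot {q ^ a} _ χ ; _ , χ₂ = remQuot {q ^ ℓ} _ χ₁ ; _ , χ₃ = remQuot {C ^ n} (2 ^ n ℕ.* n) χ₂ in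
    isOne (finToFun (proj₁ (remQuot {2 ^ n} n χ₃)) i)

  unitK : Fin K → Fin n
  unitK χ = let _ , χ₁ = remQuot {q ^ a} _ χ ; _ , χ₂ = remQuot {q ^ ℓ} _ χ₁ ; _ , χ₃ = remQuot {C ^ n} (2 ^ n ℕ.* n) χ₂ in
    proj₂ (remQuot {2 ^ n} n χ₃)

  BadPolys : (Fin m → Poly (A ℕ.+ ℓ) Δ) → Set
  BadPolys = Bad sysK supportK unitK

  pack : (Fin J → Fin n → F) → Fin (P ^ (J ℕ.* n))
  pack z = funToFin λ i → let j , v = remQuot {J} n i in z j v

  row-pack : ∀ z j v → row (pack z) j v ≡ z j v
  row-pack z j v = trans (Finₚ.finToFun-funToFin (λ i → let j , v = remQuot {J} n i in z j v) (combine j v))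
    (cong (λ (j , v) → z j v) (Finₚ.remQuot-combine {J} j v))

  singularFamily⇒bad : ∀ {g} u v o S τ zc dc →
    SingularFamily (pathSystem u v o) (λ i → isOne (finToFun S i)) τ g zc dc → BadPolys g
  singularFamily⇒bad {g} u v o S τ zc dc B = χ , zc , dc , subst Family (sym decoded) B
    where
    Family : System × Fin (2 ^ n) × Fin n → Set
    Family (s , S , τ) = SingularFamily s (λ i → isOne (finToFun S i)) τ g zc dc
    χ₃ = combine {2 ^ n} {n} S τ
    χ₂ = combine {C ^ n} {2 ^ n ℕ.* n} o χ₃
    χ₁ = combine {q ^ ℓ} v χ₂
    χ : Fin K
    χ = combine u χ₁
    decoded : (sysK χ ,
               (let _ , χ₁ = remQuot {q ^ a} _ χ ; _ , χ₂ = remQuot {q ^ ℓ} _ χ₁ ; _ , χ₃ = remQuot {C ^ n} (2 ^ n ℕ.* n) χ₂ in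
                 proj₁ (remQuot {2 ^ n} n χ₃)) , unitK χ) ≡ (pathSystem u v o , S , τ)
    decoded = trans
      (cong (λ (u , χ₁) → let v , χ₂ = remQuot {q ^ ℓ} _ χ₁ ; o , χ₃ = remQuot {C ^ n} (2 ^ n ℕ.* n) χ₂ ; S , τ = remQuot {2 ^ n} n χ₃ in
              (pathSystem u v o , S , τ)) (Finₚ.remQuot-combine {q ^ a} u χ₁))
      (trans
      (cong (λ (v , χ₂) → let o , χ₃ = remQuot {C ^ n} (2 ^ n ℕ.* n) χ₂ ; S , τ = remQuot {2 ^ n} n χ₃ in
              (pathSystem u v o , S , τ)) (Finₚ.remQuot-combine {q ^ ℓ} v χ₂))
      (trans
      (cong (λ (o , χ₃) → let S , τ = remQuot {2 ^ n} n χ₃ in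
              (pathSystem u v o , S , τ)) (Finₚ.remQuot-combine {C ^ n} o χ₃))
      (cong (λ (S , τ) → (pathSystem u v o , S , τ)) (Finₚ.remQuot-combine {2 ^ n} {n} S τ))))

  module _ (g : Fin m → Poly (A ℕ.+ ℓ) Δ) {s : ℕ} (fam : PathFamily g s) where

    open PathFamily fam

    z : Fin s → Fin n → F
    z p = pathPoint (X p) (Y p)

    point≡Q : ∀ o p e y → point (pathSystem u v o) (z p) e y ≡ Q (X p (xi e)) (Y p (yi e)) y
    point≡Q o p e y with splitAt A y
    ... | inj₁ j = value-xterm (X p) (Y p) (starts p) (xi e) (j ↑ˡ m)
    ... | inj₂ j = value-yterm (X p) (Y p) (ends p) (yi e) j

    -- The argument of g omits the last `m` coordinates of x, but on an edge these are the rounded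
    -- values of g and hence determined by it.
    Q-separates : ∀ {p p′ e e′} → Q (X p (xi e)) (Y p (yi e)) ≗ Q (X p′ (xi e′)) (Y p′ (yi e′)) → p ≡ p′ × e ≡ e′
    Q-separates {p} {p′} {e} {e′} Q≗ = disjoint (finToFun-injective {a} X≗) (finToFun-injective {ℓ} Y≗)
      where
      Y≗ : ∀ j → finToFun (Y p (yi e)) j ≡ finToFun (Y p′ (yi e′)) j
      Y≗ j = emb-injective (subst₂ _≡_ (cong [ _ , _ ]′ (Finₚ.splitAt-↑ʳ A ℓ j)) (cong [ _ , _ ]′ (Finₚ.splitAt-↑ʳ A ℓ j)) (Q≗ (A ↑ʳ j)))
      X≗ : ∀ j → finToFun (X p (xi e)) j ≡ finToFun (X p′ (xi e′)) j
      X≗ j with splitAt A j in sp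
      ... | inj₁ i = subst (λ j → finToFun (X p (xi e)) j ≡ finToFun (X p′ (xi e′)) j) (Finₚ.splitAt⁻¹-↑ˡ sp)
        (emb-injective (subst₂ _≡_ (cong [ _ , _ ]′ (Finₚ.splitAt-↑ˡ A i ℓ)) (cong [ _ , _ ]′ (Finₚ.splitAt-↑ˡ A i ℓ)) (Q≗ (i ↑ˡ ℓ))))
      ... | inj₂ x = subst (λ j → finToFun (X p (xi e)) j ≡ finToFun (X p′ (xi e′)) j) (Finₚ.splitAt⁻¹-↑ʳ sp)
        (trans (sym (edge p e x)) (trans (cong π (⟦⟧-0 (g x) Q≗)) (edge p′ e′ x)))

    OnZero : Fin (C ^ n) → Fin s → Set
    OnZero o p = ∀ e x → gval g x (X p (xi e)) (Y p (yi e)) ≡ value (ρₚ u e x) (z p) + offset (finToFun o (combine e x))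

    -- `split` writes each value of g as an embedded coordinate plus an offset, and the edge
    -- condition identifies that coordinate. Every path is thus an exact zero over the field of one
    -- of `C ^ n` systems.
    offsets : ∀ p → ∃ λ o → OnZero o p
    offsets p = funToFin o , λ e x → trans (proj₂ (split (w e x)))
      (cong₂ _+_ (trans (cong emb (edge p e x)) (sym (value-xterm (X p) (Y p) (starts p) (xi e) (A ↑ʳ x))))
        (cong offset (sym (trans (Finₚ.finToFun-funToFin o (combine e x))
          (cong (λ (e , x) → proj₁ (split (w e x))) (Finₚ.remQuot-combine {L} e x))))))
      where
      w : Fin L → Fin m → F
      w e x = gval g x (X p (xi e)) (Y p (yi e))
      o : Fin n → Fin C
      o i = let e , x = remQuot {L} m i in proj₁ (split (w e x))

    system : Fin (C ^ n) → Fin n → Tree n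
    system o = Equations.equations g (pathSystem u v o)

    record SingularAt (o : Fin (C ^ n)) (S : Fin (2 ^ n)) (τ : Fin n) (p : Fin s) : Set where
      field
        δ        : Fin n → F
        δ-kernel : ∀ i → D (system o i) (z p) δ ≡ 0#
        δ-outside : ∀ i → isOne (finToFun S i) ≡ false → δ i ≡ 0#
        δ-inside  : ∀ i → isOne (finToFun S i) ≡ true → δ i ≢ 0#
        δ-unit   : δ τ ≡ 1#

    Status : Fin (C ^ n) → Fin (suc (2 ^ n ℕ.* n)) → Fin s → Set
    Status o zero    p = NonSingular (system o) (z p)
    Status o (suc r) p = let S , τ = remQuot {2 ^ n} n r in SingularAt o S τ p

    Kernel : Fin (C ^ n) → Fin s → (Fin n → F) → Set
    Kernel o p δ = (∀ i → D (system o i) (z p) δ ≡ 0#) × ¬ (∀ i → δ i ≡ 0#)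

    -- The kernel is closed under scaling, so any nonzero coordinate `τ` can be made 1.
    normalise : ∀ o p δ → Kernel o p δ → ∃ λ S → ∃ λ τ → SingularAt o S τ p
    normalise o p δ (ker , δ≢0) with any? (λ i → ¬? (δ i ≟ 0#))
    ... | no none = contradiction (λ i → decidable-stable (δ i ≟ 0#) (λ ne → none (i , ne))) δ≢0
    ... | yes (τ , δτ≢0) = funToFin S , τ , record
      { δ         = δ′
      ; δ-kernel  = λ i → trans (D-scale (system o i) (z p) c δ) (trans (cong (c *_) (ker i)) (zeroʳ c))
      ; δ-outside = λ i eq → outside-S i (trans (cong isOne (sym (Finₚ.finToFun-funToFin S i))) eq)
      ; δ-inside  = λ i eq → inside-S i (trans (cong isOne (sym (Finₚ.finToFun-funToFin S i))) eq)
      ; δ-unit    = trans (*-comm _ _) (inverseʳ δτ≢0)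
      }
      where
      c = inv (δ τ)
      δ′ : Fin n → F
      δ′ i = c * δ i
      S : Fin n → Fin 2
      S i with δ′ i ≟ 0#
      ... | yes _ = zero
      ... | no _  = suc zero
      outside-S : ∀ i → isOne (S i) ≡ false → δ′ i ≡ 0#
      outside-S i eq with δ′ i ≟ 0#
      ... | yes δ≡0 = δ≡0
      inside-S : ∀ i → isOne (S i) ≡ true → δ′ i ≢ 0#
      inside-S i eq with δ′ i ≟ 0#
      ... | no δ≢0 = δ≢0

    status : ∀ o p → ∃ λ r → Status o r p
    status o p with any? (λ d → (all? λ i → D (system o i) (z p) (finToFun d) ≟ 0#) ×-dec ¬? (all? λ i → finToFun {P} {n} d i ≟ 0#))
    ... | yes (d , ker) = let S , τ , sing = normalise o p (finToFun d) ker in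
      suc (combine S τ) , subst (λ (S , τ) → SingularAt o S τ p) (sym (Finₚ.remQuot-combine {2 ^ n} {n} S τ)) sing
    ... | no none = zero , λ δ ker → decidable-stable (all? λ i → δ i ≟ 0#) (λ δ≢0 → none (funToFin δ ,
      (λ i → trans (D-cong (system o i) (λ _ → refl) (Finₚ.finToFun-funToFin δ)) (ker i)) ,
      (λ all0 → δ≢0 (λ i → trans (sym (Finₚ.finToFun-funToFin δ i)) (all0 i)))))

    z-separates : ∀ {p p′} → z p ≗ z p′ → p ≡ p′
    z-separates {p} {p′} z≗ = proj₁ (Q-separates {p} {p′} {e₀} {e₀} λ y →
      trans (sym (point≡Q o p e₀ y)) (trans (value-cong (σₚ u v e₀ y)) (point≡Q o p′ e₀ y)))
      where
      o = proj₁ (offsets p)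
      e₀ : Fin L
      e₀ = subst Fin (sym L≡) zero
      value-cong : ∀ t → value t (z p) ≡ value t (z p′)
      value-cong (inj₁ i) = z≗ i
      value-cong (inj₂ c) = refl

    few-nonsingular : ∀ o N (ω : Fin N → Fin s) → Injective _≡_ _≡_ ω → (∀ i → OnZero o (ω i)) →
      (∀ i → NonSingular (system o) (z (ω i))) → N ≤ (n ℕ.* Δ ℕ.+ 2) ^ n
    few-nonsingular o N ω ω-inj on ns = bezout (system o) (Equations.deg-equations g (pathSystem u v o)) (z ∘ ω)
      (λ i j i≢j z≗ → i≢j (ω-inj (z-separates z≗)))
      (λ i r → let e , x = remQuot {L} m r in Equations.equation-0 g (pathSystem u v o) (z (ω i)) e x
        (trans (⟦⟧-0 (g x) (point≡Q o (ω i) e)) (on i e x)))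
      ns

    many-singular⇒bad : ∀ o S τ (ω : Fin J → Fin s) → Injective _≡_ _≡_ ω → (∀ j → OnZero o (ω j)) →
      (∀ j → SingularAt o S τ (ω j)) → BadPolys g
    many-singular⇒bad o S τ ω ω-inj on sing = singularFamily⇒bad u v o S τ zc dc record
      { distinct = λ i j i≢j Q≗ → i≢j (index-≡ i j Q≗)
      ; on-zero  = λ j e x → trans (⟦⟧-0 (g x) (row-point j e)) (trans (on j e x)
          (cong (_+ offset (finToFun o (combine e x))) (sym (value-cong (row-pack zf j) (ρₚ u e x)))))
      ; kernel   = λ j e x → trans (⟦⟧-cong (g x) (λ y → arc-cong j e y) 1)
          (trans (Equations.equation-1 g sys (zf j) (δf j) e x (subst (λ (e , x) → D (Equations.equation g sys e x) (zf j) (δf j) ≡ 0#)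
                   (Finₚ.remQuot-combine {L} e x) (SingularAt.δ-kernel (sing j) (combine e x))))
                 (sym (tangent-cong (row-pack δf j) (ρₚ u e x))))
      ; outside  = λ j i eq → trans (row-pack δf j i) (SingularAt.δ-outside (sing j) i eq)
      ; inside   = λ j i eq r → SingularAt.δ-inside (sing j) i eq (trans (sym (row-pack δf j i)) r)
      ; unit     = λ j → trans (row-pack δf j τ) (SingularAt.δ-unit (sing j))
      }
      where
      sys : System
      sys = pathSystem u v o
      zf δf : Fin J → Fin n → F
      zf j = z (ω j)
      δf j = SingularAt.δ (sing j)
      zc dc : Fin (P ^ (J ℕ.* n))
      zc = pack zf
      dc = pack δf
      value-cong : ∀ {z z′} → z ≗ z′ → ∀ t → value t z ≡ value t z′
      value-cong eq (inj₁ i) = eq i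
      value-cong eq (inj₂ c) = refl
      tangent-cong : ∀ {z z′} → z ≗ z′ → ∀ t → tangent t z ≡ tangent t z′
      tangent-cong eq (inj₁ i) = eq i
      tangent-cong eq (inj₂ c) = refl
      row-point : ∀ j e y → point sys (row zc j) e y ≡ Q (X (ω j) (xi e)) (Y (ω j) (yi e)) y
      row-point j e y = trans (value-cong (row-pack zf j) (σₚ u v e y)) (point≡Q o (ω j) e y)
      arc-cong : ∀ j e y → arc sys (row zc j) (row dc j) e y ≗ arc sys (zf j) (δf j) e y
      arc-cong j e = dual-cong (λ y → value-cong (row-pack zf j) (σₚ u v e y)) (λ y → tangent-cong (row-pack δf j) (σₚ u v e y))
      index-≡ : ∀ i j → points sys zc i ≗ points sys zc j → i ≡ j
      index-≡ i j Q≗ = trans (sym (Finₚ.combine-remQuot {J} L i)) (trans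
        (cong₂ combine (ω-inj (proj₁ sep)) (proj₂ sep)) (Finₚ.combine-remQuot {J} L j))
        where
        sep = Q-separates λ y → trans (sym (row-point (proj₁ (remQuot {J} L i)) (proj₂ (remQuot {J} L i)) y))
          (trans (Q≗ y) (row-point (proj₁ (remQuot {J} L j)) (proj₂ (remQuot {J} L j)) y))

  s₀ : ℕ
  s₀ = familyBound C n Δ J

  no-large-family : ∀ g → ¬ BadPolys g → ∀ {s} → s₀ ≤ s → ¬ PathFamily g s
  no-large-family g ¬bad {s} s₀≤s fam with monochromatic (C ^ n ℕ.* suc (2 ^ n ℕ.* n)) (threshold n Δ J) colour s₀≤s
    where
    colour : Fin s → Fin (C ^ n ℕ.* suc (2 ^ n ℕ.* n))
    colour p = let o , _ = offsets g fam p in combine o (proj₁ (status g fam o p))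
  ... | χ , ω , ω-inj , mono = go (remQuot {C ^ n} (suc (2 ^ n ℕ.* n)) χ) refl
    where
    o : Fin s → Fin (C ^ n)
    o p = proj₁ (offsets g fam p)
    go : ∀ t → remQuot {C ^ n} (suc (2 ^ n ℕ.* n)) χ ≡ t → _
    go (o′ , r) χ≡ = conclude r status′
      where
      both : ∀ i → (o (ω i) , proj₁ (status g fam (o (ω i)) (ω i))) ≡ (o′ , r)
      both i = trans (sym (Finₚ.remQuot-combine {C ^ n} (o (ω i)) (proj₁ (status g fam (o (ω i)) (ω i)))))
        (trans (cong (remQuot {C ^ n} (suc (2 ^ n ℕ.* n))) (mono i)) χ≡)
      onZero : ∀ i → OnZero g fam o′ (ω i)
      onZero i = subst (λ o → OnZero g fam o (ω i)) (cong proj₁ (both i)) (proj₂ (offsets g fam (ω i)))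
      status′ : ∀ i → Status g fam o′ r (ω i)
      status′ i = subst (λ (o , r) → Status g fam o r (ω i)) (both i) (proj₂ (status g fam (o (ω i)) (ω i)))
      J≤ : J ≤ threshold n Δ J
      J≤ = ℕₚ.m≤n+m J _
      conclude : ∀ r → (∀ i → Status g fam o′ r (ω i)) → _
      -- A nonsingular class contradicts the Bézout bound; in a singular class, any `J` of its paths
      -- already make g bad.
      conclude zero ns = ℕₚ.<⇒≱ (ℕₚ.m≤m+n (suc ((n ℕ.* Δ ℕ.+ 2) ^ n)) J) (few-nonsingular g fam o′ (threshold n Δ J) ω ω-inj onZero ns)
      conclude (suc r) sing = ¬bad (many-singular⇒bad g fam o′ (proj₁ (remQuot {2 ^ n} n r)) (proj₂ (remQuot {2 ^ n} n r))
        (λ j → ω (inject≤ j J≤)) (Finₚ.inject≤-injective J≤ J≤ _ _ ∘ ω-inj) (λ j → onZero (inject≤ j J≤)) (λ j → sing (inject≤ j J≤)))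

  exists-good-polys : K < P ^ J → ∃ λ g → ¬ BadPolys (polys g)
  exists-good-polys = exists-good sysK supportK unitK

-- The field ℤ/P

module ModularField {P : ℕ} (P-prime : Prime P) where

  open import Data.Nat.DivMod hiding (_/_)
  open import Data.Nat.Divisibility

  private instance
    P≢0 : NonZero P
    P≢0 = prime⇒nonZero P-prime

  red : ℕ → Fin P
  red x = x mod P

  toℕ-red : ∀ x → toℕ (red x) ≡ x % P
  toℕ-red x = Finₚ.toℕ-fromℕ< (m%n<n x P)

  red-cong : ∀ {x y} → x % P ≡ y % P → red x ≡ red y
  red-cong {x} {y} eq = Finₚ.toℕ-injective (trans (toℕ-red x) (trans eq (sym (toℕ-red y))))

  red-toℕ : ∀ x → red (toℕ x) ≡ x
  red-toℕ x = Finₚ.toℕ-injective (trans (toℕ-red (toℕ x)) (m<n⇒m%n≡m (Finₚ.toℕ<n x)))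

  infixl 6 _⊹_
  infixl 7 _·_

  _⊹_ _·_ : Fin P → Fin P → Fin P
  x ⊹ y = red (toℕ x ℕ.+ toℕ y)
  x · y = red (toℕ x ℕ.* toℕ y)

  neg : Fin P → Fin P
  neg x = red (P ℕ.∸ toℕ x)

  red-+ : ∀ x y → red x ⊹ red y ≡ red (x ℕ.+ y)
  red-+ x y = red-cong (trans (cong₂ (λ a b → (a ℕ.+ b) % P) (toℕ-red x) (toℕ-red y)) (sym (%-distribˡ-+ x y P)))

  red-* : ∀ x y → red x · red y ≡ red (x ℕ.* y)
  red-* x y = red-cong (trans (cong₂ (λ a b → (a ℕ.* b) % P) (toℕ-red x) (toℕ-red y)) (sym (%-distribˡ-* x y P)))

  red-+ˡ : ∀ x y → red x ⊹ y ≡ red (x ℕ.+ toℕ y)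
  red-+ˡ x y = trans (cong (red x ⊹_) (sym (red-toℕ y))) (red-+ x (toℕ y))

  red-+ʳ : ∀ x y → x ⊹ red y ≡ red (toℕ x ℕ.+ y)
  red-+ʳ x y = trans (cong (_⊹ red y) (sym (red-toℕ x))) (red-+ (toℕ x) y)

  red-*ˡ : ∀ x y → red x · y ≡ red (x ℕ.* toℕ y)
  red-*ˡ x y = trans (cong (red x ·_) (sym (red-toℕ y))) (red-* x (toℕ y))

  red-*ʳ : ∀ x y → x · red y ≡ red (toℕ x ℕ.* y)
  red-*ʳ x y = trans (cong (_· red y) (sym (red-toℕ x))) (red-* (toℕ x) y)

  ⊹-comm : ∀ x y → x ⊹ y ≡ y ⊹ x
  ⊹-comm x y = cong red (ℕₚ.+-comm (toℕ x) (toℕ y))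

  ·-comm : ∀ x y → x · y ≡ y · x
  ·-comm x y = cong red (ℕₚ.*-comm (toℕ x) (toℕ y))

  ⊹-assoc : ∀ x y z → (x ⊹ y) ⊹ z ≡ x ⊹ (y ⊹ z)
  ⊹-assoc x y z = trans (red-+ˡ (toℕ x ℕ.+ toℕ y) z)
    (trans (cong red (ℕₚ.+-assoc (toℕ x) (toℕ y) (toℕ z))) (sym (red-+ʳ x (toℕ y ℕ.+ toℕ z))))

  ·-assoc : ∀ x y z → (x · y) · z ≡ x · (y · z)
  ·-assoc x y z = trans (red-*ˡ (toℕ x ℕ.* toℕ y) z)
    (trans (cong red (ℕₚ.*-assoc (toℕ x) (toℕ y) (toℕ z))) (sym (red-*ʳ x (toℕ y ℕ.* toℕ z))))

  ⊹-identityˡ : ∀ x → red 0 ⊹ x ≡ x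
  ⊹-identityˡ x = trans (red-+ˡ 0 x) (red-toℕ x)

  ·-identityˡ : ∀ x → red 1 · x ≡ x
  ·-identityˡ x = trans (red-*ˡ 1 x) (trans (cong red (ℕₚ.*-identityˡ (toℕ x))) (red-toℕ x))

  ⊹-inverseˡ : ∀ x → neg x ⊹ x ≡ red 0
  ⊹-inverseˡ x = trans (red-+ˡ (P ℕ.∸ toℕ x) x) (red-cong (trans (cong (_% P) (ℕₚ.m∸n+n≡m (ℕₚ.<⇒≤ (Finₚ.toℕ<n x))))
    (trans (n%n≡0 P) (sym (m<n⇒m%n≡m (ℕ.>-nonZero⁻¹ P))))))

  ·-distribˡ-⊹ : ∀ x y z → x · (y ⊹ z) ≡ x · y ⊹ x · z
  ·-distribˡ-⊹ x y z = trans (red-*ʳ x (toℕ y ℕ.+ toℕ z))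
    (trans (cong red (ℕₚ.*-distribˡ-+ (toℕ x) (toℕ y) (toℕ z))) (sym (red-+ (toℕ x ℕ.* toℕ y) (toℕ x ℕ.* toℕ z))))

  1≢0 : red 1 ≢ red 0
  1≢0 eq with trans (sym (m<n⇒m%n≡m (ℕ.nonTrivial⇒n>1 P {{prime⇒nonTrivial P-prime}}))) (trans (sym (toℕ-red 1))
    (trans (cong toℕ eq) (trans (toℕ-red 0) (m<n⇒m%n≡m (ℕ.>-nonZero⁻¹ P)))))
  ... | ()

  P∣⇒≡0 : ∀ x → P ∣ toℕ x → x ≡ red 0
  P∣⇒≡0 x P∣x = trans (sym (red-toℕ x)) (red-cong (trans (n∣m⇒m%n≡0 (toℕ x) P P∣x) (sym (m<n⇒m%n≡m (ℕ.>-nonZero⁻¹ P)))))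

  integral : ∀ x y → x · y ≡ red 0 → x ≡ red 0 ⊎ y ≡ red 0
  integral x y xy≡0 with euclidsLemma (toℕ x) (toℕ y) P-prime (m%n≡0⇒n∣m (toℕ x ℕ.* toℕ y) P
    (trans (sym (toℕ-red _)) (trans (cong toℕ xy≡0) (trans (toℕ-red 0) (m<n⇒m%n≡m (ℕ.>-nonZero⁻¹ P))))))
  ... | inj₁ P∣x = inj₁ (P∣⇒≡0 x P∣x)
  ... | inj₂ P∣y = inj₂ (P∣⇒≡0 y P∣y)

  ⊹-inverseʳ : ∀ x → x ⊹ neg x ≡ red 0
  ⊹-inverseʳ x = trans (⊹-comm x (neg x)) (⊹-inverseˡ x)

  ⊹-cancelʳ : ∀ {x y} z → x ⊹ z ≡ y ⊹ z → x ≡ y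
  ⊹-cancelʳ {x} {y} z eq = trans (sym (cancel x)) (trans (cong (_⊹ neg z) eq) (cancel y))
    where cancel : ∀ x → (x ⊹ z) ⊹ neg z ≡ x
          cancel x = trans (⊹-assoc x z (neg z)) (trans (cong (x ⊹_) (⊹-inverseʳ z)) (trans (⊹-comm x _) (⊹-identityˡ x)))

  ·-injective : ∀ {x} → x ≢ red 0 → Injective _≡_ _≡_ (x ·_)
  ·-injective {x} x≢0 {y} {z} eq with integral x (y ⊹ neg z)
    (⊹-cancelʳ (x · z) (trans (sym (·-distribˡ-⊹ x (y ⊹ neg z) z)) (trans (cong (x ·_) (trans (⊹-assoc y (neg z) z)
      (trans (cong (y ⊹_) (⊹-inverseˡ z)) (trans (⊹-comm y _) (⊹-identityˡ y))))) (trans eq (sym (⊹-identityˡ (x · z)))))))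
  ... | inj₁ x≡0 = contradiction x≡0 x≢0
  ... | inj₂ y-z≡0 = ⊹-cancelʳ (neg z) (trans y-z≡0 (sym (⊹-inverseʳ z)))

  field-inv : ∀ x → ∃ λ y → x ≢ red 0 → x · y ≡ red 1
  field-inv x with x ≟ red 0
  -- The inverse of zero is a default value.
  ... | yes x≡0 = red 0 , contradiction x≡0
  ... | no x≢0  = let y , eq = injective⇒surjective (x ·_) (·-injective x≢0) (red 1) in y , λ _ → eq

  finiteField : FiniteField P
  finiteField = record
    { _+_ = _⊹_ ; _*_ = _·_ ; -_ = neg ; 0# = red 0 ; 1# = red 1
    ; isCommutativeRing = record
      { isRing = record
        { +-isAbelianGroup = record
          { isGroup = record
            { isMonoid = record
              { isSemigroup = record
                { isMagma = record { isEquivalence = isEquivalence ; ∙-cong = cong₂ _⊹_ }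
                ; assoc = ⊹-assoc }
              ; identity = ⊹-identityˡ , λ x → trans (⊹-comm x _) (⊹-identityˡ x) }
            ; inverse = ⊹-inverseˡ , ⊹-inverseʳ
            ; ⁻¹-cong = cong neg }
          ; comm = ⊹-comm }
        ; *-cong = cong₂ _·_
        ; *-assoc = ·-assoc
        ; *-identity = ·-identityˡ , λ x → trans (·-comm x _) (·-identityˡ x)
        ; distrib = ·-distribˡ-⊹ , λ x y z → trans (·-comm _ x) (trans (·-distribˡ-⊹ x y z) (cong₂ _⊹_ (·-comm x y) (·-comm x z)))
        }
      ; *-comm = ·-comm }
    ; inv = proj₁ ∘ field-inv
    ; inverseʳ = λ {x} → proj₂ (field-inv x)
    ; 1≢0 = 1≢0
    }

  -- Division with remainder by `q`: the remainder is the rounding, and the quotient, below `C`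
  -- because w < P ≤ C·q, selects the offset.
  rounding : ∀ {q} C → NonZero q → q ≤ P → P ≤ C ℕ.* q → Rounding finiteField q C
  rounding {q} C q≢0 q≤P P≤Cq = record
    { emb = λ x → inject≤ x q≤P
    ; emb-injective = λ {x} {y} → Finₚ.inject≤-injective q≤P q≤P x y
    ; π = λ w → toℕ w mod q
    ; offset = λ c → red (toℕ c ℕ.* q)
    ; split = λ w → fromℕ< (digit< w) , sym (digits-red w)
    }
    where
    instance
      _ : NonZero q
      _ = q≢0
    digit< : ∀ (w : Fin P) → toℕ w ℕ./ q < C
    digit< w = m<n*o⇒m/o<n (ℕₚ.<-≤-trans (Finₚ.toℕ<n w) P≤Cq)
    digits-red : ∀ w → inject≤ (toℕ w mod q) q≤P ⊹ red (toℕ (fromℕ< (digit< w)) ℕ.* q) ≡ w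
    digits-red w = trans (red-+ʳ _ _) (trans (cong red (trans
      (cong₂ ℕ._+_ (trans (Finₚ.toℕ-inject≤ (toℕ w mod q) q≤P) (Finₚ.toℕ-fromℕ< (m%n<n (toℕ w) q)))
                   (cong (ℕ._* q) (Finₚ.toℕ-fromℕ< (digit< w))))
      (sym (m≡m%n+[m/n]*n (toℕ w) q)))) (red-toℕ w))

-- Theta graphs and edge counts

-- A sum is the size of a disjoint union and this is its inclusion map; it turns a lower bound for
-- `edges` into an injection.
sum-index : ∀ {n} (c : Fin n → ℕ) i → Fin (c i) → Fin (sum (tabulate c))
sum-index c zero    r = r ↑ˡ sum (tabulate (c ∘ suc))
sum-index c (suc i) r = c zero ↑ʳ sum-index (c ∘ suc) i r

sum-index-injective : ∀ {n} (c : Fin n → ℕ) {i j r r′} → sum-index c i r ≡ sum-index c j r′ → (i , r) ≡ (j , r′)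
sum-index-injective c {zero}  {zero}  eq = cong (zero ,_) (Finₚ.↑ˡ-injective _ _ _ eq)
sum-index-injective c {suc i} {suc j} eq with refl ← sum-index-injective (c ∘ suc) {i} {j} (Finₚ.↑ʳ-injective (c zero) _ _ eq) = refl
sum-index-injective c {zero}  {suc j} {r} {r′} eq with () ←
  trans (sym (Finₚ.splitAt-↑ˡ (c zero) r _)) (trans (cong (splitAt (c zero)) eq) (Finₚ.splitAt-↑ʳ (c zero) _ (sum-index (c ∘ suc) j r′)))
sum-index-injective c {suc i} {zero}  {r} {r′} eq with () ←
  trans (sym (Finₚ.splitAt-↑ʳ (c zero) _ (sum-index (c ∘ suc) i r))) (trans (cong (splitAt (c zero)) eq) (Finₚ.splitAt-↑ˡ (c zero) r′ _))

module _ {M N : ℕ} (B : Fin M → Fin N → Bool) where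

  private
    bit : Bool → ℕ
    bit b = if b then 1 else 0
    rowSum : Fin M → ℕ
    rowSum x = sum (tabulate (λ y → bit (B x y)))
    edges≡ : edges M N B ≡ sum (tabulate rowSum)
    edges≡ = cong sum (trans (Listₚ.map-tabulate (λ i → i) _)
      (Listₚ.tabulate-cong λ x → cong sum (Listₚ.map-tabulate (λ i → i) (λ y → bit (B x y)))))
    index : ∀ x y → B x y ≡ true → Fin (sum (tabulate rowSum))
    index x y eq = sum-index rowSum x (sum-index (λ y → bit (B x y)) y (subst (Fin ∘ bit) (sym eq) zero))
    index-injective : ∀ {x y x′ y′} eq eq′ → index x y eq ≡ index x′ y′ eq′ → x ≡ x′ × y ≡ y′
    index-injective {x} {y} {x′} {y′} eq eq′ i≡ = go (sum-index-injective rowSum i≡)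
      where
      go : ∀ {r r′} → (x , sum-index (λ y → bit (B x y)) y r) ≡ (x′ , sum-index (λ y → bit (B x′ y)) y′ r′) → x ≡ x′ × y ≡ y′
      go e with cong proj₁ e
      ... | refl = refl , cong proj₁ (sum-index-injective (λ y → bit (B x y)) (second e))
        where
        second : ∀ {c : Fin M → ℕ} {r r′ : Fin (c x)} → _≡_ {A = Σ (Fin M) (Fin ∘ c)} (x , r) (x , r′) → r ≡ r′
        second refl = refl

  injection⇒≤edges : ∀ {t} (x : Fin t → Fin M) (y : Fin t → Fin N) → (∀ i → B (x i) (y i) ≡ true) →
    (∀ {i j} → x i ≡ x j → y i ≡ y j → i ≡ j) → t ≤ edges M N B
  injection⇒≤edges x y true-at inj = subst (_ ≤_) (sym edges≡) (Finₚ.injective⇒≤ {f = λ i → index (x i) (y i) (true-at i)}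
    (λ {i} {j} eq → let x≡ , y≡ = index-injective (true-at i) (true-at j) eq in inj x≡ y≡))

ThetaAdj-sym : ∀ {s L} v w → ThetaAdj s L v w → ThetaAdj s L w v
ThetaAdj-sym left        right       e = e
ThetaAdj-sym right       left        e = e
ThetaAdj-sym left        (inner _ _) e = e
ThetaAdj-sym (inner _ _) left        e = e
ThetaAdj-sym right       (inner _ _) e = e
ThetaAdj-sym (inner _ _) right       e = e
ThetaAdj-sym (inner _ _) (inner _ _) (i≡ , inj₁ j≡) = sym i≡ , inj₂ j≡
ThetaAdj-sym (inner _ _) (inner _ _) (i≡ , inj₂ j≡) = sym i≡ , inj₁ j≡

-- The theta graph traversed from either endpoint. Both directions are needed because an embedding
-- may send `left` to either side of the bipartition, whereas path families start on the x side.
record Walks (s d : ℕ) : Set where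
  field
    walk      : Fin s → ℕ → ThetaV s (suc d)
    start end : ThetaV s (suc d)
    at-start  : ∀ p → walk p 0 ≡ start
    at-end    : ∀ p → walk p (suc d) ≡ end
    step      : ∀ p i → i ≤ d → ThetaAdj s (suc d) (walk p i) (walk p (suc i))
    walk-inj  : ∀ {p p′ i i′} → i ≤ suc d → i′ ≤ suc d → walk p i ≡ walk p′ i′ → i ≡ i′ × (i ≢ 0 → i ≢ suc d → p ≡ p′)

inner-injective : ∀ {s L i i′ j j′} → inner {s} {L} i j ≡ inner i′ j′ → i ≡ i′ × j ≡ j′
inner-injective refl = refl , refl

module _ (s d : ℕ) (1≤d : 1 ≤ d) where

  private
    node : Fin s → ℕ → ThetaV s (suc d)
    node p zero = left
    node p (suc j) with j ℕ.<? d
    ... | yes j<d = inner p (fromℕ< j<d)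
    ... | no _    = right

    node-inner : ∀ p {j} (j<d : j < d) → node p (suc j) ≡ inner p (fromℕ< j<d)
    node-inner p {j} j<d with j ℕ.<? d
    ... | yes _   = refl
    ... | no j≮d = contradiction j<d j≮d

    node-end : ∀ p → node p (suc d) ≡ right
    node-end p with d ℕ.<? d
    ... | yes d<d = contradiction d<d (ℕₚ.<-irrefl refl)
    ... | no _    = refl

    node-step : ∀ p i → i ≤ d → ThetaAdj s (suc d) (node p i) (node p (suc i))
    node-step p zero _ = subst (ThetaAdj s (suc d) left) (sym (node-inner p 1≤d)) (Finₚ.toℕ-fromℕ< 1≤d)
    node-step p (suc j) j<d with ℕₚ.m≤n⇒m<n∨m≡n j<d
    ... | inj₁ sj<d = subst₂ (ThetaAdj s (suc d)) (sym (node-inner p j<d)) (sym (node-inner p sj<d))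
          (refl , inj₁ (trans (cong suc (Finₚ.toℕ-fromℕ< j<d)) (sym (Finₚ.toℕ-fromℕ< sj<d))))
    ... | inj₂ refl = subst₂ (ThetaAdj s (suc d)) (sym (node-inner p j<d)) (sym (node-end p)) (cong suc (Finₚ.toℕ-fromℕ< j<d))

    node-inj : ∀ {p p′ i i′} → i ≤ suc d → i′ ≤ suc d → node p i ≡ node p′ i′ → i ≡ i′ × (i ≢ 0 → i ≢ suc d → p ≡ p′)
    node-inj {i = zero} {zero} _ _ _ = refl , λ 0≢0 → contradiction refl 0≢0
    node-inj {i = zero} {suc i′} _ _ eq with i′ ℕ.<? d
    node-inj {i = zero} {suc i′} _ _ () | yes _
    node-inj {i = zero} {suc i′} _ _ () | no _
    node-inj {i = suc i} {zero} _ _ eq with i ℕ.<? d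
    node-inj {i = suc i} {zero} _ _ () | yes _
    node-inj {i = suc i} {zero} _ _ () | no _
    node-inj {i = suc i} {suc i′} (s≤s i≤) (s≤s i′≤) eq with i ℕ.<? d | i′ ℕ.<? d
    ... | yes i<d | yes i′<d = cong suc (Finₚ.fromℕ<-injective i i′ i<d i′<d (proj₂ (inner-injective eq))) , λ _ _ → proj₁ (inner-injective eq)
    node-inj {i = suc i} {suc i′} (s≤s i≤) (s≤s i′≤) () | yes _ | no _
    node-inj {i = suc i} {suc i′} (s≤s i≤) (s≤s i′≤) () | no _ | yes _
    ... | no i≮d | no i′≮d = cong suc (trans i≡d (sym (ℕₚ.≤-antisym i′≤ (ℕₚ.≮⇒≥ i′≮d)))) , λ _ ne → contradiction (cong suc i≡d) ne
      where i≡d = ℕₚ.≤-antisym i≤ (ℕₚ.≮⇒≥ i≮d)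

  forward : Walks s d
  forward = record { walk = node ; start = left ; end = right ; at-start = λ _ → refl ; at-end = node-end
                   ; step = node-step ; walk-inj = node-inj }

  backward : Walks s d
  backward = record { walk = λ p i → node p (suc d ℕ.∸ i) ; start = right ; end = left ; at-start = node-end
                    ; at-end = λ p → cong (node p) (ℕₚ.n∸n≡0 d)
                    ; step = λ p i i≤d → subst (λ t → ThetaAdj s (suc d) (node p t) (node p (d ℕ.∸ i))) (sym (ℕₚ.+-∸-assoc 1 i≤d))
                        (ThetaAdj-sym (node p (d ℕ.∸ i)) (node p (suc (d ℕ.∸ i))) (node-step p (d ℕ.∸ i) (ℕₚ.m∸n≤m d i)))
                    ; walk-inj = λ {p} {p′} {i} {i′} i≤ i′≤ eq →
                        let t≡ , p≡ = node-inj (ℕₚ.m∸n≤m (suc d) i) (ℕₚ.m∸n≤m (suc d) i′) eq in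
                        ℕₚ.∸-cancelˡ-≡ i≤ i′≤ t≡ ,
                        λ i≢0 i≢d → p≡ (λ t≡0 → i≢d (ℕₚ.≤-antisym i≤ (ℕₚ.m∸n≡0⇒m≤n t≡0)))
                                       (λ t≡d → i≢0 (ℕₚ.∸-cancelˡ-≡ i≤ z≤n t≡d)) }

module Embedded {M N : ℕ} (E : Fin M → Fin N → Bool) where

  private
    G : Graph
    G = BipGraph M N E

  inLeft : Fin M ⊎ Fin N → Bool
  inLeft (inj₁ _) = true
  inLeft (inj₂ _) = false

  leftVertex : ∀ {w} → inLeft w ≡ true → ∃ λ x → w ≡ inj₁ x
  leftVertex {inj₁ x} _ = x , refl

  rightVertex : ∀ {w} → inLeft w ≡ false → ∃ λ y → w ≡ inj₂ y
  rightVertex {inj₂ y} _ = y , refl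

  Adj-flips : ∀ v w → Adj G v w → inLeft w ≡ not (inLeft v)
  Adj-flips (inj₁ _) (inj₂ _) _ = refl
  Adj-flips (inj₂ _) (inj₁ _) _ = refl

  Adj⇒E : ∀ {x y v w} → Adj G v w → (v ≡ inj₁ x × w ≡ inj₂ y) ⊎ (v ≡ inj₂ y × w ≡ inj₁ x) → T (E x y)
  Adj⇒E adj (inj₁ (refl , refl)) = adj
  Adj⇒E adj (inj₂ (refl , refl)) = adj

  module _ {s d : ℕ} (f : ThetaV s (suc d) → Fin M ⊎ Fin N)
           (f-adj : ∀ v w → ThetaAdj s (suc d) v w → Adj G (f v) (f w)) (ws : Walks s d) where
    open Walks ws

    even-side : ∀ p i → i ℕ.+ i ≤ suc d → inLeft (f (walk p (i ℕ.+ i))) ≡ inLeft (f start)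
    odd-side  : ∀ p i → suc (i ℕ.+ i) ≤ suc d → inLeft (f (walk p (suc (i ℕ.+ i)))) ≡ not (inLeft (f start))
    even-side p zero    _  = cong (inLeft ∘ f) (at-start p)
    even-side p (suc i) i≤ = trans (cong (λ t → inLeft (f (walk p (suc t)))) (ℕₚ.+-suc i i))
      (trans (Adj-flips _ _ (f-adj _ _ (step p (suc (i ℕ.+ i)) (ℕₚ.≤-pred (subst (λ t → suc t ≤ suc d) (ℕₚ.+-suc i i) i≤)))))
      (trans (cong not (odd-side p i (ℕₚ.≤-trans (ℕₚ.n≤1+n _) (subst (λ t → suc t ≤ suc d) (ℕₚ.+-suc i i) i≤)))) (Boolₚ.not-involutive _)))
    odd-side p i i≤ = trans (Adj-flips _ _ (f-adj _ _ (step p (i ℕ.+ i) (ℕₚ.≤-pred i≤)))) (cong not (even-side p i (ℕₚ.<⇒≤ i≤)))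

module ThetaPaths {P : ℕ} {𝔽 : FiniteField P} {q C : ℕ} (R : Rounding 𝔽 q C) (Λ : Layout) (J : ℕ) where

  open PathFamilies R Λ J public

  module _ (g : Fin m → Poly (A ℕ.+ ℓ) Δ) where

    E : Fin (q ^ a) → Fin (q ^ ℓ) → Bool
    E X Y = ⌊ edge? g X Y ⌋

    open Embedded E

    private
      d : ℕ
      d = k′ ℕ.+ k′

    module _ {s : ℕ} (p₀ : Fin s) (1≤k′ : 1 ≤ k′) (f : ThetaV s (suc d) → Fin (q ^ a) ⊎ Fin (q ^ ℓ)) (f-inj : Injective _≡_ _≡_ f)
             (f-adj : ∀ v w → ThetaAdj s (suc d) v w → Adj (BipGraph (q ^ a) (q ^ ℓ) E) (f v) (f w))
             (ws : Walks s d) (start-left : inLeft (f (Walks.start ws)) ≡ true) where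

      open Walks ws

      private
        2i≤d : ∀ (i : Fin (suc k′)) → toℕ i ℕ.+ toℕ i ≤ d
        2i≤d i = ℕₚ.+-mono-≤ (Finₚ.toℕ≤pred[n] i) (Finₚ.toℕ≤pred[n] i)

        x-vertex : ∀ p (i : Fin (suc k′)) → ∃ λ x → f (walk p (toℕ i ℕ.+ toℕ i)) ≡ inj₁ x
        x-vertex p i = leftVertex (trans (even-side f f-adj ws p (toℕ i) (ℕₚ.m≤n⇒m≤1+n (2i≤d i))) start-left)

        y-vertex : ∀ p (i : Fin (suc k′)) → ∃ λ y → f (walk p (suc (toℕ i ℕ.+ toℕ i))) ≡ inj₂ y
        y-vertex p i = rightVertex (trans (odd-side f f-adj ws p (toℕ i) (s≤s (2i≤d i))) (cong not start-left))

        X : Fin s → Fin (suc k′) → Fin (q ^ a)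
        X p i = proj₁ (x-vertex p i)

        Y : Fin s → Fin (suc k′) → Fin (q ^ ℓ)
        Y p i = proj₁ (y-vertex p i)

        toℕ-xi : ∀ e → toℕ (xi e) ≡ ⌈ toℕ e /2⌉
        toℕ-xi e = Finₚ.toℕ-fromℕ< _

        toℕ-yi : ∀ e → toℕ (yi e) ≡ ⌊ toℕ e /2⌋
        toℕ-yi e = Finₚ.toℕ-fromℕ< _

        halves : ∀ (e : Fin L) → ⌊ toℕ e /2⌋ ℕ.+ ⌈ toℕ e /2⌉ ≡ toℕ e
        halves e = ℕₚ.⌊n/2⌋+⌈n/2⌉≡n (toℕ e)

        f-x : ∀ p i {t} → toℕ i ℕ.+ toℕ i ≡ t → f (walk p t) ≡ inj₁ (X p i)
        f-x p i refl = proj₂ (x-vertex p i)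

        f-y : ∀ p i {t} → suc (toℕ i ℕ.+ toℕ i) ≡ t → f (walk p t) ≡ inj₂ (Y p i)
        f-y p i refl = proj₂ (y-vertex p i)

        ends-of-edge : ∀ p e → T (E (X p (xi e)) (Y p (yi e)))
        ends-of-edge p e = Adj⇒E (f-adj _ _ (step p (toℕ e) (edge≤ e))) (cases (⌈n/2⌉-cases (toℕ e)))
          where
          cases : _ → (f (walk p (toℕ e)) ≡ inj₁ (X p (xi e)) × f (walk p (suc (toℕ e))) ≡ inj₂ (Y p (yi e))) ⊎
                      (f (walk p (toℕ e)) ≡ inj₂ (Y p (yi e)) × f (walk p (suc (toℕ e))) ≡ inj₁ (X p (xi e)))
          cases (inj₁ even) = inj₁
            ( f-x p (xi e) (trans (cong₂ ℕ._+_ (trans (toℕ-xi e) even) (toℕ-xi e)) (halves e))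
            , f-y p (yi e) (cong suc (trans (cong₂ ℕ._+_ (toℕ-yi e) (trans (toℕ-yi e) (sym even))) (halves e))))
          cases (inj₂ odd) = inj₂
            ( f-y p (yi e) (trans (cong suc (cong₂ ℕ._+_ (toℕ-yi e) (toℕ-yi e))) (trans (sym (ℕₚ.+-suc _ _)) (trans (cong (⌊ toℕ e /2⌋ ℕ.+_) (sym odd)) (halves e))))
            , f-x p (xi e) (trans (cong₂ ℕ._+_ (trans (toℕ-xi e) odd) (toℕ-xi e)) (cong suc (halves e))))

        disjoint′ : ∀ {p p′ e e′} → X p (xi e) ≡ X p′ (xi e′) → Y p (yi e) ≡ Y p′ (yi e′) → p ≡ p′ × e ≡ e′
        disjoint′ {p} {p′} {e} {e′} X≡ Y≡ = p≡p′ , e≡e′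
          where
          nx : ∀ e → toℕ (xi e) ℕ.+ toℕ (xi e) ≤ suc d
          nx e = ℕₚ.m≤n⇒m≤1+n (2i≤d (xi e))
          ny : ∀ e → suc (toℕ (yi e) ℕ.+ toℕ (yi e)) ≤ suc d
          ny e = s≤s (2i≤d (yi e))
          wx = walk-inj (nx e) (nx e′) (f-inj (trans (f-x p (xi e) refl) (trans (cong inj₁ X≡) (sym (f-x p′ (xi e′) refl)))))
          wy = walk-inj (ny e) (ny e′) (f-inj (trans (f-y p (yi e) refl) (trans (cong inj₂ Y≡) (sym (f-y p′ (yi e′) refl)))))
          double : ∀ {i j} → i ℕ.+ i ≡ j ℕ.+ j → i ≡ j
          double {i} {j} eq = trans (ℕₚ.n≡⌊n+n/2⌋ i) (trans (cong ⌊_/2⌋ eq) (sym (ℕₚ.n≡⌊n+n/2⌋ j)))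
          e≡e′ : e ≡ e′
          e≡e′ = Finₚ.toℕ-injective (trans (sym (halves e)) (trans
            (cong₂ ℕ._+_ (trans (sym (toℕ-yi e)) (trans (double (ℕₚ.suc-injective (proj₁ wy))) (toℕ-yi e′)))
                         (trans (sym (toℕ-xi e)) (trans (double (proj₁ wx)) (toℕ-xi e′)))) (halves e′)))
          p≡p′ : p ≡ p′
          p≡p′ with toℕ (xi e) ℕ.+ toℕ (xi e) ℕ.≟ 0
          ... | no ≢0 = proj₂ wx ≢0 (λ eq → ℕₚ.<⇒≢ (s≤s (2i≤d (xi e))) eq)
          -- The x-end is the common start, so only the y-end can identify the path; it is an inner
          -- vertex because it has number 0 and k′ ≥ 1.
          ... | yes ≡0 = proj₂ wy (λ ()) (λ eq → ℕₚ.<⇒≢ yi<k′ (double (ℕₚ.suc-injective eq)))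
            where
            yi<k′ : toℕ (yi e) < k′
            yi<k′ = ℕₚ.≤-<-trans (ℕₚ.≤-reflexive (toℕ-yi e)) (ℕₚ.≤-<-trans (ℕₚ.≤-trans (ℕₚ.⌊n/2⌋≤⌈n/2⌉ (toℕ e))
              (ℕₚ.≤-reflexive (trans (sym (toℕ-xi e)) (ℕₚ.m+n≡0⇒m≡0 (toℕ (xi e)) ≡0)))) 1≤k′)

      walks⇒family : PathFamily g s
      walks⇒family = record
        { u = X p₀ zero ; v = Y p₀ (fromℕ k′) ; X = X ; Y = Y
        ; starts = λ p → Sumₚ.inj₁-injective (trans (sym (f-x p zero refl)) (trans (cong f (trans (at-start p) (sym (at-start p₀)))) (f-x p₀ zero refl)))
        ; ends = λ p → Sumₚ.inj₂-injective (trans (sym (f-y p (fromℕ k′) top)) (trans (cong f (trans (at-end p) (sym (at-end p₀)))) (f-y p₀ (fromℕ k′) top)))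
        ; edge = λ p e → toWitness (ends-of-edge p e)
        ; disjoint = disjoint′
        }
        where
        top : suc (toℕ (fromℕ k′) ℕ.+ toℕ (fromℕ k′)) ≡ suc d
        top = cong (λ t → suc (t ℕ.+ t)) (Finₚ.toℕ-fromℕ k′)

    -- The length is odd, so exactly one endpoint of the theta graph lands on the x side; traverse
    -- from that one.
    theta⇒family : ∀ {s} → Fin s → 1 ≤ k′ → Contains (BipGraph (q ^ a) (q ^ ℓ) E) (Theta s (suc d)) → PathFamily g s
    theta⇒family {s} p₀ 1≤k′ (f , f-inj , f-adj) with inLeft (f left) in side
    ... | true  = walks⇒family p₀ 1≤k′ f f-inj f-adj (forward s d 1≤d) side
      where 1≤d = ℕₚ.≤-trans 1≤k′ (ℕₚ.m≤m+n k′ k′)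
    ... | false = walks⇒family p₀ 1≤k′ f f-inj f-adj (backward s d 1≤d)
      (trans (cong (inLeft ∘ f) (sym (Walks.at-end (forward s d 1≤d) p₀)))
        (trans (odd-side f f-adj (forward s d 1≤d) p₀ k′ ℕₚ.≤-refl) (cong not side)))
      where 1≤d = ℕₚ.≤-trans 1≤k′ (ℕₚ.m≤m+n k′ k′)

    theta-free : ¬ BadPolys g → 1 ≤ k′ → ∀ {s} → s₀ ≤ s → FreeOf (Theta s (suc d)) (BipGraph (q ^ a) (q ^ ℓ) E)
    theta-free ¬bad 1≤k′ {s} s₀≤s contains = no-large-family g ¬bad s₀≤s
      (theta⇒family (fromℕ< (ℕₚ.<-≤-trans (s≤s z≤n) s₀≤s)) 1≤k′ contains)

    many-edges : q ^ (A ℕ.+ ℓ) ≤ edges (q ^ a) (q ^ ℓ) E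
    many-edges = injection⇒≤edges E x y edge-at injective
      where
      coordX : (Fin (A ℕ.+ ℓ) → Fin q) → Fin a → Fin q
      coordX w j = [ (λ i → w (i ↑ˡ ℓ)) , (λ x → π (⟦ g x ⟧ (ι ∘ emb ∘ w) 0)) ]′ (splitAt A j)
      x : Fin (q ^ (A ℕ.+ ℓ)) → Fin (q ^ a)
      x t = funToFin (coordX (finToFun t))
      y : Fin (q ^ (A ℕ.+ ℓ)) → Fin (q ^ ℓ)
      y t = funToFin (λ j → finToFun t (A ↑ʳ j))
      x-at : ∀ t j → finToFun (x t) j ≡ coordX (finToFun t) j
      x-at t j = Finₚ.finToFun-funToFin (coordX (finToFun t)) j
      x-at-ξ : ∀ t i → finToFun (x t) (i ↑ˡ m) ≡ finToFun t (i ↑ˡ ℓ)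
      x-at-ξ t i = trans (x-at t (i ↑ˡ m)) (cong [ _ , _ ]′ (Finₚ.splitAt-↑ˡ A i m))
      y-at : ∀ t j → finToFun (y t) j ≡ finToFun t (A ↑ʳ j)
      y-at t j = Finₚ.finToFun-funToFin (λ j → finToFun t (A ↑ʳ j)) j
      Q≗ : ∀ t i → Q (x t) (y t) i ≡ emb (finToFun t i)
      Q≗ t i with splitAt A i in sp
      ... | inj₁ j = cong emb (trans (x-at-ξ t j) (cong (finToFun t) (Finₚ.splitAt⁻¹-↑ˡ sp)))
      ... | inj₂ j = cong emb (trans (y-at t j) (cong (finToFun t) (Finₚ.splitAt⁻¹-↑ʳ sp)))
      edge-at : ∀ t → E (x t) (y t) ≡ true
      edge-at t with edge? g (x t) (y t)
      ... | yes _ = refl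
      ... | no ¬edge = contradiction (λ i → trans (cong π (⟦⟧-0 (g i) (Q≗ t)))
              (sym (trans (x-at t (A ↑ʳ i)) (cong [ _ , _ ]′ (Finₚ.splitAt-↑ʳ A m i))))) ¬edge
      injective : ∀ {t t′} → x t ≡ x t′ → y t ≡ y t′ → t ≡ t′
      injective {t} {t′} x≡ y≡ = finToFun-injective {A ℕ.+ ℓ} λ i → emb-injective
        (trans (sym (Q≗ t i)) (trans (cong₂ (λ X Y → Q X Y i) x≡ y≡) (Q≗ t′ i)))

  exists-theta-free : K < P ^ J → 1 ≤ k′ → ∀ {s} → s₀ ≤ s → Σ (Fin (q ^ a) → Fin (q ^ ℓ) → Bool) λ E →
    FreeOf (Theta s (suc (k′ ℕ.+ k′))) (BipGraph (q ^ a) (q ^ ℓ) E) × q ^ (A ℕ.+ ℓ) ≤ edges (q ^ a) (q ^ ℓ) E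
  exists-theta-free K< 1≤k′ s₀≤s = let g , ¬bad = exists-good-polys K< in
    E (polys g) , theta-free (polys g) ¬bad 1≤k′ s₀≤s , many-edges (polys g)

-- A prime between q and 16q

module PrimesInIntervals where

  open import Data.Nat using (_+_; _*_)
  open import Data.Nat.Divisibility
  open import Data.Nat.Induction using (<-rec)
  open import Data.Nat.Primality.Factorisation using (factorise)
  open import Data.Nat.Properties hiding (_≟_)

  -- binom i j = (i + j choose i)
  binom : ℕ → ℕ → ℕ
  binom zero    j       = 1
  binom (suc i) zero    = 1
  binom (suc i) (suc j) = binom i (suc j) + binom (suc i) j

  binom-0ʳ : ∀ i → binom i 0 ≡ 1
  binom-0ʳ zero    = refl
  binom-0ʳ (suc i) = refl

  mutual
    binom-sucˡ : ∀ i j → suc i * binom (suc i) j ≡ suc (i + j) * binom i j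
    binom-sucˡ i zero = cong₂ (λ x y → suc x * y) (sym (+-identityʳ i)) (sym (binom-0ʳ i))
    binom-sucˡ i (suc j) = begin
      suc i * (binom i (suc j) + binom (suc i) j)                       ≡⟨ *-distribˡ-+ (suc i) (binom i (suc j)) (binom (suc i) j) ⟩
      suc i * binom i (suc j) + suc i * binom (suc i) j                 ≡⟨ cong (suc i * binom i (suc j) +_) (trans (binom-sucˡ i j) (sym (binom-sucʳ i j))) ⟩
      suc i * binom i (suc j) + suc j * binom i (suc j)                 ≡⟨ *-distribʳ-+ (binom i (suc j)) (suc i) (suc j) ⟨
      suc (i + suc j) * binom i (suc j)                                 ∎
      where open ≡-Reasoning

    binom-sucʳ : ∀ i j → suc j * binom i (suc j) ≡ suc (i + j) * binom i j
    binom-sucʳ zero    j = refl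
    binom-sucʳ (suc i) j = begin
      suc j * (binom i (suc j) + binom (suc i) j)                       ≡⟨ *-distribˡ-+ (suc j) (binom i (suc j)) (binom (suc i) j) ⟩
      suc j * binom i (suc j) + suc j * binom (suc i) j                 ≡⟨ cong (_+ suc j * binom (suc i) j) (trans (binom-sucʳ i j) (sym (binom-sucˡ i j))) ⟩
      suc i * binom (suc i) j + suc j * binom (suc i) j                 ≡⟨ *-distribʳ-+ (binom (suc i) j) (suc i) (suc j) ⟨
      (suc i + suc j) * binom (suc i) j                                 ≡⟨ cong (_* binom (suc i) j) (+-suc (suc i) j) ⟩
      suc (suc i + j) * binom (suc i) j                                 ∎
      where open ≡-Reasoning

  binom≤2^ : ∀ i j → binom i j ≤ 2 ^ (i + j)
  binom≤2^ zero    j       = m^n>0 2 j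
  binom≤2^ (suc i) zero    = m^n>0 2 (suc i + 0)
  binom≤2^ (suc i) (suc j) = subst (binom (suc i) (suc j) ≤_)
    (cong (2 ^ (i + suc j) +_) (trans (cong (2 ^_) (sym (+-suc i j))) (sym (+-identityʳ _))))
    (+-mono-≤ (binom≤2^ i (suc j)) (binom≤2^ (suc i) j))

  leibniz : ℕ → ℕ → ℕ
  leibniz i j = suc (i + j) * binom i j

  -- Leibniz's harmonic triangle: 1/leibniz i j = 1/leibniz i (j+1) + 1/leibniz (i+1) j.
  leibniz-∣ : ∀ {N} i j → (∀ t → 1 ≤ t → t ≤ suc (i + j) → t ∣ N) → leibniz i j ∣ N
  leibniz-∣ {N} i zero all = subst (_∣ N) (trans (sym (*-identityʳ _)) (cong (suc (i + 0) *_) (sym (binom-0ʳ i)))) (all _ (s≤s z≤n) ≤-refl)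
  leibniz-∣ {N} i (suc j) all
    with leibniz-∣ i j (λ t 1≤t t≤ → all t 1≤t (≤-trans t≤ (s≤s (+-monoʳ-≤ i (n≤1+n j)))))
       | leibniz-∣ (suc i) j (λ t 1≤t t≤ → all t 1≤t (subst (λ s → t ≤ suc s) (sym (+-suc i j)) t≤))
  -- By the triangle identity N/y = N/w - N/x = z₁ - z₂; clearing denominators gives y·z₁ = y·z₂ +
  -- N, hence y divides N.
  ... | divides z₁ N≡z₁w | divides z₂ N≡z₂x = ∣m+n∣m⇒∣n {n = N} (subst (y ∣_) y*z₁≡ (m∣m*n z₁)) (m∣m*n z₂)
    where
    y x w M : ℕ
    y = leibniz i (suc j)
    x = leibniz (suc i) j
    w = leibniz i j
    M = suc i + suc j
    y≡ : suc j * y ≡ M * w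
    y≡ = trans (solve 3 (λ j s b → j :* (s :* b) := s :* (j :* b)) refl (suc j) (suc (i + suc j)) (binom i (suc j)))
      (cong (suc (i + suc j) *_) (binom-sucʳ i j))
      where open +-*-Solver
    x≡ : suc i * x ≡ M * w
    x≡ = trans (solve 3 (λ j s b → j :* (s :* b) := s :* (j :* b)) refl (suc i) (suc (suc i + j)) (binom (suc i) j))
      (cong₂ _*_ (sym (+-suc (suc i) j)) (binom-sucˡ i j))
      where open +-*-Solver
    y*z₁≡ : y * z₁ ≡ y * z₂ + N
    y*z₁≡ = *-cancelˡ-≡ (y * z₁) (y * z₂ + N) (suc j) (begin
      suc j * (y * z₁)              ≡⟨ trans (sym (*-assoc (suc j) y z₁)) (cong (_* z₁) y≡) ⟩
      M * w * z₁                    ≡⟨ trans (*-assoc M w z₁) (cong (M *_) (trans (*-comm w z₁) (sym N≡z₁w))) ⟩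
      M * N                         ≡⟨ *-distribʳ-+ N (suc i) (suc j) ⟩
      suc i * N + suc j * N         ≡⟨ cong (λ t → suc i * t + suc j * N) (trans N≡z₂x (*-comm z₂ x)) ⟩
      suc i * (x * z₂) + suc j * N  ≡⟨ cong (_+ suc j * N) (trans (sym (*-assoc (suc i) x z₂)) (cong (_* z₂) (trans x≡ (sym y≡)))) ⟩
      suc j * y * z₂ + suc j * N    ≡⟨ cong (_+ suc j * N) (*-assoc (suc j) y z₂) ⟩
      suc j * (y * z₂) + suc j * N  ≡⟨ *-distribˡ-+ (suc j) (y * z₂) N ⟨
      suc j * (y * z₂ + N)          ∎)
      where open ≡-Reasoning

  -- With `leibniz-∣` this bounds every positive common multiple of 1, ..., 2n+1 from below.
  -- Consecutive central entries have ratio 2(2n+3)/(n+1), which exceeds 4.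
  4^n≤leibniz : ∀ n → 4 ^ n ≤ leibniz n n
  4^n≤leibniz zero    = ≤-refl
  4^n≤leibniz (suc n) = *-cancelˡ-≤ (suc n) (begin
    suc n * (4 * 4 ^ n)                                           ≤⟨ *-monoʳ-≤ (suc n) (*-monoʳ-≤ 4 (4^n≤leibniz n)) ⟩
    suc n * (4 * leibniz n n)                                     ≤⟨ m≤m+n _ (2 * leibniz n n) ⟩
    suc n * (4 * leibniz n n) + 2 * leibniz n n                   ≡⟨ solve 2 (λ n x → (con 1 :+ n) :* (con 4 :* x) :+ con 2 :* x
                                                                       := (con 3 :+ (n :+ n)) :* (con 2 :* x)) refl n (leibniz n n) ⟩
    (3 + (n + n)) * (2 * leibniz n n)                             ≡⟨ cong (λ t → (3 + (n + n)) * (2 * t)) (sym (binom-sucʳ n n)) ⟩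
    (3 + (n + n)) * (2 * (suc n * binom n (suc n)))               ≡⟨ cong ((3 + (n + n)) *_) central ⟩
    (3 + (n + n)) * (suc n * binom (suc n) (suc n))               ≡⟨ solve 3 (λ t n b → t :* (n :* b) := n :* (t :* b)) refl (3 + (n + n)) (suc n) (binom (suc n) (suc n)) ⟩
    suc n * ((3 + (n + n)) * binom (suc n) (suc n))               ≡⟨ cong (λ t → suc n * (suc (suc t) * binom (suc n) (suc n))) (sym (+-suc n n)) ⟩
    suc n * leibniz (suc n) (suc n)                               ∎)
    where
    open ≤-Reasoning
    open +-*-Solver
    central : 2 * (suc n * binom n (suc n)) ≡ suc n * binom (suc n) (suc n)
    central = trans (solve 2 (λ n b → con 2 :* ((con 1 :+ n) :* b) := (con 1 :+ (n :+ (con 1 :+ n))) :* b) refl n (binom n (suc n)))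
      (sym (binom-sucˡ n (suc n)))

  prime∤< : ∀ {p t} → Prime p → 1 ≤ t → t < p → ¬ p ∣ t
  prime∤< {t = suc t} p-prime _ t<p p∣t = <⇒≱ t<p (∣⇒≤ p∣t)

  -- The prime divides (i+j)! but neither i! nor j!; peeling off the factors of i! one at a time
  -- avoids factorials.
  prime∣binom : ∀ {p} i j → Prime p → i < p → j < p → p ≤ i + j → p ∣ binom i j
  prime∣binom zero j p-prime i<p j<p p≤j = contradiction p≤j (<⇒≱ j<p)
  prime∣binom {p} (suc i) j p-prime i<p j<p p≤ with euclidsLemma (suc i) (binom (suc i) j) p-prime (subst (p ∣_) (sym (binom-sucˡ i j)) p∣rhs)
    where
    p∣rhs : p ∣ suc (i + j) * binom i j
    p∣rhs with m≤n⇒m<n∨m≡n p≤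
    ... | inj₁ (s≤s p≤i+j) = ∣n⇒∣m*n (suc (i + j)) (prime∣binom i j p-prime (<-trans (n<1+n i) i<p) j<p p≤i+j)
    ... | inj₂ refl        = m∣m*n (binom i j)
  ... | inj₁ p∣suci = contradiction p∣suci (prime∤< p-prime (s≤s z≤n) i<p)
  ... | inj₂ p∣B    = p∣B

  -- Turns `∏ primePart 0 n` into the primorial of n.
  primePart : ℕ → ℕ
  primePart t with prime? t
  ... | yes _ = t
  ... | no _  = 1

  primePart-prime : ∀ {t} → Prime t → primePart t ≡ t
  primePart-prime {t} t-prime with prime? t
  ... | yes _ = refl
  ... | no ¬p = contradiction t-prime ¬p

  -- ∏ f lo k = f (lo+1) ⋯ f (lo+k)
  ∏ : (ℕ → ℕ) → ℕ → ℕ → ℕ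
  ∏ f lo zero    = 1
  ∏ f lo (suc k) = ∏ f lo k * f (suc (lo + k))

  ∏-split : ∀ f a b → ∏ f 0 (a + b) ≡ ∏ f 0 a * ∏ f a b
  ∏-split f a zero    = trans (cong (∏ f 0) (+-identityʳ a)) (sym (*-identityʳ _))
  ∏-split f a (suc b) = trans (cong (∏ f 0) (+-suc a b))
    (trans (cong (_* f (suc (a + b))) (∏-split f a b)) (*-assoc (∏ f 0 a) (∏ f a b) (f (suc (a + b)))))

  ∣∏ : ∀ f {t} n → 1 ≤ t → t ≤ n → f t ∣ ∏ f 0 n
  ∣∏ f {suc t} (suc n) 1≤t (s≤s t≤n) with m≤n⇒m<n∨m≡n t≤n
  ... | inj₁ t<n  = ∣m⇒∣m*n (f (suc n)) (∣∏ f n (s≤s z≤n) t<n)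
  ... | inj₂ refl = n∣m*n (∏ f 0 n)

  ∏≤ : ∀ f n {x} → (∀ t → f t ≤ x) → ∏ f 0 n ≤ x ^ n
  ∏≤ f zero    f≤x = ≤-refl
  ∏≤ f (suc n) {x} f≤x = subst (∏ f 0 (suc n) ≤_) (*-comm (x ^ n) x) (*-mono-≤ (∏≤ f n f≤x) (f≤x (suc n)))

  1≤∏ : ∀ f n → (∀ t → 1 ≤ f t) → 1 ≤ ∏ f 0 n
  1≤∏ f zero    1≤f = ≤-refl
  1≤∏ f (suc n) 1≤f = *-mono-≤ (1≤∏ f n 1≤f) (1≤f (suc n))

  1≤primePart : ∀ t → 1 ≤ primePart t
  1≤primePart t with prime? t
  ... | yes t-prime = ℕ.>-nonZero⁻¹ t {{prime⇒nonZero t-prime}}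
  ... | no _        = ≤-refl

  primes∣ : ∀ {N} lo k → (∀ p → Prime p → lo < p → p ≤ lo + k → p ∣ N) → ∏ primePart lo k ∣ N
  primes∣ lo zero _ = 1∣ _
  primes∣ {N} lo (suc k) all with primes∣ lo k (λ p pp lo<p p≤ → all p pp lo<p (≤-trans p≤ (+-monoʳ-≤ lo (n≤1+n k)))) | prime? (suc (lo + k))
  ... | ∏∣N | no _ = subst (_∣ N) (sym (*-identityʳ _)) ∏∣N
  ... | divides c refl | yes p-prime with euclidsLemma c (∏ primePart lo k) p-prime
    (all _ p-prime (s≤s (m≤m+n lo k)) (≤-reflexive (sym (+-suc lo k))))
  ...   | inj₁ (divides c′ refl) = divides c′ (solve 3 (λ c p x → c :* p :* x := c :* (x :* p)) refl c′ (suc (lo + k)) (∏ primePart lo k))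
    where open +-*-Solver
  ...   | inj₂ p∣∏ = contradiction p∣∏ (∤∏ k ≤-refl)
    where
    ∤∏ : ∀ j → j ≤ k → ¬ suc (lo + k) ∣ ∏ primePart lo j
    ∤∏ zero    _   p∣1 = ¬prime[1] (subst Prime (∣1⇒≡1 p∣1) p-prime)
    ∤∏ (suc j) j<k p∣ with euclidsLemma (∏ primePart lo j) (primePart (suc (lo + j))) p-prime p∣
    ... | inj₁ p∣∏ = ∤∏ j (<⇒≤ j<k) p∣∏
    ... | inj₂ p∣t with prime? (suc (lo + j))
    ...   | yes _ = prime∤< p-prime (s≤s z≤n) (s≤s (+-monoʳ-< lo j<k)) p∣t
    ...   | no _  = ¬prime[1] (subst Prime (∣1⇒≡1 p∣t) p-prime)

  -- Doubling: all primes in (y, 2y] divide the central binomial coefficient, which is at most 4^y.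
  -- Powers of two suffice because intervals will end at powers of 4.
  primorial≤ : ∀ j → ∏ primePart 0 (2 ^ j) ≤ 4 ^ (2 ^ j)
  primorial≤ zero    = s≤s z≤n
  primorial≤ (suc j) = begin
    ∏ primePart 0 (y + (y + 0))                ≡⟨ cong (λ t → ∏ primePart 0 (y + t)) (+-identityʳ y) ⟩
    ∏ primePart 0 (y + y)                      ≡⟨ ∏-split primePart y y ⟩
    ∏ primePart 0 y * ∏ primePart y y          ≤⟨ *-mono-≤ (primorial≤ j) (≤-trans (∣⇒≤ {{binom≢0 y y}} (primes∣ y y
                                                    (λ p pp y<p p≤ → prime∣binom y y pp y<p y<p p≤))) (binom≤2^ y y)) ⟩
    4 ^ y * 2 ^ (y + y)                        ≡⟨ cong (λ t → 4 ^ y * 2 ^ t) (cong (y +_) (sym (+-identityʳ y))) ⟩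
    4 ^ y * 2 ^ (2 * y)                        ≡⟨ cong (4 ^ y *_) (sym (^-*-assoc 2 2 y)) ⟩
    4 ^ y * 4 ^ y                              ≡⟨ ^-distribˡ-+-* 4 y y ⟨
    4 ^ (y + y)                                ≡⟨ cong (λ t → 4 ^ (y + t)) (sym (+-identityʳ y)) ⟩
    4 ^ (y + (y + 0))                          ∎
    where
    open ≤-Reasoning
    y = 2 ^ j
    binom≢0 : ∀ i j → NonZero (binom i j)
    binom≢0 zero    j       = _
    binom≢0 (suc i) zero    = _
    binom≢0 (suc i) (suc j) = ℕ.>-nonZero (<-≤-trans (ℕ.>-nonZero⁻¹ _ {{binom≢0 i (suc j)}}) (m≤m+n _ _))

  primePower∣cofactor : ∀ {p t} → Prime p → ¬ p ∣ t → ∀ v c → p ^ v ∣ t * c → p ^ v ∣ c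
  primePower∣cofactor p-prime p∤t zero    c _ = 1∣ c
  primePower∣cofactor {p} {t} p-prime p∤t (suc v) c pᵛ∣ with euclidsLemma t c p-prime (∣-trans (m∣m*n (p ^ v)) pᵛ∣)
  ... | inj₁ p∣t = contradiction p∣t p∤t
  ... | inj₂ (divides c′ refl) = subst (p * p ^ v ∣_) (*-comm p c′) (*-monoʳ-∣ p (primePower∣cofactor p-prime p∤t v c′
    (*-cancelˡ-∣ p {{prime⇒nonZero p-prime}} (subst (p * p ^ v ∣_) (solve 3 (λ t c p → t :* (c :* p) := p :* (t :* c)) refl t c′ p) pᵛ∣))))
    where open +-*-Solver

  prime-divisor : ∀ t → 2 ≤ t → ∃ λ p → Prime p × p ∣ t
  prime-divisor t@(suc _) 2≤t with factorise t
  ... | record { factors = [] ; isFactorisation = t≡1 } = contradiction (subst (2 ≤_) t≡1 2≤t) λ { (s≤s ()) }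
  ... | record { factors = p ∷ ps ; isFactorisation = t≡ ; factorsPrime = pp ∷ _ } = p , pp , subst (p ∣_) (sym t≡) (m∣m*n (product ps))

  extract : ∀ {p} → Prime p → ∀ t → 1 ≤ t → ∃ λ v → ∃ λ t′ → t ≡ p ^ v * t′ × ¬ p ∣ t′
  extract {p} p-prime = <-rec _ step
    where
    step : ∀ t → (∀ {t′} → t′ < t → 1 ≤ t′ → ∃ λ v → ∃ λ t″ → t′ ≡ p ^ v * t″ × ¬ p ∣ t″) →
           1 ≤ t → ∃ λ v → ∃ λ t′ → t ≡ p ^ v * t′ × ¬ p ∣ t′
    step t rec 1≤t with p ∣? t
    ... | no p∤t = 0 , t , sym (*-identityˡ t) , p∤t
    ... | yes (divides c@(suc _) refl) with rec (m<m*n c p (ℕ.nonTrivial⇒n>1 p {{prime⇒nonTrivial p-prime}})) (s≤s z≤n)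
    ...   | v , t′ , c≡ , p∤t′ = suc v , t′ , trans (cong (_* p) c≡) (solve 3 (λ x t p → x :* t :* p := p :* x :* t) refl (p ^ v) t′ p) , p∤t′
      where open +-*-Solver

  primePowers∣⇒∣ : ∀ {N} t → 1 ≤ t → (∀ p v → Prime p → p ^ v ∣ t → p ^ v ∣ N) → t ∣ N
  primePowers∣⇒∣ {N} = <-rec _ step
    where
    step : ∀ t → (∀ {t′} → t′ < t → 1 ≤ t′ → (∀ p v → Prime p → p ^ v ∣ t′ → p ^ v ∣ N) → t′ ∣ N) →
           1 ≤ t → (∀ p v → Prime p → p ^ v ∣ t → p ^ v ∣ N) → t ∣ N
    step t rec 1≤t all with t ℕ.≟ 1
    ... | yes refl = 1∣ N
    ... | no t≢1 with prime-divisor t (≤∧≢⇒< 1≤t (t≢1 ∘ sym))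
    ...   | p , p-prime , p∣t with extract p-prime t 1≤t
    ...     | zero , t′ , t≡ , p∤t′ = contradiction (subst (p ∣_) (trans t≡ (*-identityˡ t′)) p∣t) p∤t′
    ...     | suc v , zero , t≡ , p∤t′ = contradiction (_ ∣0) p∤t′
    ...     | suc v , t′@(suc _) , refl , p∤t′ with rec t′<t (s≤s z≤n) (λ r w r-prime rʷ∣ → all r w r-prime (∣n⇒∣m*n (p ^ suc v) rʷ∣))
      where
      t′<t : t′ < p ^ suc v * t′
      t′<t = subst (t′ <_) (*-comm t′ (p ^ suc v)) (m<m*n t′ (p ^ suc v) (<-≤-trans (ℕ.nonTrivial⇒n>1 p {{prime⇒nonTrivial p-prime}})
        (m≤m*n p (p ^ v) {{m^n≢0 p v {{prime⇒nonZero p-prime}}}})))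
    ...       | divides c refl = subst (_∣ c * t′) (*-comm t′ (p ^ suc v)) (subst (t′ * p ^ suc v ∣_) (*-comm t′ c) (*-monoʳ-∣ t′
      (primePower∣cofactor p-prime p∤t′ (suc v) c (subst (p ^ suc v ∣_) (*-comm c t′) (all p (suc v) p-prime (m∣m*n t′))))))

  -- The largest power of a prime below x; 1 at non-primes.
  maxPower : ∀ x → 1 ≤ x → ∀ p → ∃ λ w → 1 ≤ w × w ≤ x × (Prime p → ∀ v → p ^ v ≤ x → p ^ v ∣ w)
  maxPower x 1≤x p with prime? p
  ... | no ¬p = 1 , ≤-refl , 1≤x , λ p-prime → contradiction p-prime ¬p
  ... | yes p-prime = go x (λ v pᵛ≤x → <⇒≤ (<-≤-trans (v<pᵛ v) pᵛ≤x))
    where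
    1<p : 1 < p
    1<p = ℕ.nonTrivial⇒n>1 p {{prime⇒nonTrivial p-prime}}
    v<pᵛ : ∀ v → v < p ^ v
    v<pᵛ zero    = s≤s z≤n
    v<pᵛ (suc v) = ≤-<-trans (v<pᵛ v) (subst (p ^ v <_) (*-comm (p ^ v) p) (m<m*n (p ^ v) p {{m^n≢0 p v {{prime⇒nonZero p-prime}}}} 1<p))
    go : ∀ b → (∀ v → p ^ v ≤ x → v ≤ b) → ∃ λ w → 1 ≤ w × w ≤ x × (Prime p → ∀ v → p ^ v ≤ x → p ^ v ∣ w)
    go zero v≤ = 1 , ≤-refl , 1≤x , λ _ v pᵛ≤x → subst (λ v → p ^ v ∣ 1) (sym (n≤0⇒n≡0 (v≤ v pᵛ≤x))) ∣-refl
    go (suc b) v≤ with p ^ suc b ℕ.≤? x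
    ... | yes pᵇ≤x = p ^ suc b , m^n>0 p {{prime⇒nonZero p-prime}} (suc b) , pᵇ≤x , λ _ v pᵛ≤x → m≤n⇒m^n∣ (v≤ v pᵛ≤x)
      where
      m≤n⇒m^n∣ : ∀ {v w} → v ≤ w → p ^ v ∣ p ^ w
      m≤n⇒m^n∣ {v} v≤w with m≤n⇒∃[o]m+o≡n v≤w
      ... | o , refl = subst (p ^ v ∣_) (sym (^-distribˡ-+-* p v o)) (m∣m*n (p ^ o))
    ... | no pᵇ≰x = go b λ v pᵛ≤x → ≤-pred (≤∧≢⇒< (v≤ v pᵛ≤x) (λ { refl → pᵇ≰x pᵛ≤x }))

  -- A prime up to `r` contributes its largest power, at most `x`. The square of a larger prime
  -- exceeds `x`, so it occurs at most once and is accounted for by the primorial of `y`.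
  common-multiple : ∀ x r y → 1 ≤ x → x < suc r * suc r → (∀ p → Prime p → p ≤ x → p ≤ y) →
    ∃ λ N → N ≤ x ^ r * ∏ primePart 0 y × 1 ≤ N × (∀ t → 1 ≤ t → t ≤ x → t ∣ N)
  common-multiple x r y 1≤x x<r² small = N , *-monoˡ-≤ (∏ primePart 0 y) (∏≤ w r w≤x) , N≥1 , λ t 1≤t t≤x → primePowers∣⇒∣ t 1≤t (divides-N t 1≤t t≤x)
    where
    w : ℕ → ℕ
    w p = proj₁ (maxPower x 1≤x p)
    w≤x : ∀ p → w p ≤ x
    w≤x p = proj₁ (proj₂ (proj₂ (maxPower x 1≤x p)))
    N : ℕ
    N = ∏ w 0 r * ∏ primePart 0 y
    divides-N : ∀ t → 1 ≤ t → t ≤ x → ∀ p v → Prime p → p ^ v ∣ t → p ^ v ∣ N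
    divides-N t@(suc _) 1≤t t≤x p v p-prime pᵛ∣t with p ℕ.≤? r
    ... | yes p≤r = ∣m⇒∣m*n _ (∣-trans (proj₂ (proj₂ (proj₂ (maxPower x 1≤x p))) p-prime v (≤-trans (∣⇒≤ pᵛ∣t) t≤x))
                      (∣∏ w r (ℕ.>-nonZero⁻¹ p {{prime⇒nonZero p-prime}}) p≤r))
    ... | no p≰r with v
    ...   | zero = 1∣ _
    ...   | suc zero = ∣n⇒∣m*n (∏ w 0 r) (subst (_∣ ∏ primePart 0 y) (trans (primePart-prime p-prime) (sym (*-identityʳ p)))
                         (∣∏ primePart y (ℕ.>-nonZero⁻¹ p {{prime⇒nonZero p-prime}})
                           (small p p-prime (≤-trans (∣⇒≤ (subst (_∣ t) (*-identityʳ p) pᵛ∣t)) t≤x))))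
    ...   | suc (suc v′) = contradiction (≤-trans (∣⇒≤ (∣-trans (subst (_∣ p ^ suc (suc v′)) refl
                             (*-monoʳ-∣ p (m∣m*n (p ^ v′)))) pᵛ∣t)) t≤x)
                           (<⇒≱ (<-≤-trans x<r² (*-mono-≤ (≰⇒> p≰r) (≰⇒> p≰r))))
    N≥1 : 1 ≤ N
    N≥1 = *-mono-≤ (1≤∏ w r (λ p → proj₁ (proj₂ (maxPower x 1≤x p)))) (1≤∏ primePart y 1≤primePart)

  linear≤exponential : ∀ {j} → 4 ≤ j → suc (2 * suc j) ≤ 2 ^ j
  linear≤exponential 4≤j with m≤n⇒∃[o]m+o≡n 4≤j
  ... | o , refl = go o
    where
    go : ∀ i → suc (2 * (5 + i)) ≤ 2 ^ (4 + i)
    go zero    = m≤m+n 11 5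
    go (suc i) = begin
      suc (2 * (6 + i))              ≡⟨ solve 1 (λ i → con 1 :+ con 2 :* (con 6 :+ i) := con 2 :+ (con 1 :+ con 2 :* (con 5 :+ i))) refl i ⟩
      2 + suc (2 * (5 + i))          ≤⟨ +-mono-≤ (≤-trans (s≤s (s≤s z≤n)) (go i)) (go i) ⟩
      2 ^ (4 + i) + 2 ^ (4 + i)      ≡⟨ cong (2 ^ (4 + i) +_) (sym (+-identityʳ _)) ⟩
      2 ^ (5 + i)                    ∎
      where open ≤-Reasoning
            open +-*-Solver

  -- Let y = 4ʲ, x = 4y and r = √x. Without primes in (y, x] some common multiple of 1, ..., x is at
  -- most xʳ·4^y, while `4^n≤leibniz` makes it at least 4^(2y-1). For j ≥ 4 the factor xʳ is too
  -- small to bridge the gap.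
  prime-in-range : ∀ j → 4 ≤ j → ∃ λ p → Prime p × 4 ^ j < p × p ≤ 4 ^ suc j
  prime-in-range j 4≤j with Finₚ.any? {suc (4 ^ suc j)} (λ p → prime? (toℕ p) ×-dec (4 ^ j ℕ.<? toℕ p))
  ... | yes (p , p-prime , y<p) = toℕ p , p-prime , y<p , ≤-pred (Finₚ.toℕ<n p)
  ... | no none = contradiction (^-cancelʳ chain) (<⇒≱ too-big)
    where
    i x y r n : ℕ
    i = suc j
    x = 4 ^ i
    y = 4 ^ j
    r = 2 ^ i
    -- So that 2n+1 = 4y-1 is still at most `x`.
    n = ℕ.pred (2 * y)
    1≤y : 1 ≤ y
    1≤y = m^n>0 4 j
    small : ∀ p → Prime p → p ≤ x → p ≤ y
    small p p-prime p≤x with p ℕ.≤? y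
    ... | yes p≤y = p≤y
    ... | no p≰y = contradiction (fromℕ< (s≤s p≤x) , subst Prime (sym (Finₚ.toℕ-fromℕ< (s≤s p≤x))) p-prime ,
                     subst (y <_) (sym (Finₚ.toℕ-fromℕ< (s≤s p≤x))) (≰⇒> p≰y)) none
    r²≡x : r * r ≡ x
    r²≡x = trans (sym (^-distribˡ-+-* 2 i i)) (trans (cong (2 ^_) (cong (i +_) (sym (+-identityʳ i)))) (sym (^-*-assoc 2 2 i)))
    cm = common-multiple x r y (m^n>0 4 i) (subst (_< suc r * suc r) r²≡x (*-mono-< (n<1+n r) (n<1+n r))) small
    N = proj₁ cm
    sucn≡ : suc n ≡ 2 * y
    sucn≡ = suc-pred (2 * y) {{m*n≢0 2 y {{_}} {{ℕ.>-nonZero 1≤y}}}}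
    2n+1≤x : suc (n + n) ≤ x
    2n+1≤x = ≤-trans (≤-trans (n≤1+n _) (≤-reflexive (cong suc (sym (+-suc n n))))) (≤-reflexive (trans (cong₂ _+_ sucn≡ sucn≡)
      (solve 1 (λ y → con 2 :* y :+ con 2 :* y := con 4 :* y) refl y)))
      where open +-*-Solver
    4^y≡ : 4 ^ y ≡ 2 ^ (2 * y)
    4^y≡ = ^-*-assoc 2 2 y
    4ⁿ≤N : 4 ^ n ≤ N
    4ⁿ≤N = ≤-trans (4^n≤leibniz n) (∣⇒≤ {{ℕ.>-nonZero (proj₁ (proj₂ (proj₂ cm)))}}
      (leibniz-∣ n n (λ t 1≤t t≤ → proj₂ (proj₂ (proj₂ cm)) t 1≤t (≤-trans t≤ 2n+1≤x))))
    primorial-y : ∏ primePart 0 y ≤ 2 ^ (2 * y)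
    primorial-y = subst₂ _≤_ (cong (∏ primePart 0) (sym y≡)) (trans (cong (4 ^_) (sym y≡)) 4^y≡) (primorial≤ (2 * j))
      where y≡ : y ≡ 2 ^ (2 * j)
            y≡ = ^-*-assoc 2 2 j
    chain : 2 ^ (2 * n) ≤ 2 ^ (2 * i * r + 2 * y)
    chain = begin
      2 ^ (2 * n)                          ≡⟨ ^-*-assoc 2 2 n ⟨
      4 ^ n                                ≤⟨ 4ⁿ≤N ⟩
      N                                    ≤⟨ proj₁ (proj₂ cm) ⟩
      x ^ r * ∏ primePart 0 y              ≤⟨ *-monoʳ-≤ (x ^ r) primorial-y ⟩
      x ^ r * 2 ^ (2 * y)                  ≡⟨ cong (λ t → t ^ r * 2 ^ (2 * y)) (^-*-assoc 2 2 i) ⟩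
      (2 ^ (2 * i)) ^ r * 2 ^ (2 * y)      ≡⟨ cong (_* 2 ^ (2 * y)) (^-*-assoc 2 (2 * i) r) ⟩
      2 ^ (2 * i * r) * 2 ^ (2 * y)        ≡⟨ ^-distribˡ-+-* 2 (2 * i * r) (2 * y) ⟨
      2 ^ (2 * i * r + 2 * y)              ∎
      where open ≤-Reasoning
    ^-cancelʳ : ∀ {a b} → 2 ^ a ≤ 2 ^ b → a ≤ b
    ^-cancelʳ {a} {b} 2ᵃ≤2ᵇ with a ℕ.≤? b
    ... | yes a≤b = a≤b
    ... | no a≰b  = contradiction 2ᵃ≤2ᵇ (<⇒≱ (^-monoʳ-< 2 (s≤s (s≤s z≤n)) (≰⇒> a≰b)))
    r*half : r * 2 ^ j ≡ 2 * y
    r*half = *-cancelˡ-≡ (r * 2 ^ j) (2 * y) 2 (trans (solve 2 (λ r h → con 2 :* (r :* h) := r :* (con 2 :* h)) refl r (2 ^ j))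
      (trans r²≡x (solve 1 (λ y → con 4 :* y := con 2 :* (con 2 :* y)) refl y)))
      where open +-*-Solver
    too-big : 2 * i * r + 2 * y < 2 * n
    too-big = +-cancelʳ-< 2 _ _ (begin-strict
      2 * i * r + 2 * y + 2                ≡⟨ solve 2 (λ a y → a :+ con 2 :* y :+ con 2 := a :+ con 2 :+ con 2 :* y) refl (2 * i * r) y ⟩
      2 * i * r + 2 + 2 * y                <⟨ +-monoˡ-< (2 * y) (+-monoʳ-< (2 * i * r) 2<r) ⟩
      2 * i * r + r + 2 * y                ≡⟨ cong (_+ 2 * y) (solve 2 (λ i r → con 2 :* i :* r :+ r := r :* (con 1 :+ con 2 :* i)) refl i r) ⟩
      r * suc (2 * i) + 2 * y              ≤⟨ +-monoˡ-≤ (2 * y) (*-monoʳ-≤ r (linear≤exponential 4≤j)) ⟩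
      r * 2 ^ j + 2 * y                    ≡⟨ cong (_+ 2 * y) r*half ⟩
      2 * y + 2 * y                        ≡⟨ cong₂ _+_ (sym sucn≡) (sym sucn≡) ⟩
      suc n + suc n                        ≡⟨ solve 1 (λ n → con 1 :+ n :+ (con 1 :+ n) := con 2 :* n :+ con 2) refl n ⟩
      2 * n + 2                            ∎)
      where
      open ≤-Reasoning
      open +-*-Solver
      2<r : 2 < r
      2<r = <-≤-trans (s≤s (s≤s (s≤s z≤n))) (^-monoʳ-≤ 2 {2} {i} (≤-trans (s≤s (s≤s z≤n)) (s≤s 4≤j)))

  log₄ : ∀ q → 1 ≤ q → ∃ λ j → q ≤ 4 ^ j × 4 ^ j ≤ 4 * q
  log₄ (suc zero) _ = 0 , ≤-refl , s≤s z≤n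
  log₄ (suc (suc q)) _ with log₄ (suc q) (s≤s z≤n)
  ... | j , q≤ , ≤4q with suc (suc q) ℕ.≤? 4 ^ j
  ...   | yes sq≤ = j , sq≤ , ≤-trans ≤4q (*-monoʳ-≤ 4 (n≤1+n (suc q)))
  ...   | no sq≰  = suc j , ≤-trans (≤-trans (s≤s q≤) (+-monoˡ-≤ (4 ^ j) (m^n>0 4 j))) (+-monoʳ-≤ (4 ^ j) (m≤m+n (4 ^ j) (2 * 4 ^ j))) ,
          *-monoʳ-≤ 4 (≤-trans (≤-pred (≰⇒> sq≰)) (n≤1+n (suc q)))

  -- Raising q to a power of 4 costs one factor 4, the interval above that power another. The bound
  -- 65 = 4³+1 forces the exponent to be at least 4.
  prime-near : ∀ q → 65 ≤ q → ∃ λ P → Prime P × q ≤ P × P ≤ 16 * q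
  prime-near q 65≤q with log₄ q (≤-trans (s≤s z≤n) 65≤q)
  ... | j , q≤4ʲ , 4ʲ≤4q with prime-in-range j 4≤j
    where
    4≤j : 4 ≤ j
    4≤j with 4 ℕ.≤? j
    ... | yes 4≤j = 4≤j
    ... | no 4≰j  = contradiction (≤-trans q≤4ʲ (^-monoʳ-≤ 4 {j} {3} (≤-pred (≰⇒> 4≰j)))) (<⇒≱ 65≤q)
  ... | P , P-prime , y<P , P≤x = P , P-prime , ≤-trans q≤4ʲ (<⇒≤ y<P) ,
        ≤-trans P≤x (≤-trans (*-monoʳ-≤ 4 4ʲ≤4q) (≤-reflexive (sym (*-assoc 4 4 q))))

-- From rational exponents to integer parameters, and the choice of constants

open import Data.Integer using (+_)
import Data.Integer as ℤ
import Data.Integer.Properties as ℤₚ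
open import Data.Nat using (_+_; _*_)
open import Data.Rational using (ℚ; _/_; toℚᵘ) renaming (_≤_ to _≤ℚ_; _*_ to _*ℚ_)
import Data.Rational.Properties as ℚₚ
open import Data.Rational.Unnormalised using (mkℚᵘ; _≃_)
import Data.Rational.Unnormalised as ℚᵘ
import Data.Rational.Unnormalised.Properties as ℚᵘₚ

toℚᵘ-/-*-/ : ∀ n d m → toℚᵘ ((n / suc d) *ℚ (m / 1)) ≃ mkℚᵘ n d ℚᵘ.* mkℚᵘ m 0
toℚᵘ-/-*-/ n d m = ℚᵘₚ.≃-trans (ℚₚ.toℚᵘ-homo-* (n / suc d) (m / 1))
  (ℚᵘₚ.*-cong (ℚₚ.toℚᵘ-fromℚᵘ (mkℚᵘ n d)) (ℚₚ.toℚᵘ-fromℚᵘ (mkℚᵘ m 0)))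

DivInt⇒multiple : ∀ {d n} → DivInt d (+ n / 1) → ∃ λ r → n ≡ d * r
DivInt⇒multiple {d} {n} (z , eq) = ℤ.∣ z ∣ , trans (cong ℤ.∣_∣ n≡dz) (ℤₚ.abs-* (+ d) z)
  where
  equiv : mkℚᵘ (+ n) 0 ≃ mkℚᵘ (+ d) 0 ℚᵘ.* mkℚᵘ z 0
  equiv = ℚᵘₚ.≃-trans (ℚᵘₚ.≃-sym (ℚₚ.toℚᵘ-fromℚᵘ (mkℚᵘ (+ n) 0)))
    (ℚᵘₚ.≃-trans (ℚₚ.toℚᵘ-cong eq) (toℚᵘ-/-*-/ (+ d) 0 z))
  n≡dz : + n ≡ + d ℤ.* z
  n≡dz = trans (sym (ℤₚ.*-identityʳ (+ n))) (trans (ℚᵘₚ.drop-*≡* equiv) (ℤₚ.*-identityʳ (+ d ℤ.* z)))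

fraction-≤ : ∀ p d ℓ a → ((+ p / suc d) *ℚ (+ ℓ / 1)) ≤ℚ (+ a / 1) → p * ℓ ≤ a * suc d
fraction-≤ p d ℓ a le = subst₂ _≤_ (ℕₚ.*-identityʳ (p * ℓ)) (cong (a *_) (ℕₚ.*-identityʳ (suc d)))
  (ℤₚ.drop‿+≤+ (subst₂ ℤ._≤_ lhs rhs (ℚᵘₚ.drop-*≤* ineq)))
  where
  ineq : mkℚᵘ (+ p) d ℚᵘ.* mkℚᵘ (+ ℓ) 0 ℚᵘ.≤ mkℚᵘ (+ a) 0
  ineq = ℚᵘₚ.≤-respˡ-≃ (toℚᵘ-/-*-/ (+ p) d (+ ℓ)) (ℚᵘₚ.≤-respʳ-≃ (ℚₚ.toℚᵘ-fromℚᵘ (mkℚᵘ (+ a) 0)) (ℚₚ.toℚᵘ-mono-≤ le))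
  lhs : + p ℤ.* + ℓ ℤ.* + 1 ≡ + (p * ℓ * 1)
  lhs = trans (cong (ℤ._* + 1) (sym (ℤₚ.pos-* p ℓ))) (sym (ℤₚ.pos-* (p * ℓ) 1))
  rhs : + a ℤ.* + (suc d * 1) ≡ + (a * (suc d * 1))
  rhs = sym (ℤₚ.pos-* a (suc d * 1))

fraction-≥ : ∀ ℓ a → (+ a / 1) ≤ℚ ((+ 1 / 1) *ℚ (+ ℓ / 1)) → a ≤ ℓ
fraction-≥ ℓ a le = subst₂ _≤_ (ℕₚ.*-identityʳ a) (trans (ℕₚ.*-identityʳ _) (ℕₚ.*-identityˡ ℓ))
  (ℤₚ.drop‿+≤+ (subst₂ ℤ._≤_ (sym (ℤₚ.pos-* a 1)) (trans (cong (ℤ._* + 1) (sym (ℤₚ.pos-* 1 ℓ))) (sym (ℤₚ.pos-* (1 * ℓ) 1)))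
    (ℚᵘₚ.drop-*≤* ineq)))
  where
  ineq : mkℚᵘ (+ a) 0 ℚᵘ.≤ mkℚᵘ (+ 1) 0 ℚᵘ.* mkℚᵘ (+ ℓ) 0
  ineq = ℚᵘₚ.≤-respˡ-≃ (ℚₚ.toℚᵘ-fromℚᵘ (mkℚᵘ (+ a) 0)) (ℚᵘₚ.≤-respʳ-≃ (toℚᵘ-/-*-/ (+ 1) 0 (+ ℓ)) (ℚₚ.toℚᵘ-mono-≤ le))

-- There are q^(a+ℓ)·K₀ events, with K₀ independent of q. Since q ≤ P, the power P^(a+ℓ) pays for
-- the pairs of ends, and the last factor of P^J, with J = a+ℓ+1, pays for K₀; this is why `q₀`
-- exceeds `K₀`.
random-algebraic-graph : (Λ : Layout) → let open Layout Λ in 1 ≤ k′ →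
  ∃[ s₀ ] ∃[ q₀ ] ((s q : ℕ) → s₀ ≤ s → q₀ ≤ q →
    Σ (Fin (q ^ a) → Fin (q ^ ℓ) → Bool) λ E →
      FreeOf (Theta s (suc (k′ + k′))) (BipGraph (q ^ a) (q ^ ℓ) E) × q ^ (A + ℓ) ≤ edges (q ^ a) (q ^ ℓ) E)
random-algebraic-graph Λ 1≤k′ = familyBound 16 n Δ J , 65 + suc K₀ , construct
  where
  open Layout Λ
  n J Δ K₀ : ℕ
  n  = L * m
  J  = suc (a + ℓ)
  Δ  = suc (J * L + J * L)
  K₀ = 16 ^ n * (2 ^ n * n)
  module _ {q P : ℕ} (q₀≤q : 65 + suc K₀ ≤ q) (P-prime : Prime P) (q≤P : q ≤ P) (P≤16q : P ≤ 16 * q) where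
    q≢0 : NonZero q
    q≢0 = ℕ.>-nonZero (ℕₚ.≤-trans (s≤s z≤n) q₀≤q)
    K₀<P : K₀ < P
    K₀<P = ℕₚ.≤-trans (ℕₚ.≤-trans (ℕₚ.m≤n+m (suc K₀) 65) q₀≤q) q≤P
    few-colours : q ^ a * (q ^ ℓ * K₀) < P ^ J
    few-colours = begin-strict
      q ^ a * (q ^ ℓ * K₀)      ≡⟨ sym (ℕₚ.*-assoc (q ^ a) (q ^ ℓ) K₀) ⟩
      q ^ a * q ^ ℓ * K₀        ≡⟨ cong (_* K₀) (sym (ℕₚ.^-distribˡ-+-* q a ℓ)) ⟩
      q ^ (a + ℓ) * K₀          ≤⟨ ℕₚ.*-monoˡ-≤ K₀ (ℕₚ.^-monoˡ-≤ (a + ℓ) q≤P) ⟩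
      P ^ (a + ℓ) * K₀          <⟨ ℕₚ.*-monoʳ-< (P ^ (a + ℓ)) {{Pᵃ⁺ˡ≢0}} K₀<P ⟩
      P ^ (a + ℓ) * P           ≡⟨ ℕₚ.*-comm (P ^ (a + ℓ)) P ⟩
      P ^ J                     ∎
      where
      open ℕₚ.≤-Reasoning
      Pᵃ⁺ˡ≢0 : NonZero (P ^ (a + ℓ))
      Pᵃ⁺ˡ≢0 = ℕₚ.m^n≢0 P (a + ℓ) {{ℕ.>-nonZero (ℕₚ.≤-<-trans z≤n K₀<P)}}
    modP : Rounding (ModularField.finiteField P-prime) q 16
    modP = ModularField.rounding P-prime 16 q≢0 q≤P P≤16q
  construct : ∀ s q → familyBound 16 n Δ J ≤ s → 65 + suc K₀ ≤ q → _
  construct s q s₀≤s q₀≤q =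
    let P , P-prime , q≤P , P≤16q = PrimesInIntervals.prime-near q (ℕₚ.≤-trans (ℕₚ.m≤m+n 65 (suc K₀)) q₀≤q) in
    ThetaPaths.exists-theta-free (modP q₀≤q P-prime q≤P P≤16q) Λ J (few-colours q₀≤q P-prime q≤P P≤16q) 1≤k′ s₀≤s

-- Here r = ℓ/(2k-1), t = αℓ/(2k-1) and e₀ = r+t. The lower bound on α makes the truncated
-- subtraction in `A` a true one, and α ≤ 1 gives m ≤ ℓ. The required inequality holds because both
-- (Lt+ℓ)·k and (A+ℓ)·L equal L·e₀·k.
theta-free-graphs : ∀ k′ r t → 1 ≤ k′ → k′ * r ≤ suc k′ * t → t ≤ r → let L = suc (k′ + k′) in
  ∃[ s₀ ] ∃[ q₀ ] ((s q : ℕ) → s₀ ≤ s → q₀ ≤ q →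
    Σ (Fin (q ^ (L * t)) → Fin (q ^ (L * r)) → Bool) λ E →
      FreeOf (Theta s L) (BipGraph (q ^ (L * t)) (q ^ (L * r)) E) ×
      (q ^ (L * t) * q ^ (L * r)) ^ suc k′ ≤ (2 * edges (q ^ (L * t)) (q ^ (L * r)) E) ^ L)
theta-free-graphs k′ r t 1≤k′ k′r≤kt t≤r = proj₁ built , proj₁ (proj₂ built) , λ s q s₀≤s q₀≤q →
  finish s q (subst (Graphs s q) A+m≡Lt (proj₂ (proj₂ built) s q s₀≤s q₀≤q))
  where
  open +-*-Solver
  L ℓ e₀ m A : ℕ
  L  = suc (k′ + k′)
  ℓ  = L * r
  e₀ = r + t
  m  = k′ * e₀
  A  = suc k′ * t ∸ k′ * r
  m≤ℓ : m ≤ ℓ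
  m≤ℓ = begin
    k′ * (r + t)          ≤⟨ ℕₚ.*-monoʳ-≤ k′ (ℕₚ.+-monoʳ-≤ r t≤r) ⟩
    k′ * (r + r)          ≤⟨ ℕₚ.m≤n+m _ r ⟩
    r + k′ * (r + r)      ≡⟨ solve 2 (λ k r → r :+ k :* (r :+ r) := (con 1 :+ (k :+ k)) :* r) refl k′ r ⟩
    L * r                 ∎
    where open ℕₚ.≤-Reasoning
  A+ℓ≡ : A + ℓ ≡ suc k′ * e₀
  A+ℓ≡ = begin
    A + L * r                          ≡⟨ cong (A ℕ.+_) (solve 2 (λ k r → (con 1 :+ (k :+ k)) :* r := k :* r :+ (con 1 :+ k) :* r) refl k′ r) ⟩
    A + (k′ * r + suc k′ * r)          ≡⟨ sym (ℕₚ.+-assoc A (k′ * r) (suc k′ * r)) ⟩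
    A + k′ * r + suc k′ * r            ≡⟨ cong (_+ suc k′ * r) (ℕₚ.m∸n+n≡m k′r≤kt) ⟩
    suc k′ * t + suc k′ * r            ≡⟨ solve 3 (λ k t r → k :* t :+ k :* r := k :* (r :+ t)) refl (suc k′) t r ⟩
    suc k′ * e₀                        ∎
    where open ≡-Reasoning
  Lt+ℓ≡ : L * t + ℓ ≡ L * e₀
  Lt+ℓ≡ = solve 3 (λ l t r → l :* t :+ l :* r := l :* (r :+ t)) refl L t r
  A+m≡Lt : A + m ≡ L * t
  A+m≡Lt = ℕₚ.+-cancelʳ-≡ ℓ (A + m) (L * t) (begin
    A + m + ℓ                          ≡⟨ solve 3 (λ a m l → a :+ m :+ l := a :+ l :+ m) refl A m ℓ ⟩
    A + ℓ + m                          ≡⟨ cong (_+ m) A+ℓ≡ ⟩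
    suc k′ * e₀ + k′ * e₀              ≡⟨ solve 2 (λ k e → (con 1 :+ k) :* e :+ k :* e := (con 1 :+ (k :+ k)) :* e) refl k′ e₀ ⟩
    L * e₀                             ≡⟨ sym Lt+ℓ≡ ⟩
    L * t + ℓ                          ∎)
    where open ≡-Reasoning
  Graphs : ℕ → ℕ → ℕ → Set
  Graphs s q a = Σ (Fin (q ^ a) → Fin (q ^ ℓ) → Bool) λ E →
    FreeOf (Theta s L) (BipGraph (q ^ a) (q ^ ℓ) E) × q ^ (A + ℓ) ≤ edges (q ^ a) (q ^ ℓ) E
  built = random-algebraic-graph (BlockLayout.layout k′ e₀ A ℓ m≤ℓ A+ℓ≡) 1≤k′
  finish : ∀ s q → Graphs s q (L * t) → _
  finish s q (E , free , many) = E , free , (begin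
    (q ^ (L * t) * q ^ ℓ) ^ suc k′            ≡⟨ cong (_^ suc k′) (sym (ℕₚ.^-distribˡ-+-* q (L * t) ℓ)) ⟩
    (q ^ (L * t + ℓ)) ^ suc k′                ≡⟨ ℕₚ.^-*-assoc q (L * t + ℓ) (suc k′) ⟩
    q ^ ((L * t + ℓ) * suc k′)                ≡⟨ cong (q ^_) exponent ⟩
    q ^ ((A + ℓ) * L)                         ≡⟨ sym (ℕₚ.^-*-assoc q (A + ℓ) L) ⟩
    (q ^ (A + ℓ)) ^ L                         ≤⟨ ℕₚ.^-monoˡ-≤ L (ℕₚ.≤-trans many (ℕₚ.m≤m+n _ _)) ⟩
    (2 * edges (q ^ (L * t)) (q ^ ℓ) E) ^ L   ∎)
    where
    open ℕₚ.≤-Reasoning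
    exponent : (L * t + ℓ) * suc k′ ≡ (A + ℓ) * L
    exponent = trans (cong (_* suc k′) Lt+ℓ≡) (trans (solve 3 (λ l e k → l :* e :* k := k :* e :* l) refl L e₀ (suc k′))
      (cong (_* L) (sym A+ℓ≡)))

theorem5p6 : (k : ℕ) → .{{_ : NonZero k}} → 2 ≤ k → (α : ℚ) →
    (+ (k ∸ 1) / k) ≤ℚ α → α ≤ℚ (+ 1 / 1) →
    (ℓ a : ℕ) → IsLeastL k α ℓ → α *ℚ (+ ℓ / 1) ≡ (+ a / 1) →
    ∃[ s₀ ] ∃[ q₀ ] ((s q : ℕ) → s₀ ≤ s → q₀ ≤ q → IsPrimePower q →
    Σ (Fin (q ^ a) → Fin (q ^ ℓ) → Bool) λ E →
    FreeOf (Theta s (2 * k ∸ 1)) (BipGraph (q ^ a) (q ^ ℓ) E) ×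
    (q ^ a * q ^ ℓ) ^ k ≤ (2 * edges (q ^ a) (q ^ ℓ) E) ^ (2 * k ∸ 1))
theorem5p6 (suc k′) (s≤s 1≤k′) α k′/k≤α α≤1 ℓ a ((_ , ℓ-div , αℓ-div) , _) αℓ≡a =
  let s₀ , q₀ , construct = subst₂ Conclusion (sym a≡Lt) (sym ℓ≡Lr) (subst (Conclusion₀ (L * t) (L * r)) (sym 2k-1≡L)
                              (theta-free-graphs k′ r t 1≤k′ k′r≤kt t≤r)) in
  s₀ , q₀ , λ s q s₀≤s q₀≤q _ → construct s q s₀≤s q₀≤q
  where
  open +-*-Solver
  L r t : ℕ
  L = suc (k′ + k′)
  Conclusion₀ : ℕ → ℕ → ℕ → Set
  Conclusion₀ a ℓ L = ∃[ s₀ ] ∃[ q₀ ] ((s q : ℕ) → s₀ ≤ s → q₀ ≤ q →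
    Σ (Fin (q ^ a) → Fin (q ^ ℓ) → Bool) λ E → FreeOf (Theta s L) (BipGraph (q ^ a) (q ^ ℓ) E) ×
      (q ^ a * q ^ ℓ) ^ suc k′ ≤ (2 * edges (q ^ a) (q ^ ℓ) E) ^ L)
  Conclusion : ℕ → ℕ → Set
  Conclusion a ℓ = Conclusion₀ a ℓ (2 * suc k′ ∸ 1)
  -- The two integrality conditions supply r and t; the bounds on α become (k-1)·ℓ ≤ k·a and a ≤ ℓ
  -- after multiplication by ℓ, and the common factor 2k-1 is then cancelled.
  r,ℓ≡ = DivInt⇒multiple {2 * suc k′ ∸ 1} {ℓ} ℓ-div
  t,a≡ = DivInt⇒multiple {2 * suc k′ ∸ 1} {a} (subst (DivInt (2 * suc k′ ∸ 1)) αℓ≡a αℓ-div)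
  r = proj₁ r,ℓ≡
  t = proj₁ t,a≡
  2k-1≡L : 2 * suc k′ ∸ 1 ≡ L
  2k-1≡L = trans (ℕₚ.+-suc k′ (k′ + 0)) (cong (λ t → suc (k′ + t)) (ℕₚ.+-identityʳ k′))
  ℓ≡Lr : ℓ ≡ L * r
  ℓ≡Lr = trans (proj₂ r,ℓ≡) (cong (_* r) 2k-1≡L)
  a≡Lt : a ≡ L * t
  a≡Lt = trans (proj₂ t,a≡) (cong (_* t) 2k-1≡L)
  instance
    ℓ/1≥0 = ℚₚ.normalize-nonNeg ℓ 1
  k′ℓ≤ka : k′ * ℓ ≤ a * suc k′
  k′ℓ≤ka = fraction-≤ k′ k′ ℓ a (subst ((+ k′ / suc k′) *ℚ (+ ℓ / 1) ≤ℚ_) αℓ≡a (ℚₚ.*-monoʳ-≤-nonNeg (+ ℓ / 1) k′/k≤α))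
  a≤ℓ : a ≤ ℓ
  a≤ℓ = fraction-≥ ℓ a (subst (_≤ℚ (+ 1 / 1) *ℚ (+ ℓ / 1)) αℓ≡a (ℚₚ.*-monoʳ-≤-nonNeg (+ ℓ / 1) α≤1))
  k′r≤kt : k′ * r ≤ suc k′ * t
  k′r≤kt = ℕₚ.*-cancelˡ-≤ L (subst₂ _≤_
    (trans (cong (k′ *_) ℓ≡Lr) (solve 3 (λ k l r → k :* (l :* r) := l :* (k :* r)) refl k′ L r))
    (trans (cong (_* suc k′) a≡Lt) (solve 3 (λ l t k → l :* t :* k := l :* (k :* t)) refl L t (suc k′))) k′ℓ≤ka)
  t≤r : t ≤ r
  t≤r = ℕₚ.*-cancelˡ-≤ L (subst₂ _≤_ a≡Lt ℓ≡Lr a≤ℓ)
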